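{- Let $p$ be a prime and let $U\subseteq\mathbb F_p^2$ with $\#U=np-r$ for some integers $1\leq n\leq p$ and $0\leq r<p$. If $U$ is not contained in the union of $n$ lines, then there are at least $\left\lceil \frac{p+n+2-r}{n+1}\right\rceil$ $U$-special directions.
   Context: A line of $\mathbb F_p^2$ is either a set $\{(u,v): v=mu-k\}$ with $m,k\in\mathbb F_p$ (its slope, or direction, is $m$) or a vertical set $\{(u,v):u=c\}$ with $c\in\mathbb F_p$ (its slope is $\infty$); parallel lines have the same slope, and the $p+1$ directions are identified with $\mathbb F_p\cup\{\infty\}$. For $U\subseteq\mathbb F_p^2$ put $\theta=\#U/p$. A line $\ell$ is $U$-rich if $\#(\ell\cap U)\geq\theta+1$ and $U$-poor if $\#(\ell\cap U)\leq\theta-1$. A direction $m\in\mathbb F_p\cup\{\infty\}$ is $U$-special if there is a line with slope $m$ that is $U$-rich or $U$-poor. -}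

module Defs where

open import Data.Nat using (ℕ; zero; suc; _+_; _*_; _∸_; _≤_; NonZero)
open import Data.Nat.DivMod using (_mod_; _/_)
open import Data.Fin using (Fin; toℕ)
open import Data.Fin.Properties using () renaming (_≟_ to _≟ᶠ_)
open import Data.Bool using (Bool; true; false; _∧_; if_then_else_)
open import Data.List using (List; map; cartesianProduct)
open import Data.Nat.ListAction using (sum)
open import Data.List.Base using (allFin)
open import Data.Product using (_×_; _,_; ∃; Σ)
open import Data.Sum using (_⊎_)
open import Relation.Binary.PropositionalEquality using (_≡_)
open import Relation.Nullary.Decidable using (⌊_⌋)

-- Points of F_p^2, with F_p modelled as Fin p (residues 0..p-1).
Point : ℕ → Set
Point p = Fin p × Fin p

PointSet : ℕ → Set
PointSet p = Point p → Bool

-- Lines: nonvert m k = {(u,v) : v = m u - k},  vert c = {(u,v) : u = c}.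
data Line (p : ℕ) : Set where
  nonvert : Fin p → Fin p → Line p
  vert    : Fin p → Line p

data Direction (p : ℕ) : Set where
  fin : Fin p → Direction p
  ∞   : Direction p

slope : ∀ {p} → Line p → Direction p
slope (nonvert m k) = fin m
slope (vert c)      = ∞

-- Membership of a point in a line (arithmetic mod p):
-- v = m u - k  iff  v + k ≡ m u (mod p).
onLine : ∀ {p} .{{_ : NonZero p}} → Line p → Point p → Bool
onLine {p} (nonvert m k) (u , v) =
  ⌊ ((toℕ v + toℕ k) mod p) ≟ᶠ ((toℕ m * toℕ u) mod p) ⌋
onLine (vert c) (u , v) = ⌊ u ≟ᶠ c ⌋

allPoints : (p : ℕ) → List (Point p)
allPoints p = cartesianProduct (allFin p) (allFin p)

countPts : (p : ℕ) → PointSet p → ℕ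
countPts p P = sum (map (λ x → if P x then 1 else 0) (allPoints p))

card : ∀ {p} → PointSet p → ℕ
card {p} U = countPts p U

cardOn : ∀ {p} .{{_ : NonZero p}} → Line p → PointSet p → ℕ
cardOn {p} ℓ U = countPts p (λ x → onLine ℓ x ∧ U x)

-- With θ = #U / p:
-- ℓ is U-rich  iff  #(ℓ∩U) ≥ θ + 1  iff  p·#(ℓ∩U) ≥ #U + p   (p > 0)
Rich : ∀ {p} .{{_ : NonZero p}} → PointSet p → Line p → Set
Rich {p} U ℓ = card U + p ≤ p * cardOn ℓ U

-- ℓ is U-poor  iff  #(ℓ∩U) ≤ θ - 1  iff  p·#(ℓ∩U) + p ≤ #U
Poor : ∀ {p} .{{_ : NonZero p}} → PointSet p → Line p → Set
Poor {p} U ℓ = p * cardOn ℓ U + p ≤ card U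

Special : ∀ {p} .{{_ : NonZero p}} → PointSet p → Direction p → Set
Special {p} U d = Σ (Line p) λ ℓ → slope ℓ ≡ d × (Rich U ℓ ⊎ Poor U ℓ)

CoveredByLines : ∀ {p} .{{_ : NonZero p}} → (n : ℕ) → PointSet p → Set
CoveredByLines {p} n U =
  Σ (Fin n → Line p) λ ls →
    (x : Point p) → U x ≡ true → Σ (Fin n) λ i → onLine (ls i) x ≡ true

⌈_/_⌉ : ℕ → (b : ℕ) → .{{_ : NonZero b}} → ℕ
⌈ a / b ⌉ = (a + b ∸ 1) / b

{-# OPTIONS --safe #-}
-- Choose coordinates in which ∞ is a special direction, let Y be the set of the N slopes that are
-- not special and D = p - N; the claim is that (n+1) D + r ≤ p forces U into n lines.
--
-- The Rédei polynomial R(X,Y) = ∏_{(u,v) ∈ U} (X - (v - uY)) divides Zⁿ, Z = ∏_{x ∈ F_p} (X - x), at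
-- every y ∈ Y.  Dividing Zⁿ by R with remainder gives P = R f of total degree np that vanishes to
-- order n at all points (x,y) with y ∈ Y.  Hence, for every y, P(X,y) = Σ_{i ≤ n} Zⁱ dᵢ with dₙ = 1
-- and deg dᵢ ≤ (n-i) D.
--
-- Since Z′ is a constant κ, the polynomial Z P′ - c P with c = dₙ₋₁′ + nκ (derivatives in X, y fixed) is
-- Σ_{i<n} Zⁱ γᵢ with γᵢ = dᵢ₋₁′ + (iκ - c) dᵢ.  It is divisible by R(X,y), which splits over F_p, and its
-- degree is less than #U, so all γᵢ vanish.  If a is the least index with dₐ ≠ 0, this gives c = aκ and
-- deg dₐ ≤ n - a, and every x that is not a root of dₐ is a root of R(X,y) of multiplicity at most a.
-- So if some line of slope y has more than n points, then some line of slope y has at least p - r.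
--
-- If no line of finite slope through a point of U has more than n points, then the vertical line
-- through it has at least p - r.  So there always is a line ℓ with at least p - r points.  On the dual
-- line of each point of ℓ, P has more zeros than its degree; hence the full product of linear factors
-- over ℓ divides P, and dividing it out removes ℓ from U and lowers n by one.
module Submission where

open import Defs
open import Algebra.Bundles using (CommutativeRing; RawRing)
open import Algebra.Structures using (IsCommutativeRing)
import Algebra.Properties.Ring
import Algebra.Properties.Semiring.Mult
import Algebra.Solver.Ring
open import Algebra.Solver.Ring.AlmostCommutativeRing using (fromCommutativeRing; _-Raw-AlmostCommutative⟶_)
import Algebra.Solver.Ring.NaturalCoefficients.Default
open import Data.Bool using (Bool; true; false; _∧_; if_then_else_)
import Data.Bool.Properties as Bool
open import Data.Empty using (⊥-elim)
open import Data.Fin using (Fin; toℕ)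
import Data.Fin.Properties as Fin
open import Data.List using (List; []; _∷_; map; length; _++_; filter; allFin; lookup; replicate)
import Data.List.Properties as List
open import Data.List.Membership.Propositional using (_∈_; _∉_)
open import Data.List.Membership.Propositional.Properties using (∈-allFin; ∈-cartesianProduct⁺; ∈-filter⁺; ∈-filter⁻; ∈-map⁺; ∈-map⁻; ∈-length)
open import Data.List.Relation.Unary.All as All using (All; []; _∷_)
import Data.List.Relation.Unary.All.Properties as All
open import Data.List.Relation.Unary.All.Properties using (all-filter)
open import Data.List.Relation.Unary.AllPairs using ([]; _∷_)
open import Data.List.Relation.Unary.Any as Any using (Any; here; there; any?)
open import Data.List.Relation.Unary.Unique.Propositional using (Unique)
open import Data.List.Relation.Unary.Unique.Propositional.Properties as Unique using (filter⁺)
open import Data.Maybe.Base using (Maybe; just; nothing)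
open import Data.Nat as ℕ using (ℕ; zero; suc; _≤_; _<_; z≤n; s≤s; _∸_; NonZero)
open import Data.Nat.Coprimality using (prime⇒coprime; coprime-Bézout)
open import Data.Nat.DivMod as ℕ using (_mod_; _%_)
open import Data.Nat.GCD using (module Bézout)
open import Data.Nat.ListAction using (sum)
open import Data.Nat.Primality using (Prime; prime⇒nonTrivial)
import Data.Nat.Properties as ℕ
open import Data.Nat.Tactic.RingSolver using (solve-∀)
open import Data.Product using (_×_; _,_; ∃; ∃₂; Σ; proj₁; proj₂)
open import Data.Sum using (_⊎_; inj₁; inj₂)
open import Data.Unit using (⊤; tt)
open import Function using (_∘_; id)
open import Level using (0ℓ)
open import Relation.Binary.Bundles using (Setoid)
open import Relation.Binary.PropositionalEquality as ≡ using (_≡_; _≢_)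
import Relation.Binary.Reasoning.Setoid
open import Relation.Nullary using (¬_; Dec; yes; no; contradiction)
open import Relation.Nullary.Decidable using (¬?; ⌊_⌋; _⊎-dec_)

-- Why the digits are so small: a polynomial that vanishes on all lines Y = y with y ∈ Y is
-- divisible by a polynomial of degree N in the second variable alone. Giving up one power of Z
-- frees p degrees and this division takes back N of them, so each power costs the digits only D.
-- The hypothesis (n+1) D + r ≤ p serves three purposes. Every γᵢ has degree below (n+1) D ≤ p, so
-- the expansion in powers of Z is unique. The degree of Z P′ - c P stays below #U because 2 D + r ≤
-- p, which the term i = n-1 demands. On the dual line of a point of a long sloped line, P has
-- degree at most np = nN + nD, and nN zeros over Y together with p - r further ones exceed this
-- once nD < p - r. The induction carries P along with U: divisibility by R and the order over Y
-- pass to the quotient by a full line even where U fills that line only partly. The vertical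
-- direction is special but not among the D slopes, so there are 1 + D special directions, which
-- explains n + 2 instead of 1 in the numerator p + n + 2 - r.

module RingSolver (R : CommutativeRing 0ℓ 0ℓ) where
  open CommutativeRing R
  private
    module M = Algebra.Properties.Semiring.Mult semiring
    module N = Algebra.Solver.Ring.NaturalCoefficients.Default commutativeSemiring
    open Algebra.Properties.Ring ring using (-‿distribˡ-*; -‿distribʳ-*; -‿involutive; -‿+-comm; -0#≈0#)
    open import Relation.Binary.Reasoning.Setoid setoid

    -- The pair (a , b) stands for the integer coefficient a - b.
    Coeff : RawRing 0ℓ 0ℓ
    Coeff = record
      { Carrier = ℕ × ℕ
      ; _≈_ = _≡_
      ; _+_ = λ { (a , b) (c , d) → a ℕ.+ c , b ℕ.+ d }
      ; _*_ = λ { (a , b) (c , d) → a ℕ.* c ℕ.+ b ℕ.* d , a ℕ.* d ℕ.+ b ℕ.* c }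
      ; -_ = λ { (a , b) → b , a }
      ; 0# = 0 , 0
      ; 1# = 1 , 0
      }

    ⟦_⟧ : ℕ × ℕ → Carrier
    ⟦ a , b ⟧ = a M.× 1# + - (b M.× 1#)

    +-hom : ∀ x y → ⟦ RawRing._+_ Coeff x y ⟧ ≈ ⟦ x ⟧ + ⟦ y ⟧
    +-hom (a , b) (c , d) = begin
      (a ℕ.+ c) M.× 1# + - ((b ℕ.+ d) M.× 1#)
        ≈⟨ +-cong (M.×-homo-+ 1# a c) (trans (-‿cong (M.×-homo-+ 1# b d)) (sym (-‿+-comm _ _))) ⟩
      a M.× 1# + c M.× 1# + (- (b M.× 1#) + - (d M.× 1#))
        ≈⟨ N.solve 4 (λ x y z w → x N.:+ y N.:+ (z N.:+ w) N.:= (x N.:+ z) N.:+ (y N.:+ w)) refl _ _ _ _ ⟩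
      ⟦ a , b ⟧ + ⟦ c , d ⟧ ∎

    ×*-hom : ∀ a b c d → (a ℕ.* b ℕ.+ c ℕ.* d) M.× 1# ≈ (a M.× 1#) * (b M.× 1#) + (c M.× 1#) * (d M.× 1#)
    ×*-hom a b c d = trans (M.×-homo-+ 1# (a ℕ.* b) (c ℕ.* d)) (+-cong (M.×1-homo-* a b) (M.×1-homo-* c d))

    neg*neg : ∀ x y → x * y ≈ (- x) * (- y)
    neg*neg x y = begin
      x * y           ≈⟨ -‿involutive (x * y) ⟨
      - - (x * y)     ≈⟨ -‿cong (-‿distribʳ-* x y) ⟩
      - (x * (- y))   ≈⟨ -‿distribˡ-* x (- y) ⟩
      (- x) * (- y)   ∎

    *-hom : ∀ x y → ⟦ RawRing._*_ Coeff x y ⟧ ≈ ⟦ x ⟧ * ⟦ y ⟧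
    *-hom (a , b) (c , d) = begin
      (a ℕ.* c ℕ.+ b ℕ.* d) M.× 1# + - ((a ℕ.* d ℕ.+ b ℕ.* c) M.× 1#)
        ≈⟨ +-cong (trans (×*-hom a c b d) (+-congˡ (neg*neg B E)))
                  (trans (-‿cong (×*-hom a d b c))
                    (trans (sym (-‿+-comm _ _)) (+-cong (-‿distribʳ-* A E) (-‿distribˡ-* B C)))) ⟩
      A * C + (- B) * (- E) + (A * (- E) + (- B) * C)
        ≈⟨ N.solve 4 (λ x y z w → x N.:* z N.:+ y N.:* w N.:+ (x N.:* w N.:+ y N.:* z)
                                   N.:= (x N.:+ y) N.:* (z N.:+ w)) refl A (- B) C (- E) ⟩
      (A + - B) * (C + - E) ∎
      where
      A = a M.× 1#
      B = b M.× 1#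
      C = c M.× 1#
      E = d M.× 1#

    -hom : ∀ x → ⟦ RawRing.-_ Coeff x ⟧ ≈ - ⟦ x ⟧
    -hom (a , b) = begin
      b M.× 1# + - (a M.× 1#)      ≈⟨ +-comm _ _ ⟩
      - (a M.× 1#) + b M.× 1#      ≈⟨ +-congˡ (sym (-‿involutive _)) ⟩
      - (a M.× 1#) + - - (b M.× 1#) ≈⟨ -‿+-comm _ _ ⟩
      - (a M.× 1# + - (b M.× 1#))  ∎

    1-hom : 1# + 0# + - 0# ≈ 1#
    1-hom = trans (+-cong (+-identityʳ 1#) -0#≈0#) (+-identityʳ 1#)

    morphism : Coeff -Raw-AlmostCommutative⟶ fromCommutativeRing R
    morphism = record
      { ⟦_⟧ = ⟦_⟧ ; +-homo = +-hom ; *-homo = *-hom ; -‿homo = -hom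
      ; 0-homo = -‿inverseʳ 0# ; 1-homo = 1-hom }

    cancel : ∀ a b c d → a ℕ.+ d ≡ c ℕ.+ b → ⟦ a , b ⟧ ≈ ⟦ c , d ⟧
    cancel a b c d e = begin
      A + - B                      ≈⟨ +-identityʳ _ ⟨
      A + - B + 0#                 ≈⟨ +-congˡ (-‿inverseʳ E) ⟨
      A + - B + (E + - E)
        ≈⟨ N.solve 4 (λ x y z w → x N.:+ y N.:+ (z N.:+ w) N.:= (x N.:+ z) N.:+ (y N.:+ w)) refl A (- B) E (- E) ⟩
      (A + E) + (- B + - E)        ≈⟨ +-congʳ (trans (sym (M.×-homo-+ 1# a d)) (trans (M.×-congˡ e) (M.×-homo-+ 1# c b))) ⟩
      (C + B) + (- B + - E)
        ≈⟨ N.solve 4 (λ x y z w → (x N.:+ y) N.:+ (z N.:+ w) N.:= (x N.:+ w) N.:+ (y N.:+ z)) refl C B (- B) (- E) ⟩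
      C + - E + (B + - B)          ≈⟨ +-congˡ (-‿inverseʳ B) ⟩
      C + - E + 0#                 ≈⟨ +-identityʳ _ ⟩
      C + - E                      ∎
      where
      A = a M.× 1#
      B = b M.× 1#
      C = c M.× 1#
      E = d M.× 1#

    -- Coefficients are compared as integers, so the test is sound in every commutative ring; an
    -- equality that holds only in characteristic p is answered by `nothing`.
    dec : ∀ x y → Maybe (⟦ x ⟧ ≈ ⟦ y ⟧)
    dec (a , b) (c , d) with a ℕ.+ d ℕ.≟ c ℕ.+ b
    ... | yes e = just (cancel a b c d e)
    ... | no _  = nothing

  open Algebra.Solver.Ring Coeff (fromCommutativeRing R) morphism dec public
    using (solve; _:=_; _:+_; _:*_; :-_)

-- Polynomials as coefficient lists over a commutative ring

module Polynomial (R : CommutativeRing 0ℓ 0ℓ) where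
  open CommutativeRing R
  open Algebra.Properties.Ring ring using (-0#≈0#)
  open Algebra.Properties.Semiring.Mult semiring using () renaming (_×_ to _×ₙ_; ×-congʳ to ×ₙ-congʳ)
  private
    module RS = RingSolver R
  open RS using (_:=_; _:+_; _:*_; :-_)

  infix 4 _≋_
  infixl 6 _⊕_
  infixl 7 _⊛_

  Poly : Set
  Poly = List Carrier

  coeff : Poly → ℕ → Carrier
  coeff []      _       = 0#
  coeff (a ∷ p) zero    = a
  coeff (a ∷ p) (suc k) = coeff p k

  -- Lists may end in zeros, hence equality is coefficientwise. As a record it lets `p` and `q` be
  -- inferred from a proof.
  record _≋_ (p q : Poly) : Set where
    constructor mk
    field at : ∀ k → coeff p k ≈ coeff q k
  open _≋_ public

  -- The degree of p is less than m.
  record Bnd (m : ℕ) (p : Poly) : Set where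
    constructor mkB
    field vanish : ∀ k → m ≤ k → coeff p k ≈ 0#
  open Bnd public

  ≋-refl : ∀ {p} → p ≋ p
  ≋-refl = mk λ _ → refl

  ≋-sym : ∀ {p q} → p ≋ q → q ≋ p
  ≋-sym e = mk λ k → sym (at e k)

  ≋-trans : ∀ {p q r} → p ≋ q → q ≋ r → p ≋ r
  ≋-trans e f = mk λ k → trans (at e k) (at f k)

  opaque
    _⊕_ : Poly → Poly → Poly
    []      ⊕ q       = q
    (a ∷ p) ⊕ []      = a ∷ p
    (a ∷ p) ⊕ (b ∷ q) = a + b ∷ p ⊕ q

    scale : Carrier → Poly → Poly
    scale a = map (a *_)

    ⊖_ : Poly → Poly
    ⊖_ = map (λ a → - a)

    shift : Poly → Poly
    shift p = 0# ∷ p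

    _⊛_ : Poly → Poly → Poly
    []      ⊛ q = []
    (a ∷ p) ⊛ q = scale a q ⊕ shift (p ⊛ q)

    const : Carrier → Poly
    const a = a ∷ []

    𝟘 : Poly
    𝟘 = []

    coeff-⊕ : ∀ p q k → coeff (p ⊕ q) k ≈ coeff p k + coeff q k
    coeff-⊕ []      q       k       = sym (+-identityˡ _)
    coeff-⊕ (a ∷ p) []      zero    = sym (+-identityʳ _)
    coeff-⊕ (a ∷ p) []      (suc k) = sym (+-identityʳ _)
    coeff-⊕ (a ∷ p) (b ∷ q) zero    = refl
    coeff-⊕ (a ∷ p) (b ∷ q) (suc k) = coeff-⊕ p q k

    coeff-scale : ∀ a p k → coeff (scale a p) k ≈ a * coeff p k
    coeff-scale a []      k       = sym (zeroʳ a)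
    coeff-scale a (b ∷ p) zero    = refl
    coeff-scale a (b ∷ p) (suc k) = coeff-scale a p k

    coeff-⊖ : ∀ p k → coeff (⊖ p) k ≈ - coeff p k
    coeff-⊖ []      k       = sym -0#≈0#
    coeff-⊖ (b ∷ p) zero    = refl
    coeff-⊖ (b ∷ p) (suc k) = coeff-⊖ p k

    coeff-𝟘 : ∀ k → coeff 𝟘 k ≈ 0#
    coeff-𝟘 k = refl

    coeff-shift-zero : ∀ p → coeff (shift p) 0 ≈ 0#
    coeff-shift-zero p = refl

    coeff-shift-suc : ∀ p k → coeff (shift p) (suc k) ≈ coeff p k
    coeff-shift-suc p k = refl

    coeff-const-zero : ∀ a → coeff (const a) 0 ≈ a
    coeff-const-zero a = refl

    coeff-const-suc : ∀ a k → coeff (const a) (suc k) ≈ 0#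
    coeff-const-suc a k = refl

  ⊕-cong : ∀ {p p′ q q′} → p ≋ p′ → q ≋ q′ → p ⊕ q ≋ p′ ⊕ q′
  ⊕-cong {p} {p′} {q} {q′} e f = mk λ k → trans (coeff-⊕ p q k) (trans (+-cong (at e k) (at f k)) (sym (coeff-⊕ p′ q′ k)))

  ⊕-assoc : ∀ p q r → (p ⊕ q) ⊕ r ≋ p ⊕ (q ⊕ r)
  ⊕-assoc p q r = mk λ k → trans (trans (coeff-⊕ (p ⊕ q) r k) (+-congʳ (coeff-⊕ p q k)))
    (trans (+-assoc _ _ _) (sym (trans (coeff-⊕ p (q ⊕ r) k) (+-congˡ (coeff-⊕ q r k)))))

  ⊕-comm : ∀ p q → p ⊕ q ≋ q ⊕ p
  ⊕-comm p q = mk λ k → trans (coeff-⊕ p q k) (trans (+-comm _ _) (sym (coeff-⊕ q p k)))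

  ⊕-identityˡ : ∀ p → 𝟘 ⊕ p ≋ p
  ⊕-identityˡ p = mk λ k → trans (coeff-⊕ 𝟘 p k) (trans (+-congʳ (coeff-𝟘 k)) (+-identityˡ _))

  ⊕-identityʳ : ∀ p → p ⊕ 𝟘 ≋ p
  ⊕-identityʳ p = ≋-trans (⊕-comm p 𝟘) (⊕-identityˡ p)

  ⊖-cong : ∀ {p q} → p ≋ q → ⊖ p ≋ ⊖ q
  ⊖-cong {p} {q} e = mk λ k → trans (coeff-⊖ p k) (trans (-‿cong (at e k)) (sym (coeff-⊖ q k)))

  ⊖-inverseˡ : ∀ p → ⊖ p ⊕ p ≋ 𝟘
  ⊖-inverseˡ p = mk λ k → trans (coeff-⊕ (⊖ p) p k) (trans (+-congʳ (coeff-⊖ p k)) (trans (-‿inverseˡ _) (sym (coeff-𝟘 k))))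

  ⊖-inverseʳ : ∀ p → p ⊕ ⊖ p ≋ 𝟘
  ⊖-inverseʳ p = ≋-trans (⊕-comm p (⊖ p)) (⊖-inverseˡ p)

  scale-cong : ∀ {a b p q} → a ≈ b → p ≋ q → scale a p ≋ scale b q
  scale-cong {a} {b} {p} {q} e f = mk λ k → trans (coeff-scale a p k) (trans (*-cong e (at f k)) (sym (coeff-scale b q k)))

  scale-⊕ : ∀ a p q → scale a (p ⊕ q) ≋ scale a p ⊕ scale a q
  scale-⊕ a p q = mk λ k → trans (coeff-scale a (p ⊕ q) k) (trans (*-congˡ (coeff-⊕ p q k))
    (trans (distribˡ _ _ _) (sym (trans (coeff-⊕ (scale a p) (scale a q) k) (+-cong (coeff-scale a p k) (coeff-scale a q k))))))

  scale-scale : ∀ a b p → scale a (scale b p) ≋ scale (a * b) p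
  scale-scale a b p = mk λ k → trans (coeff-scale a (scale b p) k) (trans (*-congˡ (coeff-scale b p k))
    (trans (sym (*-assoc _ _ _)) (sym (coeff-scale (a * b) p k))))

  scale-0 : ∀ {a} p → a ≈ 0# → scale a p ≋ 𝟘
  scale-0 {a} p e = mk λ k → trans (coeff-scale a p k) (trans (*-congʳ e) (trans (zeroˡ _) (sym (coeff-𝟘 k))))

  scale-1 : ∀ p → scale 1# p ≋ p
  scale-1 p = mk λ k → trans (coeff-scale 1# p k) (*-identityˡ _)

  opaque
    unfolding shift 𝟘 const

    shift-cong : ∀ {p q} → p ≋ q → shift p ≋ shift q
    shift-cong e = mk λ { zero → refl ; (suc k) → at e k }

    shift-⊕ : ∀ p q → shift (p ⊕ q) ≋ shift p ⊕ shift q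
    shift-⊕ p q = mk λ { zero → sym (trans (coeff-⊕ (shift p) (shift q) 0) (+-identityʳ _))
                       ; (suc k) → trans (coeff-⊕ p q k) (sym (coeff-⊕ (shift p) (shift q) (suc k))) }

    shift-scale : ∀ a p → shift (scale a p) ≋ scale a (shift p)
    shift-scale a p = mk λ { zero → sym (trans (coeff-scale a (shift p) 0) (zeroʳ a))
                           ; (suc k) → trans (coeff-scale a p k) (sym (coeff-scale a (shift p) (suc k))) }

    shift-𝟘 : ∀ {p} → p ≋ 𝟘 → shift p ≋ 𝟘
    shift-𝟘 e = mk λ { zero → refl ; (suc k) → at e k }

  private
    ≋-setoid : Setoid 0ℓ 0ℓ
    ≋-setoid = record { Carrier = Poly ; _≈_ = _≋_
      ; isEquivalence = record { refl = ≋-refl ; sym = ≋-sym ; trans = ≋-trans } }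
  module ≋R = Relation.Binary.Reasoning.Setoid ≋-setoid
  open ≋R

  private
    interchange : ∀ p q r s → (p ⊕ q) ⊕ (r ⊕ s) ≋ (p ⊕ r) ⊕ (q ⊕ s)
    interchange p q r s = mk λ k → trans
      (trans (coeff-⊕ (p ⊕ q) (r ⊕ s) k) (+-cong (coeff-⊕ p q k) (coeff-⊕ r s k)))
      (trans (RS.solve 4 (λ a b c d → (a :+ b) :+ (c :+ d) := (a :+ c) :+ (b :+ d)) refl _ _ _ _)
             (sym (trans (coeff-⊕ (p ⊕ r) (q ⊕ s) k) (+-cong (coeff-⊕ p r k) (coeff-⊕ q s k)))))

    swap-middle : ∀ p q r → p ⊕ (q ⊕ r) ≋ q ⊕ (p ⊕ r)
    swap-middle p q r = ≋-trans (≋-sym (⊕-assoc p q r)) (≋-trans (⊕-cong (⊕-comm p q) ≋-refl) (⊕-assoc q p r))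

    ⊕-congˡ : ∀ {p q q′} → q ≋ q′ → p ⊕ q ≋ p ⊕ q′
    ⊕-congˡ = ⊕-cong ≋-refl

    ⊕-congʳ : ∀ {p p′ q} → p ≋ p′ → p ⊕ q ≋ p′ ⊕ q
    ⊕-congʳ e = ⊕-cong e ≋-refl

  opaque
    unfolding _⊛_

    cons-⊛ : ∀ a p q → (a ∷ p) ⊛ q ≋ scale a q ⊕ shift (p ⊛ q)
    cons-⊛ a p q = ≋-refl

    nil-⊛ : ∀ q → [] ⊛ q ≋ 𝟘
    nil-⊛ q = ≋-refl

    cons-split : ∀ a p → a ∷ p ≋ const a ⊕ shift p
    cons-split a p = mk λ { zero → sym (+-identityʳ a) ; (suc k) → refl }

    ⊛-congʳ : ∀ p {q q′} → q ≋ q′ → p ⊛ q ≋ p ⊛ q′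
    ⊛-congʳ []      e = ≋-refl
    ⊛-congʳ (a ∷ p) e = ⊕-cong (scale-cong refl e) (shift-cong (⊛-congʳ p e))

    ⊛-zeroʳ : ∀ p → p ⊛ [] ≋ []
    ⊛-zeroʳ []      = ≋-refl
    ⊛-zeroʳ (a ∷ p) = shift-𝟘 (⊛-zeroʳ p)

    -- The recursion of `_⊛_` mirrored in its second argument; commutativity follows from it by
    -- induction.
    ⊛-cons : ∀ p b q → p ⊛ (b ∷ q) ≋ scale b p ⊕ shift (p ⊛ q)
    ⊛-cons [] b q = ≋-sym (shift-𝟘 ≋-refl)
    ⊛-cons (a ∷ p) b q = begin
      scale a (b ∷ q) ⊕ shift (p ⊛ (b ∷ q))
        ≈⟨ mk (λ { zero → +-congʳ (*-comm a b) ; (suc k) → at eq k }) ⟩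
      scale b (a ∷ p) ⊕ shift (scale a q ⊕ shift (p ⊛ q)) ∎
      where
      eq : scale a q ⊕ p ⊛ (b ∷ q) ≋ scale b p ⊕ (scale a q ⊕ shift (p ⊛ q))
      eq = ≋-trans (⊕-congˡ (⊛-cons p b q)) (swap-middle (scale a q) (scale b p) (shift (p ⊛ q)))

    ⊛-comm : ∀ p q → p ⊛ q ≋ q ⊛ p
    ⊛-comm []      q = ≋-sym (⊛-zeroʳ q)
    ⊛-comm (a ∷ p) q = ≋-trans (⊕-congˡ (shift-cong (⊛-comm p q))) (≋-sym (⊛-cons q a p))

  ⊛-cong : ∀ {p p′ q q′} → p ≋ p′ → q ≋ q′ → p ⊛ q ≋ p′ ⊛ q′
  ⊛-cong {p} {p′} {q} {q′} e f = begin
    p ⊛ q    ≈⟨ ⊛-congʳ p f ⟩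
    p ⊛ q′   ≈⟨ ⊛-comm p q′ ⟩
    q′ ⊛ p   ≈⟨ ⊛-congʳ q′ e ⟩
    q′ ⊛ p′  ≈⟨ ⊛-comm q′ p′ ⟩
    p′ ⊛ q′  ∎

  opaque
    unfolding _⊛_

    ⊛-distribˡ : ∀ p q r → p ⊛ (q ⊕ r) ≋ p ⊛ q ⊕ p ⊛ r
    ⊛-distribˡ []      q r = ≋-refl
    ⊛-distribˡ (a ∷ p) q r = begin
      scale a (q ⊕ r) ⊕ shift (p ⊛ (q ⊕ r))
        ≈⟨ ⊕-cong (scale-⊕ a q r) (≋-trans (shift-cong (⊛-distribˡ p q r)) (shift-⊕ (p ⊛ q) (p ⊛ r))) ⟩
      (scale a q ⊕ scale a r) ⊕ (shift (p ⊛ q) ⊕ shift (p ⊛ r))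
        ≈⟨ interchange (scale a q) (scale a r) (shift (p ⊛ q)) (shift (p ⊛ r)) ⟩
      (scale a q ⊕ shift (p ⊛ q)) ⊕ (scale a r ⊕ shift (p ⊛ r)) ∎

  ⊛-distribʳ : ∀ p q r → (q ⊕ r) ⊛ p ≋ q ⊛ p ⊕ r ⊛ p
  ⊛-distribʳ p q r = ≋-trans (⊛-comm _ p) (≋-trans (⊛-distribˡ p q r) (⊕-cong (⊛-comm p q) (⊛-comm p r)))

  opaque
    unfolding _⊛_

    scale-⊛ : ∀ a p q → scale a p ⊛ q ≋ scale a (p ⊛ q)
    scale-⊛ a []      q = ≋-refl
    scale-⊛ a (b ∷ p) q = ≋-trans
      (⊕-cong (≋-sym (scale-scale a b q)) (≋-trans (shift-cong (scale-⊛ a p q)) (shift-scale a (p ⊛ q))))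
      (≋-sym (scale-⊕ a (scale b q) (shift (p ⊛ q))))

    shift-⊛ : ∀ p q → shift p ⊛ q ≋ shift (p ⊛ q)
    shift-⊛ p q = ≋-trans (⊕-congʳ (scale-0 q refl)) (⊕-identityˡ _)

    ⊛-assoc : ∀ p q r → (p ⊛ q) ⊛ r ≋ p ⊛ (q ⊛ r)
    ⊛-assoc []      q r = ≋-refl
    ⊛-assoc (a ∷ p) q r = begin
      (scale a q ⊕ shift (p ⊛ q)) ⊛ r        ≈⟨ ⊛-distribʳ r (scale a q) (shift (p ⊛ q)) ⟩
      scale a q ⊛ r ⊕ shift (p ⊛ q) ⊛ r
        ≈⟨ ⊕-cong (scale-⊛ a q r) (≋-trans (shift-⊛ (p ⊛ q) r) (shift-cong (⊛-assoc p q r))) ⟩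
      scale a (q ⊛ r) ⊕ shift (p ⊛ (q ⊛ r))  ∎

    const-⊛ : ∀ a p → const a ⊛ p ≋ scale a p
    const-⊛ a p = ≋-trans (⊕-congˡ (shift-𝟘 ≋-refl)) (⊕-identityʳ _)

  const-cong : ∀ {a b} → a ≈ b → const a ≋ const b
  const-cong {a} {b} e = mk λ { zero → trans (coeff-const-zero a) (trans e (sym (coeff-const-zero b)))
                              ; (suc k) → trans (coeff-const-suc a k) (sym (coeff-const-suc b k)) }

  opaque
    unfolding _⊛_

    const-+ : ∀ a b → const (a + b) ≋ const a ⊕ const b
    const-+ a b = ≋-refl

    const-* : ∀ a b → const (a * b) ≋ const a ⊛ const b
    const-* a b = ≋-sym (const-⊛ a (const b))

    const-neg : ∀ a → const (- a) ≋ ⊖ const a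
    const-neg a = ≋-refl

    const-0 : const 0# ≋ 𝟘
    const-0 = shift-𝟘 ≋-refl

  coeff-const-⊛ : ∀ a p k → coeff (const a ⊛ p) k ≈ a * coeff p k
  coeff-const-⊛ a p k = trans (at (const-⊛ a p) k) (coeff-scale a p k)

  polyRing : CommutativeRing 0ℓ 0ℓ
  polyRing = record
    { Carrier = Poly ; _≈_ = _≋_ ; _+_ = _⊕_ ; _*_ = _⊛_ ; -_ = ⊖_ ; 0# = 𝟘 ; 1# = const 1#
    ; isCommutativeRing = record
      { isRing = record
        { +-isAbelianGroup = record
          { isGroup = record
            { isMonoid = record
              { isSemigroup = record
                { isMagma = record { isEquivalence = record { refl = ≋-refl ; sym = ≋-sym ; trans = ≋-trans } ; ∙-cong = ⊕-cong }
                ; assoc = ⊕-assoc }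
              ; identity = ⊕-identityˡ , ⊕-identityʳ }
            ; inverse = ⊖-inverseˡ , ⊖-inverseʳ
            ; ⁻¹-cong = ⊖-cong }
          ; comm = ⊕-comm }
        ; *-cong = ⊛-cong
        ; *-assoc = ⊛-assoc
        ; *-identity = 1-⊛ , λ p → ≋-trans (⊛-comm p _) (1-⊛ p)
        ; distrib = ⊛-distribˡ , ⊛-distribʳ }
      ; *-comm = ⊛-comm } }
    where
    1-⊛ : ∀ p → const 1# ⊛ p ≋ p
    1-⊛ p = ≋-trans (const-⊛ 1# p) (scale-1 p)

  opaque
    unfolding _⊛_

    eval : Carrier → Poly → Carrier
    eval x []      = 0#
    eval x (a ∷ p) = a + x * eval x p

    eval-nil : ∀ x → eval x [] ≈ 0#
    eval-nil x = refl

    eval-cons : ∀ x a p → eval x (a ∷ p) ≈ a + x * eval x p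
    eval-cons x a p = refl

    eval-zero : ∀ x {p} → p ≋ 𝟘 → eval x p ≈ 0#
    eval-zero x {[]}    e = refl
    eval-zero x {a ∷ p} e = trans (+-cong (at e 0) (trans (*-congˡ (eval-zero x {p} (mk λ k → at e (suc k)))) (zeroʳ x))) (+-identityʳ _)

    eval-cong : ∀ x {p q} → p ≋ q → eval x p ≈ eval x q
    eval-cong x {[]}    {q}     e = sym (eval-zero x {q} (≋-sym e))
    eval-cong x {a ∷ p} {[]}    e = eval-zero x {a ∷ p} e
    eval-cong x {a ∷ p} {b ∷ q} e = +-cong (at e 0) (*-congˡ (eval-cong x {p} {q} (mk λ k → at e (suc k))))

    eval-⊕ : ∀ x p q → eval x (p ⊕ q) ≈ eval x p + eval x q
    eval-⊕ x []      q       = sym (+-identityˡ _)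
    eval-⊕ x (a ∷ p) []      = sym (+-identityʳ _)
    eval-⊕ x (a ∷ p) (b ∷ q) = trans (+-congˡ (*-congˡ (eval-⊕ x p q)))
      (RS.solve 5 (λ a b x p q → (a :+ b) :+ x :* (p :+ q) := (a :+ x :* p) :+ (b :+ x :* q)) refl a b x _ _)

    eval-scale : ∀ x a p → eval x (scale a p) ≈ a * eval x p
    eval-scale x a []      = sym (zeroʳ a)
    eval-scale x a (b ∷ p) = trans (+-congˡ (*-congˡ (eval-scale x a p)))
      (RS.solve 4 (λ a b x p → a :* b :+ x :* (a :* p) := a :* (b :+ x :* p)) refl a b x _)

    eval-⊖ : ∀ x p → eval x (⊖ p) ≈ - eval x p
    eval-⊖ x []      = sym -0#≈0#
    eval-⊖ x (b ∷ p) = trans (+-congˡ (*-congˡ (eval-⊖ x p)))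
      (RS.solve 3 (λ b x p → :- b :+ x :* (:- p) := :- (b :+ x :* p)) refl b x _)

    eval-⊛ : ∀ x p q → eval x (p ⊛ q) ≈ eval x p * eval x q
    eval-⊛ x []      q = sym (zeroˡ _)
    eval-⊛ x (a ∷ p) q = trans (eval-⊕ x (scale a q) (shift (p ⊛ q)))
      (trans (+-cong (eval-scale x a q) (trans (+-identityˡ _) (*-congˡ (eval-⊛ x p q))))
        (RS.solve 4 (λ a x p q → a :* q :+ x :* (p :* q) := (a :+ x :* p) :* q) refl a x _ _))

    eval-const : ∀ x a → eval x (const a) ≈ a
    eval-const x a = trans (+-congˡ (zeroʳ x)) (+-identityʳ a)

    eval-shift : ∀ x p → eval x (shift p) ≈ x * eval x p
    eval-shift x p = +-identityˡ _

  opaque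
    unfolding _⊛_ eval

    lin : Carrier → Poly
    lin s = - s ∷ 1# ∷ []

    lin-⊛ : ∀ s q → lin s ⊛ q ≋ shift q ⊕ scale (- s) q
    lin-⊛ s q = ≋-trans (⊕-congˡ (shift-cong (≋-trans (const-⊛ 1# q) (scale-1 q)))) (⊕-comm (scale (- s) q) (shift q))

    lin-shift : ∀ s → lin s ≋ const (- s) ⊕ shift (const 1#)
    lin-shift s = cons-split (- s) (const 1#)

    coeff-lin-zero : ∀ s q → coeff (lin s ⊛ q) 0 ≈ - s * coeff q 0
    coeff-lin-zero s q = trans (at (lin-⊛ s q) 0)
      (trans (coeff-⊕ (shift q) (scale (- s) q) 0) (trans (+-identityˡ _) (coeff-scale (- s) q 0)))

    coeff-lin : ∀ s q k → coeff (lin s ⊛ q) (suc k) ≈ coeff q k + - s * coeff q (suc k)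
    coeff-lin s q k = trans (at (lin-⊛ s q) (suc k))
      (trans (coeff-⊕ (shift q) (scale (- s) q) (suc k)) (+-congˡ (coeff-scale (- s) q (suc k))))

    eval-lin : ∀ x s → eval x (lin s) ≈ x + - s
    eval-lin x s = trans (+-congˡ (trans (*-congˡ (trans (+-congˡ (zeroʳ x)) (+-identityʳ _))) (*-identityʳ x))) (+-comm _ _)

    lin-cong : ∀ {s t} → s ≈ t → lin s ≋ lin t
    lin-cong e = mk λ { zero → -‿cong e ; (suc zero) → refl ; (suc (suc k)) → refl }

    lin-diff : ∀ s t → lin s ≋ lin t ⊕ const (t + - s)
    lin-diff s t = mk λ { zero → RS.solve 2 (λ s t → :- s := :- t :+ (t :+ :- s)) refl s t ; (suc zero) → refl ; (suc (suc k)) → refl }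

    Bnd-lin-2 : ∀ s → Bnd 2 (lin s)
    Bnd-lin-2 s = mkB λ { (suc (suc k)) (s≤s (s≤s _)) → refl }

    lin-1 : ∀ s → coeff (lin s) 1 ≈ 1#
    lin-1 s = refl

  Bnd-≤ : ∀ {m n p} → m ≤ n → Bnd m p → Bnd n p
  Bnd-≤ m≤n b = mkB λ k n≤k → vanish b k (ℕ.≤-trans m≤n n≤k)

  Bnd-resp : ∀ {m p q} → p ≋ q → Bnd m p → Bnd m q
  Bnd-resp e b = mkB λ k m≤k → trans (sym (at e k)) (vanish b k m≤k)

  Bnd-⊕ : ∀ {m p q} → Bnd m p → Bnd m q → Bnd m (p ⊕ q)
  Bnd-⊕ {m} {p} {q} b c = mkB λ k m≤k → trans (coeff-⊕ p q k) (trans (+-cong (vanish b k m≤k) (vanish c k m≤k)) (+-identityʳ _))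

  Bnd-⊖ : ∀ {m p} → Bnd m p → Bnd m (⊖ p)
  Bnd-⊖ {m} {p} b = mkB λ k m≤k → trans (coeff-⊖ p k) (trans (-‿cong (vanish b k m≤k)) -0#≈0#)

  Bnd-𝟘 : ∀ {m} → Bnd m 𝟘
  Bnd-𝟘 = mkB λ k _ → coeff-𝟘 k

  Bnd-0 : ∀ {p} → Bnd 0 p → p ≋ 𝟘
  Bnd-0 b = mk λ k → trans (vanish b k z≤n) (sym (coeff-𝟘 k))

  Bnd-const : ∀ a → Bnd 1 (const a)
  Bnd-const a = mkB λ { (suc k) _ → coeff-const-suc a k }

  Bnd-shift : ∀ {m p} → Bnd m p → Bnd (suc m) (shift p)
  Bnd-shift {m} {p} b = mkB λ { (suc k) (s≤s m≤k) → trans (coeff-shift-suc p k) (vanish b k m≤k) }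

  Bnd-scale : ∀ {m p} a → Bnd m p → Bnd m (scale a p)
  Bnd-scale {m} {p} a b = mkB λ k m≤k → trans (coeff-scale a p k) (trans (*-congˡ (vanish b k m≤k)) (zeroʳ a))

  Bnd-1⇒const : ∀ {p} → Bnd 1 p → p ≋ const (coeff p 0)
  Bnd-1⇒const {p} b = mk λ { zero → sym (coeff-const-zero (coeff p 0))
                           ; (suc k) → trans (vanish b (suc k) (s≤s z≤n)) (sym (coeff-const-suc _ k)) }

  Bnd-length : ∀ p → Bnd (length p) p
  Bnd-length p = mkB (go p)
    where
    go : ∀ p k → length p ≤ k → coeff p k ≈ 0#
    go []      k       _         = refl
    go (a ∷ p) (suc k) (s≤s l≤k) = go p k l≤k

  Bnd-cons : ∀ {m a p} → Bnd (suc m) (a ∷ p) → Bnd m p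
  Bnd-cons b = mkB λ k m≤k → vanish b (suc k) (s≤s m≤k)

  ⊛-zeroˡ : ∀ {p} q → p ≋ 𝟘 → p ⊛ q ≋ 𝟘
  ⊛-zeroˡ q e = ≋-trans (⊛-cong e ≋-refl) (CommutativeRing.zeroˡ polyRing q)

  Bnd-⊛ : ∀ a b p q → Bnd a p → Bnd (suc b) q → Bnd (a ℕ.+ b) (p ⊛ q)
  Bnd-⊛ zero    b p       q bp bq = Bnd-resp (≋-sym (⊛-zeroˡ q (Bnd-0 bp))) Bnd-𝟘
  Bnd-⊛ (suc a) b []      q bp bq = Bnd-resp (≋-sym (nil-⊛ q)) Bnd-𝟘
  Bnd-⊛ (suc a) b (x ∷ p) q bp bq = Bnd-resp (≋-sym (cons-⊛ x p q))
    (Bnd-⊕ (Bnd-≤ (s≤s (ℕ.m≤n+m b a)) (Bnd-scale x bq))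
      (Bnd-shift (Bnd-⊛ a b p q (Bnd-cons bp) bq)))

  coeff-top : ∀ a b p q → Bnd (suc a) p → Bnd (suc b) q → coeff (p ⊛ q) (a ℕ.+ b) ≈ coeff p a * coeff q b
  coeff-top a b [] q bp bq = trans (at (nil-⊛ q) (a ℕ.+ b)) (trans (coeff-𝟘 _) (sym (zeroˡ _)))
  coeff-top zero b (x ∷ p) q bp bq = trans (at (cons-⊛ x p q) b)
    (trans (coeff-⊕ (scale x q) (shift (p ⊛ q)) b)
      (trans (+-cong (coeff-scale x q b) (trans (at (shift-𝟘 (⊛-zeroˡ q (Bnd-0 (Bnd-cons bp)))) b) (coeff-𝟘 b))) (+-identityʳ _)))
  coeff-top (suc a) b (x ∷ p) q bp bq = trans (at (cons-⊛ x p q) (suc (a ℕ.+ b)))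
    (trans (coeff-⊕ (scale x q) (shift (p ⊛ q)) (suc (a ℕ.+ b)))
      (trans (+-cong (vanish (Bnd-scale x bq) _ (s≤s (ℕ.m≤n+m b a)))
                     (trans (coeff-shift-suc (p ⊛ q) (a ℕ.+ b)) (coeff-top a b p q (Bnd-cons bp) bq)))
             (+-identityˡ _)))

  -- Zero is not decidable in a general ring, so the degree is lowered one step at a time from the
  -- length of the list; a coefficient has to be shown zero only when all later ones are known to
  -- vanish.
  descend : ∀ {p} m → (∀ k → m ≤ k → Bnd (suc k) p → Bnd k p) → Bnd m p
  descend {p} m h = go (length p) (Bnd-≤ (ℕ.m≤n+m _ m) (Bnd-length p))
    where
    go : ∀ d → Bnd (m ℕ.+ d) p → Bnd m p
    go zero    b = ≡.subst (λ i → Bnd i p) (ℕ.+-identityʳ m) b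
    go (suc d) b = go d (h (m ℕ.+ d) (ℕ.m≤m+n m d) (≡.subst (λ i → Bnd i p) (ℕ.+-suc m d) b))

  Bnd-pred : ∀ {k p} → coeff p k ≈ 0# → Bnd (suc k) p → Bnd k p
  Bnd-pred {k} {p} e b = mkB go
    where
    go : ∀ j → k ≤ j → coeff p j ≈ 0#
    go j k≤j with ℕ.m≤n⇒m<n∨m≡n k≤j
    ... | inj₁ k<j    = vanish b j k<j
    ... | inj₂ ≡.refl = e

  -- The factor is monic: the top coefficient of `q` reappears as the next coefficient of the
  -- product. So the degree drops over any commutative ring, in particular over the polynomials in
  -- Y.
  Bnd-lin-inv : ∀ {m} s q → Bnd m (lin s ⊛ q) → Bnd (m ∸ 1) q
  Bnd-lin-inv {m} s q b = descend (m ∸ 1) λ k m≤k bk → Bnd-pred (eq k m≤k bk) bk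
    where
    eq : ∀ k → m ∸ 1 ≤ k → Bnd (suc k) q → coeff q k ≈ 0#
    eq k m≤k bk = trans (sym (trans (coeff-lin s q k) (trans (+-congˡ (trans (*-congˡ (vanish bk (suc k) ℕ.≤-refl)) (zeroʳ _))) (+-identityʳ _))))
      (vanish b (suc k) (ℕ.≤-trans (ℕ.m≤n+m∸n m 1) (s≤s m≤k)))

  lin-zero : ∀ s q → lin s ⊛ q ≋ 𝟘 → q ≋ 𝟘
  lin-zero s q e = Bnd-0 (Bnd-lin-inv {0} s q (Bnd-resp (≋-sym e) Bnd-𝟘))

  private
    module PS = RingSolver polyRing

  ≋⇒⊖ : ∀ {p q} → p ≋ q → p ⊕ ⊖ q ≋ 𝟘
  ≋⇒⊖ {p} {q} e = ≋-trans (⊕-congʳ e) (⊖-inverseʳ q)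

  ⊖⇒≋ : ∀ {p q} → p ⊕ ⊖ q ≋ 𝟘 → p ≋ q
  ⊖⇒≋ {p} {q} e = begin
    p                ≈⟨ PS.solve 2 (λ p q → p PS.:= (p PS.:+ PS.:- q) PS.:+ q) ≋-refl p q ⟩
    (p ⊕ ⊖ q) ⊕ q    ≈⟨ ⊕-congʳ e ⟩
    𝟘 ⊕ q            ≈⟨ ⊕-identityˡ q ⟩
    q                ∎

  lin-cancel : ∀ s {p q} → lin s ⊛ p ≋ lin s ⊛ q → p ≋ q
  lin-cancel s {p} {q} e = ⊖⇒≋ (lin-zero s (p ⊕ ⊖ q) (≋-trans
    (PS.solve 3 (λ l p q → l PS.:* (p PS.:+ PS.:- q) PS.:= l PS.:* p PS.:+ PS.:- (l PS.:* q)) ≋-refl (lin s) p q)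
    (≋⇒⊖ e)))

  Π : List Carrier → Poly
  Π []       = const 1#
  Π (s ∷ ss) = lin s ⊛ Π ss

  Π-++ : ∀ ss ts → Π (ss ++ ts) ≋ Π ss ⊛ Π ts
  Π-++ []       ts = ≋-sym (CommutativeRing.*-identityˡ polyRing _)
  Π-++ (s ∷ ss) ts = ≋-trans (⊛-cong ≋-refl (Π-++ ss ts)) (≋-sym (⊛-assoc (lin s) (Π ss) (Π ts)))

  Bnd-Π : ∀ ss → Bnd (suc (length ss)) (Π ss)
  Bnd-Π []       = Bnd-const 1#
  Bnd-Π (s ∷ ss) = Bnd-⊛ 2 (length ss) (lin s) (Π ss) (Bnd-lin-2 s) (Bnd-Π ss)

  coeff-Π : ∀ ss → coeff (Π ss) (length ss) ≈ 1#
  coeff-Π []       = coeff-const-zero 1#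
  coeff-Π (s ∷ ss) = trans (coeff-top 1 (length ss) (lin s) (Π ss) (Bnd-lin-2 s) (Bnd-Π ss))
    (trans (*-cong (lin-1 s) (coeff-Π ss)) (*-identityˡ 1#))

  Bnd-Π-inv : ∀ {m} ss q → Bnd m (Π ss ⊛ q) → Bnd (m ∸ length ss) q
  Bnd-Π-inv []       q b = Bnd-resp (CommutativeRing.*-identityˡ polyRing q) b
  Bnd-Π-inv {m} (s ∷ ss) q b = ≡.subst (λ i → Bnd i q) (ℕ.∸-+-assoc m 1 (length ss))
    (Bnd-Π-inv {m ∸ 1} ss q (Bnd-lin-inv s (Π ss ⊛ q) (Bnd-resp (⊛-assoc (lin s) (Π ss) q) b)))

  eval-lin-⊛ : ∀ x s q → eval x (lin s ⊛ q) ≈ (x + - s) * eval x q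
  eval-lin-⊛ x s q = trans (eval-⊛ x (lin s) q) (*-congʳ (eval-lin x s))

  opaque
    unfolding eval lin

    -- Horner's scheme: the coefficients of the quotient by X - s are the values at s of the
    -- successive tails of the polynomial.
    quot : Carrier → Poly → Poly
    quot s []      = []
    quot s (a ∷ p) = eval s p ∷ quot s p

    private
      quot-zero : ∀ s p → coeff p 0 ≈ - s * coeff (quot s p) 0 + eval s p
      quot-zero s []      = sym (trans (+-identityʳ _) (zeroʳ _))
      quot-zero s (a ∷ p) = RS.solve 3 (λ a s e → a := :- s :* e :+ (a :+ s :* e)) refl a s (eval s p)

      quot-suc : ∀ s p k → coeff p (suc k) ≈ coeff (quot s p) k + - s * coeff (quot s p) (suc k)
      quot-suc s []      k       = sym (trans (+-identityˡ _) (zeroʳ _))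
      quot-suc s (a ∷ p) zero    = trans (quot-zero s p) (+-comm _ _)
      quot-suc s (a ∷ p) (suc k) = quot-suc s p k

    quot-spec : ∀ s p → p ≋ lin s ⊛ quot s p ⊕ const (eval s p)
    quot-spec s p = mk λ
      { zero    → trans (quot-zero s p) (sym (trans (coeff-⊕ (lin s ⊛ quot s p) (const (eval s p)) 0)
                    (+-congʳ (coeff-lin-zero s (quot s p)))))
      ; (suc k) → trans (quot-suc s p k) (sym (trans (coeff-⊕ (lin s ⊛ quot s p) (const (eval s p)) (suc k))
                    (trans (+-identityʳ _) (coeff-lin s (quot s p) k)))) }

  root⇒factor : ∀ s p → eval s p ≈ 0# → p ≋ lin s ⊛ quot s p
  root⇒factor s p e = ≋-trans (quot-spec s p) (≋-trans (⊕-congˡ (≋-trans (const-cong e) const-0)) (⊕-identityʳ _))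

  private
    ×ₙ-zero : ∀ n → n ×ₙ 0# ≈ 0#
    ×ₙ-zero zero    = refl
    ×ₙ-zero (suc n) = trans (+-identityˡ _) (×ₙ-zero n)

  opaque
    unfolding _⊛_ lin

    deriv : Poly → Poly
    deriv []      = []
    deriv (a ∷ p) = p ⊕ shift (deriv p)

    coeff-deriv : ∀ p k → coeff (deriv p) k ≈ suc k ×ₙ coeff p (suc k)
    coeff-deriv []      k       = sym (×ₙ-zero (suc k))
    coeff-deriv (a ∷ p) zero    = coeff-⊕ p (shift (deriv p)) 0
    coeff-deriv (a ∷ p) (suc k) = trans (coeff-⊕ p (shift (deriv p)) (suc k)) (+-congˡ (coeff-deriv p k))

    deriv-cong : ∀ {p q} → p ≋ q → deriv p ≋ deriv q
    deriv-cong {p} {q} e = mk λ k → trans (coeff-deriv p k) (trans (×ₙ-congʳ (suc k) (at e (suc k))) (sym (coeff-deriv q k)))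

    deriv-⊕ : ∀ p q → deriv (p ⊕ q) ≋ deriv p ⊕ deriv q
    deriv-⊕ []      q       = ≋-refl
    deriv-⊕ (a ∷ p) []      = ≋-sym (⊕-identityʳ _)
    deriv-⊕ (a ∷ p) (b ∷ q) = ≋-trans (⊕-congˡ {p ⊕ q} (≋-trans (shift-cong (deriv-⊕ p q)) (shift-⊕ (deriv p) (deriv q))))
      (interchange p q (shift (deriv p)) (shift (deriv q)))

    deriv-scale : ∀ a p → deriv (scale a p) ≋ scale a (deriv p)
    deriv-scale a []      = ≋-refl
    deriv-scale a (b ∷ p) = ≋-trans (⊕-congˡ {scale a p} (≋-trans (shift-cong (deriv-scale a p)) (shift-scale a (deriv p))))
      (≋-sym (scale-⊕ a p (shift (deriv p))))

    deriv-⊛ : ∀ p q → deriv (p ⊛ q) ≋ deriv p ⊛ q ⊕ p ⊛ deriv q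
    deriv-⊛ []      q = ≋-refl
    deriv-⊛ (a ∷ p) q = begin
      deriv (scale a q ⊕ shift (p ⊛ q))
        ≈⟨ deriv-⊕ (scale a q) (shift (p ⊛ q)) ⟩
      deriv (scale a q) ⊕ (p ⊛ q ⊕ shift (deriv (p ⊛ q)))
        ≈⟨ ⊕-cong (deriv-scale a q) (⊕-congˡ {p ⊛ q} (≋-trans (shift-cong (deriv-⊛ p q)) (shift-⊕ (deriv p ⊛ q) (p ⊛ deriv q)))) ⟩
      scale a (deriv q) ⊕ (p ⊛ q ⊕ (shift (deriv p ⊛ q) ⊕ shift (p ⊛ deriv q)))
        ≈⟨ PS.solve 4 (λ a b c d → a PS.:+ (b PS.:+ (c PS.:+ d)) PS.:= (b PS.:+ c) PS.:+ (a PS.:+ d)) ≋-refl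
             (scale a (deriv q)) (p ⊛ q) (shift (deriv p ⊛ q)) (shift (p ⊛ deriv q)) ⟩
      (p ⊛ q ⊕ shift (deriv p ⊛ q)) ⊕ (scale a (deriv q) ⊕ shift (p ⊛ deriv q))
        ≈⟨ ⊕-congʳ {p ⊛ q ⊕ shift (deriv p ⊛ q)} {(p ⊕ shift (deriv p)) ⊛ q} (≋-sym (≋-trans (⊛-distribʳ q p (shift (deriv p)))
             (⊕-congˡ {p ⊛ q} (shift-⊛ (deriv p) q)))) ⟩
      (p ⊕ shift (deriv p)) ⊛ q ⊕ (scale a (deriv q) ⊕ shift (p ⊛ deriv q)) ∎

    deriv-lin : ∀ s → deriv (lin s) ≋ const 1#
    deriv-lin s = mk λ { zero → +-identityʳ 1# ; (suc zero) → refl ; (suc (suc k)) → refl }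

  Bnd-deriv : ∀ {m p} → Bnd m p → Bnd (m ∸ 1) (deriv p)
  Bnd-deriv {m} {p} b = mkB λ k m≤k → trans (coeff-deriv p k)
    (trans (×ₙ-congʳ (suc k) (vanish b (suc k) (ℕ.≤-trans (ℕ.m≤n+m∸n m 1) (s≤s m≤k)))) (×ₙ-zero (suc k)))

-- Finite prime fields

record FiniteField : Set₁ where
  infixl 6 _+_
  infixl 7 _*_
  infix  8 -_
  infix  4 _≟_
  field
    F : Set
    _+_ _*_ : F → F → F
    -_ : F → F
    0# 1# : F
    isCommutativeRing : IsCommutativeRing _≡_ _+_ _*_ -_ 0# 1#
    _≟_ : (x y : F) → Dec (x ≡ y)
    inverse : ∀ x → x ≢ 0# → ∃ λ y → x * y ≡ 1#
    1≢0 : 1# ≢ 0#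
    els : List F
    ∈-els : ∀ x → x ∈ els
    els-unique : Unique els

  K : CommutativeRing 0ℓ 0ℓ
  K = record { isCommutativeRing = isCommutativeRing }

  open Algebra.Properties.Semiring.Mult (CommutativeRing.semiring K) public using () renaming (_×_ to _×ₙ_)

  p : ℕ
  p = length els

  field
    -- As `p` is the number of elements, this says that the field is a prime field.
    char : ∀ k → 0 < k → k < p → k ×ₙ 1# ≢ 0#

-- Roots with multiplicity, and the derivative of Z

module Univariate (𝔽 : FiniteField) where
  open FiniteField 𝔽
  module KR = CommutativeRing K
  module KS = RingSolver K
  open Polynomial K
  module P = CommutativeRing polyRing
  module PS = RingSolver polyRing
  open PS using (_:=_; _:+_; _:*_; :-_)

  *-cancelˡ-0 : ∀ {x y} → x ≢ 0# → x * y ≡ 0# → y ≡ 0#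
  *-cancelˡ-0 {x} {y} x≢0 e with inverse x x≢0
  ... | z , xz = ≡.trans (≡.sym (KR.*-identityˡ y)) (≡.trans (≡.cong (_* y) (≡.trans (≡.sym xz) (KR.*-comm x z)))
                   (≡.trans (KR.*-assoc z x y) (≡.trans (≡.cong (z *_) e) (KR.zeroʳ z))))

  x-y≡0⇒x≡y : ∀ {x y} → x + - y ≡ 0# → x ≡ y
  x-y≡0⇒x≡y {x} {y} e = ≡.trans (KS.solve 2 (λ x y → x KS.:= (x KS.:+ KS.:- y) KS.:+ y) ≡.refl x y)
    (≡.trans (≡.cong (_+ y) e) (KR.+-identityˡ y))

  lead : ∀ p → p ≋ 𝟘 ⊎ ∃ λ b → Bnd (suc b) p × coeff p b ≢ 0#
  lead p = go (length p) (Bnd-length p)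
    where
    go : ∀ m → Bnd m p → p ≋ 𝟘 ⊎ ∃ λ b → Bnd (suc b) p × coeff p b ≢ 0#
    go zero    b = inj₁ (Bnd-0 b)
    go (suc m) b with coeff p m ≟ 0#
    ... | yes e = go m (Bnd-pred e b)
    ... | no ne = inj₂ (m , b , ne)

  ≋𝟘? : ∀ p → p ≋ 𝟘 ⊎ ¬ (p ≋ 𝟘)
  ≋𝟘? p with lead p
  ... | inj₁ e = inj₁ e
  ... | inj₂ (b , _ , ne) = inj₂ λ e → ne (≡.trans (at e b) (coeff-𝟘 b))

  -- The top coefficient of the product is that of `p` times the nonzero leading coefficient of `q`;
  -- so the coefficients of `p` vanish from the top down.
  domain : ∀ p {q} → ¬ (q ≋ 𝟘) → p ⊛ q ≋ 𝟘 → p ≋ 𝟘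
  domain p {q} nq e with lead q
  ... | inj₁ z = ⊥-elim (nq z)
  ... | inj₂ (b , Bq , ne) = Bnd-0 (descend 0 λ k _ Bp → Bnd-pred (eq k Bp) Bp)
    where
    eq : ∀ k → Bnd (suc k) p → coeff p k ≡ 0#
    eq k Bp = *-cancelˡ-0 ne (≡.trans (KR.*-comm (coeff q b) _) (≡.trans (≡.sym (coeff-top k b p q Bp Bq))
      (≡.trans (at e (k ℕ.+ b)) (coeff-𝟘 _))))

  count : F → List F → ℕ
  count x [] = 0
  count x (z ∷ L) with x ≟ z
  ... | yes _ = suc (count x L)
  ... | no  _ = count x L

  count-here : ∀ x L → count x (x ∷ L) ≡ suc (count x L)
  count-here x L with x ≟ x
  ... | yes _ = ≡.refl
  ... | no ne = contradiction ≡.refl ne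

  count-there : ∀ {x z} L → x ≢ z → count x (z ∷ L) ≡ count x L
  count-there {x} {z} L ne with x ≟ z
  ... | yes e = contradiction e ne
  ... | no _  = ≡.refl

  count-++ : ∀ x L M → count x (L ++ M) ≡ count x L ℕ.+ count x M
  count-++ x []      M = ≡.refl
  count-++ x (z ∷ L) M with x ≟ z
  ... | yes _ = ≡.cong suc (count-++ x L M)
  ... | no  _ = count-++ x L M

  count-∉ : ∀ x L → x ∉ L → count x L ≡ 0
  count-∉ x []      _  = ≡.refl
  count-∉ x (z ∷ L) ni with x ≟ z
  ... | yes e = contradiction (here e) ni
  ... | no  _ = count-∉ x L (ni ∘ there)

  All≢⇒∉ : ∀ {x : F} {L} → All (x ≢_) L → x ∉ L
  All≢⇒∉ (ne ∷ _) (here e)  = ne e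
  All≢⇒∉ (_ ∷ a)  (there i) = All≢⇒∉ a i

  count-unique : ∀ {x L} → Unique L → x ∈ L → count x L ≡ 1
  count-unique {x} (a ∷ u) (here {xs = L} ≡.refl) = ≡.trans (count-here x L) (≡.cong suc (count-∉ x L (All≢⇒∉ a)))
  count-unique {x} (a ∷ u) (there {xs = L} i) =
    ≡.trans (count-there L (λ e → All.lookup a i (≡.sym e))) (count-unique u i)

  count-≤1 : ∀ x {L} → Unique L → count x L ≤ 1
  count-≤1 x {[]}    _ = z≤n
  count-≤1 x {z ∷ L} (a ∷ u) with x ≟ z
  ... | yes ≡.refl = s≤s (ℕ.≤-reflexive (count-∉ x L (All≢⇒∉ a)))
  ... | no  _      = count-≤1 x u

  -- Divisibility by the m-th power of X - x, given as a chain of quotients so that proofs peel off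
  -- one factor at a time. The true multiplicity may be larger.
  data Mult (x : F) : ℕ → Poly → Set where
    mz : ∀ {g} → Mult x 0 g
    ms : ∀ {m g} q → g ≋ lin x ⊛ q → Mult x m q → Mult x (suc m) g

  Mult-resp : ∀ {x m g h} → g ≋ h → Mult x m g → Mult x m h
  Mult-resp e mz         = mz
  Mult-resp e (ms q f r) = ms q (≋-trans (≋-sym e) f) r

  Mult-≤ : ∀ {x m k g} → k ≤ m → Mult x m g → Mult x k g
  Mult-≤ z≤n       _          = mz
  Mult-≤ (s≤s k≤m) (ms q e r) = ms q e (Mult-≤ k≤m r)

  Mult-⊕ : ∀ {x m g h} → Mult x m g → Mult x m h → Mult x m (g ⊕ h)
  Mult-⊕ mz         _          = mz
  Mult-⊕ {x} (ms q e r) (ms q′ e′ r′) = ms (q ⊕ q′) (≋-trans (⊕-cong e e′) (≋-sym (⊛-distribˡ (lin x) q q′))) (Mult-⊕ r r′)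

  Mult-⊛ : ∀ {x m g} h → Mult x m g → Mult x m (h ⊛ g)
  Mult-⊛ h mz = mz
  Mult-⊛ {x} h (ms q e r) = ms (h ⊛ q) (≋-trans (⊛-cong ≋-refl e)
    (PS.solve 3 (λ h l q → h :* (l :* q) := l :* (h :* q)) ≋-refl h (lin x) q)) (Mult-⊛ h r)

  Mult-⊖ : ∀ {x m g} → Mult x m g → Mult x m (⊖ g)
  Mult-⊖ {g = g} r = Mult-resp (≋-trans (PS.solve 2 (λ o g → (:- o) :* g := :- (o :* g)) ≋-refl (const 1#) g)
    (⊖-cong (P.*-identityˡ g))) (Mult-⊛ (⊖ const 1#) r)

  Mult-deriv : ∀ {x m g} → Mult x (suc m) g → Mult x m (deriv g)
  Mult-deriv {m = zero} _ = mz
  Mult-deriv {x} {suc m} {g} (ms q e r) = Mult-resp (≋-sym eq) (Mult-⊕ r (ms (deriv q) ≋-refl (Mult-deriv r)))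
    where
    eq : deriv g ≋ q ⊕ lin x ⊛ deriv q
    eq = ≋-trans (deriv-cong e) (≋-trans (deriv-⊛ (lin x) q)
           (⊕-cong (≋-trans (⊛-cong (deriv-lin x) ≋-refl) (P.*-identityˡ q)) ≋-refl))

  Mult-root : ∀ {x m g} → Mult x (suc m) g → eval x g ≡ 0#
  Mult-root {x} {g = g} (ms q e _) = ≡.trans (eval-cong x e) (≡.trans (eval-lin-⊛ x x q)
    (≡.trans (≡.cong (_* eval x q) (KR.-‿inverseʳ x)) (KR.zeroˡ _)))

  root-Mult : ∀ {x g} → eval x g ≡ 0# → Mult x 1 g
  root-Mult {x} {g} e = ms (quot x g) (root⇒factor x g e) mz

  Mult-lin-same : ∀ {x m g} → Mult x (suc m) (lin x ⊛ g) → Mult x m g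
  Mult-lin-same {x} (ms q e r) = Mult-resp (≋-sym (lin-cancel x e)) r

  -- As x ≠ z, the root x of the product is a root of `g`; X - x is cancelled on both sides and the
  -- argument repeats with the quotients.
  Mult-lin-other : ∀ {x z m} g → x ≢ z → Mult x m (lin z ⊛ g) → Mult x m g
  Mult-lin-other g ne mz = mz
  Mult-lin-other {x} {z} g ne (ms q e r) = ms (quot x g) g≋ (Mult-lin-other (quot x g) ne (Mult-resp (≋-sym eq) r))
    where
    g≋ : g ≋ lin x ⊛ quot x g
    g≋ = root⇒factor x g (*-cancelˡ-0 (λ x-z → ne (x-y≡0⇒x≡y x-z))
           (≡.trans (≡.sym (eval-lin-⊛ x z g)) (Mult-root (ms q e r))))
    eq : lin z ⊛ quot x g ≋ q
    eq = lin-cancel x (≋-trans (PS.solve 3 (λ a b c → a :* (b :* c) := b :* (a :* c)) ≋-refl (lin x) (lin z) (quot x g))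
           (≋-trans (⊛-cong ≋-refl (≋-sym g≋)) e))

  -- Only the factors X - x of the product can absorb multiplicity at x.
  Mult-Π-inv : ∀ {x m} L g → Mult x (count x L ℕ.+ m) (Π L ⊛ g) → Mult x m g
  Mult-Π-inv []      g r = Mult-resp (P.*-identityˡ g) r
  Mult-Π-inv {x} (z ∷ L) g r with x ≟ z
  ... | yes ≡.refl = Mult-Π-inv L g (Mult-lin-same (Mult-resp (⊛-assoc (lin x) (Π L) g) r))
  ... | no ne      = Mult-Π-inv L g (Mult-lin-other (Π L ⊛ g) ne (Mult-resp (⊛-assoc (lin z) (Π L) g) r))

  Mult-Π : ∀ x L → Mult x (count x L) (Π L)
  Mult-Π x []      = mz
  Mult-Π x (z ∷ L) with x ≟ z
  ... | yes ≡.refl = ms (Π L) ≋-refl (Mult-Π x L)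
  ... | no _       = Mult-⊛ (lin z) (Mult-Π x L)

  -- The vanishing criterion used throughout: repetitions in `L` encode the prescribed
  -- multiplicities, its length the number of zeros. The head splits off as a linear factor, and all
  -- other multiplicities survive in the quotient.
  many-roots⇒𝟘 : ∀ L {g} → (∀ x → Mult x (count x L) g) → Bnd (length L) g → g ≋ 𝟘
  many-roots⇒𝟘 []      r b = Bnd-0 b
  many-roots⇒𝟘 (x ∷ L) {g} r b with ≡.subst (λ k → Mult x k g) (count-here x L) (r x)
  ... | ms q e rx = ≋-trans e (≋-trans (⊛-cong ≋-refl (many-roots⇒𝟘 L rq (Bnd-lin-inv x q (Bnd-resp e b)))) (P.zeroʳ (lin x)))
    where
    rq : ∀ z → Mult z (count z L) q
    rq z with z ≟ x
    ... | yes ≡.refl = rx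
    ... | no ne      = Mult-lin-other q ne (Mult-resp e (≡.subst (λ k → Mult z k g) (count-there L ne) (r z)))

  unique-roots⇒𝟘 : ∀ L {g} → Unique L → All (λ x → eval x g ≡ 0#) L → Bnd (length L) g → g ≋ 𝟘
  unique-roots⇒𝟘 L {g} u a b = many-roots⇒𝟘 L r b
    where
    r : ∀ x → Mult x (count x L) g
    r x with count x L in eq
    ... | zero  = mz
    ... | suc c = Mult-≤ (≡.subst (_≤ 1) eq (count-≤1 x u)) (root-Mult (lookup-count L a eq))
      where
      lookup-count : ∀ L {c} → All (λ x → eval x g ≡ 0#) L → count x L ≡ suc c → eval x g ≡ 0#
      lookup-count (z ∷ L) (e ∷ a) h with x ≟ z
      ... | yes ≡.refl = e
      ... | no _       = lookup-count L a h

  Z : Poly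
  Z = Π els

  rep : ℕ → List F → List F
  rep zero    L = []
  rep (suc k) L = L ++ rep k L

  length-rep : ∀ k L → length (rep k L) ≡ k ℕ.* length L
  length-rep zero    L = ≡.refl
  length-rep (suc k) L = ≡.trans (List.length-++ L) (≡.cong (length L ℕ.+_) (length-rep k L))

  count-rep : ∀ x k L → count x (rep k L) ≡ k ℕ.* count x L
  count-rep x zero    L = ≡.refl
  count-rep x (suc k) L = ≡.trans (count-++ x L (rep k L)) (≡.cong (count x L ℕ.+_) (count-rep x k L))

  copies : ℕ → List F
  copies i = rep i els

  Zp : ℕ → Poly
  Zp i = Π (copies i)

  Zp-suc : ∀ i → Zp (suc i) ≋ Z ⊛ Zp i
  Zp-suc i = Π-++ els (copies i)

  length-copies : ∀ i → length (copies i) ≡ i ℕ.* p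
  length-copies i = length-rep i els

  count-els : ∀ x → count x els ≡ 1
  count-els x = count-unique els-unique (∈-els x)

  count-copies : ∀ x i → count x (copies i) ≡ i
  count-copies x i = ≡.trans (count-rep x i els) (≡.trans (≡.cong (i ℕ.*_) (count-els x)) (ℕ.*-identityʳ i))

  Mult-Zp : ∀ x i → Mult x i (Zp i)
  Mult-Zp x i = ≡.subst (λ k → Mult x k (Zp i)) (count-copies x i) (Mult-Π x (copies i))

  eval-Z : ∀ x → eval x Z ≡ 0#
  eval-Z x = Mult-root (≡.subst (λ k → Mult x k Z) (count-els x) (Mult-Π x els))

  -- Translation by t permutes the roots of Z, so the derivative of Z takes the same value everywhere.
  eval-Π-translate : ∀ x t L → eval (x + t) (Π (map (_+ t) L)) ≡ eval x (Π L)
  eval-Π-translate x t []      = ≡.trans (eval-const _ 1#) (≡.sym (eval-const x 1#))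
  eval-Π-translate x t (s ∷ L) = ≡.trans (eval-lin-⊛ (x + t) (s + t) _) (≡.trans
    (≡.cong₂ _*_ (KS.solve 3 (λ x s t → x KS.:+ t KS.:+ KS.:- (s KS.:+ t) KS.:= x KS.:+ KS.:- s) ≡.refl x s t) (eval-Π-translate x t L))
    (≡.sym (eval-lin-⊛ x s (Π L))))

  eval-deriv-lin : ∀ x s q → eval x (deriv (lin s ⊛ q)) ≡ eval x q + (x + - s) * eval x (deriv q)
  eval-deriv-lin x s q = ≡.trans (eval-cong x (≋-trans (deriv-⊛ (lin s) q)
      (⊕-cong (≋-trans (⊛-cong (deriv-lin s) ≋-refl) (P.*-identityˡ q)) ≋-refl)))
    (≡.trans (eval-⊕ x q (lin s ⊛ deriv q)) (≡.cong (eval x q +_) (eval-lin-⊛ x s (deriv q))))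

  eval-deriv-Π-translate : ∀ x t L → eval (x + t) (deriv (Π (map (_+ t) L))) ≡ eval x (deriv (Π L))
  eval-deriv-Π-translate x t [] = ≡.trans (eval-zero (x + t) d0) (≡.sym (eval-zero x d0))
    where
    d0 : deriv (const 1#) ≋ 𝟘
    d0 = Bnd-0 (Bnd-deriv (Bnd-const 1#))
  eval-deriv-Π-translate x t (s ∷ L) = ≡.trans (eval-deriv-lin (x + t) (s + t) _) (≡.trans
    (≡.cong₂ _+_ (eval-Π-translate x t L)
      (≡.cong₂ _*_ (KS.solve 3 (λ x s t → x KS.:+ t KS.:+ KS.:- (s KS.:+ t) KS.:= x KS.:+ KS.:- s) ≡.refl x s t) (eval-deriv-Π-translate x t L)))
    (≡.sym (eval-deriv-lin x s (Π L))))

  Bnd-difference : ∀ {m g h} → Bnd (suc m) g → Bnd (suc m) h → coeff g m ≡ coeff h m → Bnd m (g ⊕ ⊖ h)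
  Bnd-difference {m} {g} {h} bg bh e = Bnd-pred (≡.trans (coeff-⊕ g (⊖ h) m) (≡.trans (≡.cong (coeff g m +_) (coeff-⊖ h m))
    (≡.trans (≡.cong (_+ - coeff h m) e) (KR.-‿inverseʳ _)))) (Bnd-⊕ bg (Bnd-⊖ bh))

  -- Both sides are monic of degree p, so their difference has degree below p and vanishes at all p
  -- elements.
  Z-translate : ∀ t → Π (map (_+ t) els) ≋ Z
  Z-translate t = ⊖⇒≋ (unique-roots⇒𝟘 els els-unique (All.tabulate λ {x} _ → root x)
    (Bnd-difference (≡.subst (λ k → Bnd (suc k) (Π (map (_+ t) els))) len (Bnd-Π (map (_+ t) els))) (Bnd-Π els)
      (≡.trans (≡.trans (≡.cong (coeff (Π (map (_+ t) els))) (≡.sym len)) (coeff-Π (map (_+ t) els))) (≡.sym (coeff-Π els)))))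
    where
    len : length (map (_+ t) els) ≡ p
    len = List.length-map (_+ t) els
    root : ∀ x → eval x (Π (map (_+ t) els) ⊕ ⊖ Z) ≡ 0#
    root x = ≡.trans (eval-⊕ x _ (⊖ Z)) (≡.trans (≡.cong₂ _+_
        (≡.trans (≡.cong (λ y → eval y (Π (map (_+ t) els))) (KS.solve 2 (λ x t → x KS.:= x KS.:+ KS.:- t KS.:+ t) ≡.refl x t))
          (≡.trans (eval-Π-translate (x + - t) t els) (eval-Z _)))
        (≡.trans (eval-⊖ x Z) (≡.trans (≡.cong -_ (eval-Z x)) (KR.-‿cong ≡.refl))))
      (KR.-‿inverseʳ 0#))

  -- Since Z is X^p - X, this constant is -1.
  κ : F
  κ = eval 0# (deriv Z)

  deriv-Z : deriv Z ≋ const κ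
  deriv-Z = ⊖⇒≋ (unique-roots⇒𝟘 els els-unique (All.tabulate λ {x} _ → root x) bnd)
    where
    p≥1 : 1 ≤ p
    p≥1 with els | ∈-els 0#
    ... | _ ∷ _ | _ = s≤s z≤n
    bnd : Bnd p (deriv Z ⊕ ⊖ const κ)
    bnd = Bnd-⊕ (Bnd-deriv (Bnd-Π els)) (Bnd-⊖ (Bnd-≤ p≥1 (Bnd-const κ)))
    root : ∀ x → eval x (deriv Z ⊕ ⊖ const κ) ≡ 0#
    root x = ≡.trans (eval-⊕ x _ _) (≡.trans (≡.cong₂ _+_
      (≡.trans (≡.cong (λ y → eval y (deriv Z)) (≡.sym (KR.+-identityˡ x)))
        (≡.trans (eval-cong (0# + x) (deriv-cong (≋-sym (Z-translate x)))) (eval-deriv-Π-translate 0# x els)))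
      (≡.trans (eval-⊖ x (const κ)) (≡.cong -_ (eval-const x κ)))) (KR.-‿inverseʳ κ))

-- Expansions in powers of Z, and the long root

module Rédei (𝔽 : FiniteField) where
  open FiniteField 𝔽
  open Univariate 𝔽
  open Polynomial K
  open PS using (_:=_; _:+_; _:*_; :-_)

  Σ< : (ℕ → Poly) → ℕ → Poly
  Σ< f zero    = 𝟘
  Σ< f (suc m) = Σ< f m ⊕ f m

  Σ<-cong : ∀ {f g} m → (∀ i → i < m → f i ≋ g i) → Σ< f m ≋ Σ< g m
  Σ<-cong zero    h = ≋-refl
  Σ<-cong (suc m) h = ⊕-cong (Σ<-cong m (λ i i<m → h i (ℕ.m<n⇒m<1+n i<m))) (h m (ℕ.n<1+n m))

  Bnd-Σ< : ∀ {f b} m → (∀ i → i < m → Bnd b (f i)) → Bnd b (Σ< f m)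
  Bnd-Σ< zero    h = Bnd-𝟘
  Bnd-Σ< (suc m) h = Bnd-⊕ (Bnd-Σ< m (λ i i<m → h i (ℕ.m<n⇒m<1+n i<m))) (h m (ℕ.n<1+n m))

  Bnd-Zp-⊛ : ∀ i {b} g → Bnd b g → Bnd (i ℕ.* p ℕ.+ b) (Zp i ⊛ g)
  Bnd-Zp-⊛ i {b} g h = Bnd-resp (⊛-comm g (Zp i)) (Bnd-≤ (ℕ.≤-reflexive (≡.trans (≡.cong (b ℕ.+_) (length-copies i)) (ℕ.+-comm b _)))
    (Bnd-⊛ b (length (copies i)) g (Zp i) h (Bnd-Π (copies i))))

  Bnd-Zp-inv : ∀ i {b} g → Bnd b (Zp i ⊛ g) → Bnd (b ∸ i ℕ.* p) g
  Bnd-Zp-inv i {b} g h = ≡.subst (λ l → Bnd (b ∸ l) g) (length-copies i) (Bnd-Π-inv (copies i) g h)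

  coeff-Zp-⊛ : ∀ i g → Bnd 1 g → coeff (Zp i ⊛ g) (i ℕ.* p) ≡ coeff g 0
  coeff-Zp-⊛ i g h = ≡.trans (≡.cong (coeff (Zp i ⊛ g)) (≡.trans (≡.sym (length-copies i)) (≡.sym (ℕ.+-identityʳ _))))
    (≡.trans (coeff-top (length (copies i)) 0 (Zp i) g (Bnd-Π (copies i)) h)
      (≡.trans (≡.cong (_* coeff g 0) (coeff-Π (copies i))) (KR.*-identityˡ _)))

  -- The terms below the top one have degree below m p, whereas Z^m times a nonzero digit has degree
  -- at least m p. So the top digit vanishes, and the others follow by induction.
  expansion-unique : ∀ (f : ℕ → Poly) m → (∀ i → i < m → Bnd p (f i)) → Σ< (λ i → Zp i ⊛ f i) m ≋ 𝟘 → ∀ i → i < m → f i ≋ 𝟘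
  expansion-unique f (suc m) h e i i<1+m = go (ℕ.m≤n⇒m<n∨m≡n (ℕ.≤-pred i<1+m))
    where
    S T : Poly
    S = Σ< (λ i → Zp i ⊛ f i) m
    T = Zp m ⊛ f m
    T≋-S : T ≋ ⊖ S
    T≋-S = ⊖⇒≋ (≋-trans (PS.solve 2 (λ s t → t :+ :- (:- s) := s :+ t) ≋-refl S T) e)
    bS : Bnd (m ℕ.* p) S
    bS = Bnd-Σ< m λ i i<m → Bnd-≤ (ℕ.≤-trans (ℕ.≤-reflexive (ℕ.+-comm (i ℕ.* p) p)) (ℕ.*-monoˡ-≤ p i<m))
           (Bnd-Zp-⊛ i (f i) (h i (ℕ.m<n⇒m<1+n i<m)))
    fm≋𝟘 : f m ≋ 𝟘
    fm≋𝟘 = Bnd-0 (≡.subst (λ k → Bnd k (f m)) (ℕ.n∸n≡0 (m ℕ.* p)) (Bnd-Zp-inv m (f m) (Bnd-resp (≋-sym T≋-S) (Bnd-⊖ bS))))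
    S≋𝟘 : S ≋ 𝟘
    S≋𝟘 = ≋-trans (≋-sym (⊕-identityʳ S)) (≋-trans (⊕-cong ≋-refl (≋-sym (≋-trans (⊛-cong ≋-refl fm≋𝟘) (P.zeroʳ (Zp m))))) e)
    go : i < m ⊎ i ≡ m → f i ≋ 𝟘
    go (inj₁ i<m)    = expansion-unique f m (λ i i<m → h i (ℕ.m<n⇒m<1+n i<m)) S≋𝟘 i i<m
    go (inj₂ ≡.refl) = fm≋𝟘

  -- nκ i is the constant i κ, the logarithmic derivative Z (Zⁱ)′ / Zⁱ.
  nκ : ℕ → Poly
  nκ zero    = 𝟘
  nκ (suc i) = const κ ⊕ nκ i

  Bnd-nκ : ∀ i → Bnd 1 (nκ i)
  Bnd-nκ zero    = Bnd-𝟘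
  Bnd-nκ (suc i) = Bnd-⊕ (Bnd-const κ) (Bnd-nκ i)

  Z-deriv-Zp : ∀ i → Z ⊛ deriv (Zp i) ≋ nκ i ⊛ Zp i
  Z-deriv-Zp zero    = ≋-trans (⊛-cong ≋-refl (Bnd-0 (Bnd-deriv (Bnd-const 1#)))) (≋-trans (P.zeroʳ Z) (≋-sym (P.zeroˡ (Zp 0))))
  Z-deriv-Zp (suc i) = begin
    Z ⊛ deriv (Zp (suc i))
      ≈⟨ ⊛-cong ≋-refl (≋-trans (deriv-cong (Zp-suc i)) (≋-trans (deriv-⊛ Z (Zp i)) (⊕-cong (⊛-cong deriv-Z ≋-refl) ≋-refl))) ⟩
    Z ⊛ (const κ ⊛ Zp i ⊕ Z ⊛ deriv (Zp i))
      ≈⟨ ⊛-cong ≋-refl (⊕-cong ≋-refl (Z-deriv-Zp i)) ⟩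
    Z ⊛ (const κ ⊛ Zp i ⊕ nκ i ⊛ Zp i)
      ≈⟨ PS.solve 4 (λ z k n w → z :* (k :* w :+ n :* w) := (k :+ n) :* (z :* w)) ≋-refl Z (const κ) (nκ i) (Zp i) ⟩
    (const κ ⊕ nκ i) ⊛ (Z ⊛ Zp i)
      ≈⟨ ⊛-cong ≋-refl (≋-sym (Zp-suc i)) ⟩
    nκ (suc i) ⊛ Zp (suc i) ∎
    where open ≋R

  S : (ℕ → Poly) → ℕ → Poly
  S d = Σ< (λ i → Zp i ⊛ d i)

  -- All terms above index a carry a further factor Z, which vanishes at every element of the field;
  -- after division by Z^a the value at x is therefore that of `d a`.
  S-factor : ∀ d a → (∀ i → i < a → d i ≋ 𝟘) → ∀ t → ∃ λ E → S d (a ℕ.+ suc t) ≋ Zp a ⊛ (d a ⊕ Z ⊛ E)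
  S-factor d a h zero = 𝟘 , (begin
    S d (a ℕ.+ 1)                ≡⟨ ≡.cong (S d) (ℕ.+-comm a 1) ⟩
    S d a ⊕ Zp a ⊛ d a           ≈⟨ ⊕-cong (Bnd-0 (Bnd-Σ< a λ i i<a → Bnd-resp (≋-sym (≋-trans (⊛-cong ≋-refl (h i i<a)) (P.zeroʳ (Zp i)))) Bnd-𝟘)) ≋-refl ⟩
    𝟘 ⊕ Zp a ⊛ d a             ≈⟨ ⊕-identityˡ _ ⟩
    Zp a ⊛ d a                 ≈⟨ ⊛-cong ≋-refl (≋-sym (≋-trans (⊕-cong ≋-refl (P.zeroʳ Z)) (⊕-identityʳ (d a)))) ⟩
    Zp a ⊛ (d a ⊕ Z ⊛ 𝟘)       ∎)
    where open ≋R
  S-factor d a h (suc t) with S-factor d a h t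
  ... | E , eq = E ⊕ Zp t ⊛ D , (begin
    S d (a ℕ.+ suc (suc t))                          ≡⟨ ≡.cong (S d) (ℕ.+-suc a (suc t)) ⟩
    S d (a ℕ.+ suc t) ⊕ Zp (a ℕ.+ suc t) ⊛ D         ≈⟨ ⊕-cong eq (⊛-cong (≋-trans (Zp-+ a (suc t)) (⊛-cong ≋-refl (Zp-suc t))) ≋-refl) ⟩
    Zp a ⊛ (d a ⊕ Z ⊛ E) ⊕ (Zp a ⊛ (Z ⊛ Zp t)) ⊛ D
      ≈⟨ PS.solve 6 (λ a d z e t D → a :* (d :+ z :* e) :+ (a :* (z :* t)) :* D := a :* (d :+ z :* (e :+ t :* D))) ≋-refl
           (Zp a) (d a) Z E (Zp t) D ⟩
    Zp a ⊛ (d a ⊕ Z ⊛ (E ⊕ Zp t ⊛ D))              ∎)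
    where
    open ≋R
    D : Poly
    D = d (a ℕ.+ suc t)
    Zp-+ : ∀ i j → Zp (i ℕ.+ j) ≋ Zp i ⊛ Zp j
    Zp-+ zero    j = ≋-sym (P.*-identityˡ (Zp j))
    Zp-+ (suc i) j = ≋-trans (Zp-suc (i ℕ.+ j)) (≋-trans (⊛-cong ≋-refl (Zp-+ i j))
      (≋-trans (≋-sym (⊛-assoc Z (Zp i) (Zp j))) (⊛-cong (≋-sym (Zp-suc i)) ≋-refl)))

  module _ (d : ℕ → Poly) (c : Poly) where

    -- Since Z (Zⁱ dᵢ)′ = iκ Zⁱ dᵢ + Zⁱ⁺¹ dᵢ′, the derivative of a digit is carried into the next
    -- place.
    δ : ℕ → Poly
    δ zero    = 𝟘
    δ (suc i) = deriv (d i)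

    γ : ℕ → Poly
    γ i = δ i ⊕ (nκ i ⊕ ⊖ c) ⊛ d i

    -- The last summand is the carry out of the digit m - 1, which has no place yet in a sum of m
    -- terms.
    G-expansion : ∀ m → Z ⊛ deriv (S d m) ⊕ ⊖ (c ⊛ S d m) ≋ Σ< (λ i → Zp i ⊛ γ i) m ⊕ Zp m ⊛ δ m
    G-expansion zero = ≋-trans
      (⊕-cong (≋-trans (⊛-cong ≋-refl (Bnd-0 (Bnd-deriv {0} Bnd-𝟘))) (P.zeroʳ Z)) (⊖-cong (P.zeroʳ c)))
      (≋-trans (⊖-inverseʳ 𝟘) (≋-sym (≋-trans (⊕-identityˡ _) (P.zeroʳ (Zp 0)))))
    G-expansion (suc m) = begin
      Z ⊛ deriv (S d m ⊕ W ⊛ d m) ⊕ ⊖ (c ⊛ (S d m ⊕ W ⊛ d m))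
        ≈⟨ ⊕-cong (⊛-cong ≋-refl (≋-trans (deriv-⊕ (S d m) (W ⊛ d m)) (⊕-cong ≋-refl (deriv-⊛ W (d m))))) ≋-refl ⟩
      Z ⊛ (deriv (S d m) ⊕ (deriv W ⊛ d m ⊕ W ⊛ deriv (d m))) ⊕ ⊖ (c ⊛ (S d m ⊕ W ⊛ d m))
        ≈⟨ PS.solve 8 (λ z s′ w′ d w d′ c s → z :* (s′ :+ (w′ :* d :+ w :* d′)) :+ :- (c :* (s :+ w :* d))
             := (z :* s′ :+ :- (c :* s)) :+ ((z :* w′) :* d :+ (:- c) :* (w :* d) :+ (z :* w) :* d′)) ≋-refl
             Z (deriv (S d m)) (deriv W) (d m) W (deriv (d m)) c (S d m) ⟩
      (Z ⊛ deriv (S d m) ⊕ ⊖ (c ⊛ S d m)) ⊕ ((Z ⊛ deriv W) ⊛ d m ⊕ (⊖ c) ⊛ (W ⊛ d m) ⊕ (Z ⊛ W) ⊛ deriv (d m))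
        ≈⟨ ⊕-cong (G-expansion m) (⊕-cong (⊕-cong (⊛-cong (Z-deriv-Zp m) ≋-refl) ≋-refl) (⊛-cong (≋-sym (Zp-suc m)) ≋-refl)) ⟩
      (Γ ⊕ W ⊛ δ m) ⊕ ((nκ m ⊛ W) ⊛ d m ⊕ (⊖ c) ⊛ (W ⊛ d m) ⊕ Zp (suc m) ⊛ deriv (d m))
        ≈⟨ PS.solve 7 (λ g w e n d c r → (g :+ w :* e) :+ ((n :* w) :* d :+ (:- c) :* (w :* d) :+ r)
             := (g :+ w :* (e :+ (n :+ :- c) :* d)) :+ r) ≋-refl Γ W (δ m) (nκ m) (d m) c (Zp (suc m) ⊛ deriv (d m)) ⟩
      (Γ ⊕ W ⊛ γ m) ⊕ Zp (suc m) ⊛ δ (suc m) ∎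
      where
      open ≋R
      W Γ : Poly
      W = Zp m
      Γ = Σ< (λ i → Zp i ⊛ γ i) m

  least-nonzero : ∀ (d : ℕ → Poly) n → ¬ (d n ≋ 𝟘) → ∃ λ a → a ≤ n × ¬ (d a ≋ 𝟘) × (∀ i → i < a → d i ≋ 𝟘)
  least-nonzero d n ne = go n 0 ≡.refl (λ _ ())
    where
    go : ∀ t a → a ℕ.+ t ≡ n → (∀ i → i < a → d i ≋ 𝟘) → ∃ λ a → a ≤ n × ¬ (d a ≋ 𝟘) × (∀ i → i < a → d i ≋ 𝟘)
    go t a eq h with ≋𝟘? (d a)
    go t a eq h | inj₂ na = a , ≡.subst (a ≤_) eq (ℕ.m≤m+n a t) , na , h
    go zero a eq h | inj₁ za = contradiction (≡.subst (λ k → d k ≋ 𝟘) (≡.trans (≡.sym (ℕ.+-identityʳ a)) eq) za) ne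
    go (suc t) a eq h | inj₁ za = go t (suc a) (≡.trans (≡.sym (ℕ.+-suc a t)) eq) h′
      where
      h′ : ∀ i → i < suc a → d i ≋ 𝟘
      h′ i i<1+a with ℕ.m≤n⇒m<n∨m≡n (ℕ.≤-pred i<1+a)
      ... | inj₁ i<a    = h i i<a
      ... | inj₂ ≡.refl = za

  -- Below degree p, differentiation lowers the degree by exactly one.
  Bnd-antideriv : ∀ {m} g → Bnd p g → Bnd m (deriv g) → Bnd (suc m) g
  Bnd-antideriv {m} g bp bd = mkB go
    where
    ×ₙ-assoc : ∀ k x → k ×ₙ x ≡ (k ×ₙ 1#) * x
    ×ₙ-assoc zero    x = ≡.sym (KR.zeroˡ x)
    ×ₙ-assoc (suc k) x = ≡.trans (≡.cong₂ _+_ (≡.sym (KR.*-identityˡ x)) (×ₙ-assoc k x)) (≡.sym (KR.distribʳ x 1# (k ×ₙ 1#)))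
    go : ∀ k → suc m ≤ k → coeff g k ≡ 0#
    go (suc k) (s≤s m≤k) with p ℕ.≤? suc k
    ... | yes p≤k = vanish bp (suc k) p≤k
    ... | no p≰k = *-cancelˡ-0 (char (suc k) (s≤s z≤n) (ℕ.≰⇒> p≰k))
      (≡.trans (≡.sym (×ₙ-assoc (suc k) _)) (≡.trans (≡.sym (coeff-deriv g k)) (vanish bd k m≤k)))

  sum-count : ∀ L → sum (map (λ x → count x L) els) ≡ length L
  sum-count []      = sum-0 els
    where
    sum-0 : ∀ (xs : List F) → sum (map (λ _ → 0) xs) ≡ 0
    sum-0 []       = ≡.refl
    sum-0 (_ ∷ xs) = sum-0 xs
  sum-count (z ∷ L) = ≡.trans (go els) (≡.cong₂ ℕ._+_ (count-els z) (sum-count L))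
    where
    swap : ∀ a b c → a ℕ.+ (b ℕ.+ c) ≡ b ℕ.+ (a ℕ.+ c)
    swap = solve-∀
    go : ∀ xs → sum (map (λ x → count x (z ∷ L)) xs) ≡ count z xs ℕ.+ sum (map (λ x → count x L) xs)
    go []       = ≡.refl
    go (x ∷ xs) with x ≟ z | z ≟ x
    ... | yes _ | yes _ = ≡.cong suc (≡.trans (≡.cong (count x L ℕ.+_) (go xs)) (swap (count x L) (count z xs) _))
    ... | no _  | no _  = ≡.trans (≡.cong (count x L ℕ.+_) (go xs)) (swap (count x L) (count z xs) _)
    ... | yes e | no ne = contradiction (≡.sym e) ne
    ... | no ne | yes e = contradiction (≡.sym e) ne

  -- An element with `Q` is charged a + M, which keeps the first summand independent of the number
  -- of such elements.
  sum-bound : ∀ {Q : F → Set} (Q? : ∀ x → Dec (Q x)) (f : F → ℕ) a M → (∀ x → ¬ Q x → f x ≤ a) → (∀ x → f x ≤ M) →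
              ∀ xs → sum (map f xs) ≤ length xs ℕ.* a ℕ.+ length (filter Q? xs) ℕ.* M
  sum-bound Q? f a M h₁ h₂ []       = z≤n
  sum-bound Q? f a M h₁ h₂ (x ∷ xs) with Q? x
  ... | yes q = ℕ.≤-trans (ℕ.+-mono-≤ (h₂ x) (sum-bound Q? f a M h₁ h₂ xs))
                  (ℕ.≤-trans (ℕ.m≤n+m _ a) (ℕ.≤-reflexive (eq a M (length xs ℕ.* a) _)))
    where
    eq : ∀ a M b c → a ℕ.+ (M ℕ.+ (b ℕ.+ c)) ≡ a ℕ.+ b ℕ.+ (M ℕ.+ c)
    eq = solve-∀
  ... | no nq = ℕ.≤-trans (ℕ.+-mono-≤ (h₁ x nq) (sum-bound Q? f a M h₁ h₂ xs)) (ℕ.≤-reflexive (≡.sym (ℕ.+-assoc a _ _)))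

  private
    split : ∀ {i n} → i < n → ∃ λ t → n ≡ i ℕ.+ suc t
    split {i} i<n with ℕ.m≤n⇒∃[o]m+o≡n i<n
    ... | t , e = t , ≡.sym (≡.trans (ℕ.+-suc i t) e)

    term-bound : ∀ i t D q → D < q → i ℕ.* q ℕ.+ suc (suc t ℕ.* D) ≤ (i ℕ.+ suc t) ℕ.* q
    term-bound i t D q D<q = ℕ.≤-trans (ℕ.+-monoʳ-≤ (i ℕ.* q) (ℕ.≤-trans (s≤s (ℕ.m≤n+m _ t))
        (ℕ.≤-trans (ℕ.≤-reflexive (eq t D)) (ℕ.*-monoʳ-≤ (suc t) D<q))))
      (ℕ.≤-reflexive (≡.sym (ℕ.*-distribʳ-+ q i (suc t))))
      where
      eq : ∀ t D → suc (t ℕ.+ suc t ℕ.* D) ≡ suc t ℕ.* suc D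
      eq = solve-∀

    -- The degree budget of Zⁱ γᵢ for n = i + 1 + t: as n ≥ 1, two copies of D together with r fit
    -- into one p, and each of the t other copies of D fits into a p of its own.
    γ-bound : ∀ i t D r q → suc (i ℕ.+ suc t) ℕ.* D ℕ.+ r ≤ q → i ℕ.* q ℕ.+ (suc (i ℕ.+ suc t) ∸ i) ℕ.* D ℕ.+ r ≤ (i ℕ.+ suc t) ℕ.* q
    γ-bound i t D r q h = begin
      i ℕ.* q ℕ.+ (suc (i ℕ.+ suc t) ∸ i) ℕ.* D ℕ.+ r
        ≡⟨ ≡.cong (λ k → i ℕ.* q ℕ.+ k ℕ.* D ℕ.+ r) (≡.trans (≡.cong (_∸ i) (≡.sym (ℕ.+-suc i (suc t)))) (ℕ.m+n∸m≡n i (2 ℕ.+ t))) ⟩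
      i ℕ.* q ℕ.+ (2 ℕ.+ t) ℕ.* D ℕ.+ r
        ≡⟨ eq₁ (i ℕ.* q) t D r ⟩
      i ℕ.* q ℕ.+ (2 ℕ.* D ℕ.+ r ℕ.+ t ℕ.* D)
        ≤⟨ ℕ.+-monoʳ-≤ (i ℕ.* q) (ℕ.+-mono-≤ (ℕ.≤-trans (ℕ.+-monoˡ-≤ r (ℕ.*-monoˡ-≤ D (s≤s (ℕ.≤-trans (s≤s z≤n) (ℕ.m≤n+m (suc t) i))))) h)
             (ℕ.*-monoʳ-≤ t (ℕ.≤-trans (ℕ.m≤m+n D _) (ℕ.≤-trans (ℕ.m≤m+n _ r) h)))) ⟩
      i ℕ.* q ℕ.+ (q ℕ.+ t ℕ.* q)
        ≡⟨ ℕ.*-distribʳ-+ q i (suc t) ⟨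
      (i ℕ.+ suc t) ℕ.* q ∎
      where
      open ℕ.≤-Reasoning
      eq₁ : ∀ a t D r → a ℕ.+ (2 ℕ.+ t) ℕ.* D ℕ.+ r ≡ a ℕ.+ (2 ℕ.* D ℕ.+ r ℕ.+ t ℕ.* D)
      eq₁ = solve-∀

  -- Applied to f = P(X,y), with `L` the values v - uy of the points of U, so that `count x L` is
  -- the number of points on a line of slope y. The index n is a successor because `c` refers to the
  -- digit n - 1.
  long-root : ∀ n′ D r → let n = suc n′ in 1 ≤ D → suc n ℕ.* D ℕ.+ r ≤ p →
    ∀ (d : ℕ → Poly) f L → f ≋ S d (suc n) → (∀ i → i ≤ n → Bnd (suc ((n ∸ i) ℕ.* D)) (d i)) →
    coeff f (n ℕ.* p) ≡ 1# → n ℕ.* p ≤ length L ℕ.+ r → (∀ x → Mult x (count x L) f) →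
    ∀ x₁ → n < count x₁ L → ∃ λ x → p ≤ count x L ℕ.+ r
  long-root n′ D r 1≤D hD d f L f≋ bd mon len mult x₁ n<x₁ = result
    where
    n = suc n′

    D<p : D < p
    D<p = ℕ.≤-trans (ℕ.+-mono-≤ 1≤D (ℕ.m≤m+n D _)) (ℕ.≤-trans (ℕ.m≤m+n (D ℕ.+ (D ℕ.+ n′ ℕ.* D)) r) hD)

    bdn : Bnd 1 (d n)
    bdn = ≡.subst (λ k → Bnd (suc (k ℕ.* D)) (d n)) (ℕ.n∸n≡0 n) (bd n ℕ.≤-refl)

    bS : Bnd (n ℕ.* p) (S d n)
    bS = Bnd-Σ< n term
      where
      term : ∀ i → i < n → Bnd (n ℕ.* p) (Zp i ⊛ d i)
      term i i<n with split i<n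
      ... | t , eq = Bnd-≤ (≡.subst (λ k → i ℕ.* p ℕ.+ suc ((k ∸ i) ℕ.* D) ≤ k ℕ.* p) (≡.sym eq)
                       (≡.subst (λ k → i ℕ.* p ℕ.+ suc (k ℕ.* D) ≤ (i ℕ.+ suc t) ℕ.* p) (≡.sym (ℕ.m+n∸m≡n i (suc t))) (term-bound i t D p D<p)))
                     (Bnd-Zp-⊛ i (d i) (bd i (ℕ.<⇒≤ i<n)))

    dn≋1 : d n ≋ const 1#
    dn≋1 = ≋-trans (Bnd-1⇒const bdn) (mk λ { zero → ≡.trans (coeff-const-zero _) (≡.trans dn0 (≡.sym (coeff-const-zero 1#)))
                                            ; (suc k) → ≡.trans (coeff-const-suc _ k) (≡.sym (coeff-const-suc 1# k)) })
      where
      dn0 : coeff (d n) 0 ≡ 1#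
      dn0 = ≡.trans (≡.sym (≡.trans (at f≋ (n ℕ.* p)) (≡.trans (coeff-⊕ (S d n) (Zp n ⊛ d n) (n ℕ.* p))
              (≡.trans (≡.cong₂ _+_ (vanish bS (n ℕ.* p) ℕ.≤-refl) (coeff-Zp-⊛ n (d n) bdn)) (KR.+-identityˡ _))))) mon

    dn≉0 : ¬ (d n ≋ 𝟘)
    dn≉0 z = 1≢0 (≡.trans (≡.sym (coeff-const-zero 1#)) (≡.trans (at (≋-trans (≋-sym dn≋1) z) 0) (coeff-𝟘 0)))

    -- Chosen so that the digit γₙ vanishes, given dₙ = 1.
    c : Poly
    c = deriv (d n′) ⊕ nκ n

    n∸n′ : n ∸ n′ ≡ 1
    n∸n′ = ℕ.m+n∸n≡m 1 n′

    bc : Bnd D c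
    bc = Bnd-⊕ (Bnd-≤ (ℕ.≤-reflexive (≡.trans (≡.cong (ℕ._* D) n∸n′) (ℕ.*-identityˡ D))) (Bnd-deriv (bd n′ (ℕ.n≤1+n n′))))
               (Bnd-≤ 1≤D (Bnd-nκ n))

    γn≋𝟘 : γ d c n ≋ 𝟘
    γn≋𝟘 = ≋-trans (⊕-cong ≋-refl (≋-trans (⊛-cong ≋-refl dn≋1) (P.*-identityʳ (nκ n ⊕ ⊖ c))))
      (≋-trans (PS.solve 2 (λ a b → a :+ (b :+ :- (a :+ b)) := b :+ :- b) ≋-refl (deriv (d n′)) (nκ n)) (⊖-inverseʳ (nκ n)))

    bγ : ∀ i → i ≤ n → Bnd ((suc n ∸ i) ℕ.* D) (γ d c i)
    bγ i i≤n = Bnd-⊕ (be i i≤n) (≡.subst (λ k → Bnd (k ℕ.* D) ((nκ i ⊕ ⊖ c) ⊛ d i)) (≡.sym (ℕ.+-∸-assoc 1 i≤n))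
      (Bnd-⊛ D ((n ∸ i) ℕ.* D) (nκ i ⊕ ⊖ c) (d i) (Bnd-⊕ (Bnd-≤ 1≤D (Bnd-nκ i)) (Bnd-⊖ bc)) (bd i i≤n)))
      where
      be : ∀ i → i ≤ n → Bnd ((suc n ∸ i) ℕ.* D) (δ d c i)
      be zero    _   = Bnd-𝟘
      be (suc i) i<n = Bnd-deriv (bd i (ℕ.<⇒≤ i<n))

    Γ : Poly
    Γ = Σ< (λ i → Zp i ⊛ γ d c i) n

    G≋Γ : Z ⊛ deriv f ⊕ ⊖ (c ⊛ f) ≋ Γ
    G≋Γ = begin
      Z ⊛ deriv f ⊕ ⊖ (c ⊛ f)
        ≈⟨ ⊕-cong (⊛-cong ≋-refl (deriv-cong f≋)) (⊖-cong (⊛-cong ≋-refl f≋)) ⟩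
      Z ⊛ deriv (S d (suc n)) ⊕ ⊖ (c ⊛ S d (suc n))
        ≈⟨ G-expansion d c (suc n) ⟩
      (Γ ⊕ Zp n ⊛ γ d c n) ⊕ Zp (suc n) ⊛ deriv (d n)
        ≈⟨ ⊕-cong (⊕-cong ≋-refl (≋-trans (⊛-cong ≋-refl γn≋𝟘) (P.zeroʳ (Zp n))))
             (≋-trans (⊛-cong ≋-refl (Bnd-0 (Bnd-deriv bdn))) (P.zeroʳ (Zp (suc n)))) ⟩
      (Γ ⊕ 𝟘) ⊕ 𝟘
        ≈⟨ ≋-trans (⊕-identityʳ _) (⊕-identityʳ Γ) ⟩
      Γ ∎
      where open ≋R

    Γ≋𝟘 : Γ ≋ 𝟘
    Γ≋𝟘 = many-roots⇒𝟘 L (λ x → Mult-resp G≋Γ (Mult-⊕ (zf x (count x L) (mult x)) (Mult-⊖ (Mult-⊛ c (mult x))))) (Bnd-Σ< n term)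
      where
      -- Differentiation loses one zero at x, and Z, which vanishes at x, restores it.
      zf : ∀ x m → Mult x m f → Mult x m (Z ⊛ deriv f)
      zf x zero    _ = mz
      zf x (suc m) h = Mult-resp (≋-trans (≋-sym (⊛-assoc (lin x) (quot x Z) (deriv f))) (⊛-cong (≋-sym (root⇒factor x Z (eval-Z x))) ≋-refl))
        (ms (quot x Z ⊛ deriv f) ≋-refl (Mult-⊛ (quot x Z) (Mult-deriv h)))
      term : ∀ i → i < n → Bnd (length L) (Zp i ⊛ γ d c i)
      term i i<n with split i<n
      ... | t , eq = Bnd-≤ (ℕ.+-cancelʳ-≤ r _ _ (ℕ.≤-trans
              (≡.subst (λ k → i ℕ.* p ℕ.+ (suc k ∸ i) ℕ.* D ℕ.+ r ≤ k ℕ.* p) (≡.sym eq)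
                (γ-bound i t D r p (≡.subst (λ k → suc k ℕ.* D ℕ.+ r ≤ p) eq hD))) len))
            (Bnd-Zp-⊛ i (γ d c i) (bγ i (ℕ.<⇒≤ i<n)))

    [1+n]D≤p : suc n ℕ.* D ≤ p
    [1+n]D≤p = ℕ.≤-trans (ℕ.m≤m+n _ r) hD

    γ≋𝟘 : ∀ i → i ≤ n → γ d c i ≋ 𝟘
    γ≋𝟘 i i≤n with ℕ.m≤n⇒m<n∨m≡n i≤n
    ... | inj₂ ≡.refl = γn≋𝟘
    ... | inj₁ i<n = expansion-unique (γ d c) n (λ i i<n → Bnd-≤ (ℕ.≤-trans (ℕ.*-monoˡ-≤ D (ℕ.m∸n≤m (suc n) i)) [1+n]D≤p) (bγ i (ℕ.<⇒≤ i<n)))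
                       Γ≋𝟘 i i<n

    module Least (a : ℕ) (a≤n : a ≤ n) (da≉0 : ¬ (d a ≋ 𝟘)) (below-a : ∀ i → i < a → d i ≋ 𝟘) where
      -- At i = a the relation γ i = 0 reads (a κ - c) d a = 0.
      bc₁ : Bnd 1 c
      bc₁ = Bnd-resp (⊖⇒≋ (domain _ da≉0 (≋-trans (≋-sym (⊕-identityˡ _)) (≋-trans (⊕-cong (≋-sym (ea a below-a)) ≋-refl) (γ≋𝟘 a a≤n)))))
              (Bnd-nκ a)
        where
        ea : ∀ a → (∀ i → i < a → d i ≋ 𝟘) → δ d c a ≋ 𝟘
        ea zero    _ = ≋-refl
        ea (suc a) h = ≋-trans (deriv-cong (h a (ℕ.n<1+n a))) (Bnd-0 (Bnd-deriv {0} Bnd-𝟘))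

      -- Downwards from the constant dₙ: since c is constant, γᵢ₊₁ = 0 makes dᵢ′ a constant multiple
      -- of dᵢ₊₁, so each step down gains at most one degree.
      bd′ : ∀ t i → i ℕ.+ t ≡ n → Bnd (suc t) (d i)
      bd′ zero    i eq = ≡.subst (λ k → Bnd 1 (d k)) (≡.trans (≡.sym eq) (ℕ.+-identityʳ i)) bdn
      bd′ (suc t) i eq = Bnd-antideriv (d i)
          (Bnd-≤ (ℕ.≤-trans (ℕ.+-mono-≤ 1≤D (ℕ.*-monoˡ-≤ D (ℕ.m∸n≤m n i))) [1+n]D≤p) (bd i (≡.subst (i ≤_) eq (ℕ.m≤m+n i (suc t)))))
          (Bnd-resp (≋-sym rel) (Bnd-⊖ (Bnd-⊛ 1 t (nκ (suc i) ⊕ ⊖ c) (d (suc i)) (Bnd-⊕ (Bnd-nκ (suc i)) (Bnd-⊖ bc₁)) (bd′ t (suc i) eq′))))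
        where
        eq′ : suc i ℕ.+ t ≡ n
        eq′ = ≡.trans (≡.sym (ℕ.+-suc i t)) eq
        rel : deriv (d i) ≋ ⊖ ((nκ (suc i) ⊕ ⊖ c) ⊛ d (suc i))
        rel = ⊖⇒≋ (≋-trans (PS.solve 2 (λ a b → a :+ :- (:- b) := a :+ b) ≋-refl (deriv (d i)) ((nκ (suc i) ⊕ ⊖ c) ⊛ d (suc i)))
                (γ≋𝟘 (suc i) (≡.subst (suc i ≤_) eq′ (ℕ.m≤m+n (suc i) t))))

      b = n ∸ a

      Root : F → Set
      Root x = eval x (d a) ≡ 0#

      root? : ∀ x → Dec (Root x)
      root? x = eval x (d a) ≟ 0#

      roots : List F
      roots = filter root? els

      roots≤b : length roots ≤ b
      roots≤b = ℕ.≮⇒≥ λ b<l → da≉0 (unique-roots⇒𝟘 roots (filter⁺ root? els-unique) (all-filter root? els)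
                  (Bnd-≤ b<l (bd′ b a (ℕ.m+[n∸m]≡n a≤n))))

      -- Beyond the a zeros supplied by Z^a, a further zero at x must come from dₐ + Z E, whose
      -- value at x is dₐ(x).
      nonroot : ∀ x → ¬ Root x → count x L ≤ a
      nonroot x nr = ℕ.≮⇒≥ λ a<c → nr (root a<c)
        where
        root : a < count x L → Root x
        root a<c with S-factor d a below-a b
        ... | E , eq = ≡.trans (≡.sym (≡.trans (eval-⊕ x (d a) (Z ⊛ E)) (≡.trans (≡.cong (eval x (d a) +_)
                (≡.trans (eval-⊛ x Z E) (≡.trans (≡.cong (_* eval x E) (eval-Z x)) (KR.zeroˡ _)))) (KR.+-identityʳ _))))
                (Mult-root (Mult-Π-inv (copies a) _ (≡.subst (λ k → Mult x k (Zp a ⊛ (d a ⊕ Z ⊛ E))) (≡.trans (ℕ.+-comm 1 a) (≡.cong (ℕ._+ 1) (≡.sym (count-copies x a))))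
                  (Mult-resp f≋′ (Mult-≤ a<c (mult x))))))
          where
          f≋′ : f ≋ Zp a ⊛ (d a ⊕ Z ⊛ E)
          f≋′ = ≋-trans f≋ (≋-trans (≡.subst (λ k → S d k ≋ S d (a ℕ.+ suc b)) (≡.trans (ℕ.+-suc a b) (≡.cong suc (ℕ.m+[n∸m]≡n a≤n))) ≋-refl) eq)

      Root-x₁ : Root x₁
      Root-x₁ with root? x₁
      ... | yes r = r
      ... | no nr = contradiction (ℕ.≤-trans (nonroot x₁ nr) a≤n) (ℕ.<⇒≱ n<x₁)

      -- This is where x₁ is used: its multiplicity exceeds n ≥ a, so it is a root of dₐ, and dₐ has
      -- at most b roots.
      1≤b : 1 ≤ b
      1≤b = ℕ.≤-trans (∈-length (∈-filter⁺ root? (∈-els x₁) Root-x₁)) roots≤b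

      result : ∃ λ x → p ≤ count x L ℕ.+ r
      result with any? (λ x → p ℕ.≤? count x L ℕ.+ r) els
      ... | yes some = Any.satisfied some
      ... | no none = ⊥-elim (ℕ.<⇒≱ (s≤s ℕ.≤-refl) absurd)
        where
        -- If every multiplicity is below p - r, it is at most M = p - r - 1. Summing gives n p ≤ a
        -- p + b M + r, hence b (r + 1) ≤ r, which is impossible for b ≥ 1.
        M = p ∸ suc r
        count<p : ∀ x → count x L ℕ.+ r < p
        count<p x = ℕ.≰⇒> λ h → none (Any.map (λ { ≡.refl → h }) (∈-els x))
        r<p : suc r ≤ p
        r<p = ℕ.≤-trans (s≤s (ℕ.m≤n+m r _)) (count<p x₁)
        M+1+r : M ℕ.+ suc r ≡ p
        M+1+r = ℕ.m∸n+n≡m r<p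
        count≤M : ∀ x → count x L ≤ M
        count≤M x = ℕ.≤-trans (ℕ.≤-reflexive (≡.sym (ℕ.m+n∸n≡m (count x L) (suc r))))
          (ℕ.∸-monoˡ-≤ (suc r) (≡.subst (_≤ p) (≡.sym (ℕ.+-suc (count x L) r)) (count<p x)))
        open ℕ.≤-Reasoning
        rearrange : ∀ p a b M r → p ℕ.* a ℕ.+ b ℕ.* M ℕ.+ r ≡ b ℕ.* M ℕ.+ r ℕ.+ a ℕ.* p
        rearrange = solve-∀
        expand : ∀ b M r → b ℕ.* (M ℕ.+ suc r) ≡ b ℕ.* suc r ℕ.+ b ℕ.* M
        expand = solve-∀
        upper : b ℕ.* p ≤ b ℕ.* M ℕ.+ r
        upper = ℕ.+-cancelʳ-≤ (a ℕ.* p) _ _ (begin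
          b ℕ.* p ℕ.+ a ℕ.* p                 ≡⟨ ≡.trans (≡.sym (ℕ.*-distribʳ-+ p b a)) (≡.cong (ℕ._* p) (ℕ.m∸n+n≡m a≤n)) ⟩
          n ℕ.* p                             ≤⟨ len ⟩
          length L ℕ.+ r                      ≡⟨ ≡.cong (ℕ._+ r) (≡.sym (sum-count L)) ⟩
          sum (map (λ x → count x L) els) ℕ.+ r
            ≤⟨ ℕ.+-monoˡ-≤ r (sum-bound root? (λ x → count x L) a M nonroot count≤M els) ⟩
          p ℕ.* a ℕ.+ length roots ℕ.* M ℕ.+ r ≤⟨ ℕ.+-monoˡ-≤ r (ℕ.+-monoʳ-≤ (p ℕ.* a) (ℕ.*-monoˡ-≤ M roots≤b)) ⟩
          p ℕ.* a ℕ.+ b ℕ.* M ℕ.+ r           ≡⟨ rearrange p a b M r ⟩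
          b ℕ.* M ℕ.+ r ℕ.+ a ℕ.* p           ∎)
        absurd : suc r ≤ r
        absurd = ℕ.+-cancelʳ-≤ (b ℕ.* M) _ _ (begin
          suc r ℕ.+ b ℕ.* M          ≤⟨ ℕ.+-monoˡ-≤ (b ℕ.* M) (ℕ.≤-trans (ℕ.≤-reflexive (≡.sym (ℕ.*-identityˡ (suc r)))) (ℕ.*-monoˡ-≤ (suc r) 1≤b)) ⟩
          b ℕ.* suc r ℕ.+ b ℕ.* M    ≡⟨ expand b M r ⟨
          b ℕ.* (M ℕ.+ suc r)        ≡⟨ ≡.cong (b ℕ.*_) M+1+r ⟩
          b ℕ.* p                    ≤⟨ upper ⟩
          b ℕ.* M ℕ.+ r              ≡⟨ ℕ.+-comm (b ℕ.* M) r ⟩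
          r ℕ.+ b ℕ.* M              ∎)

    result : ∃ λ x → p ≤ count x L ℕ.+ r
    result with least-nonzero d n dn≉0
    ... | a , a≤n , da≉0 , below-a = Least.result a a≤n da≉0 below-a

-- Polynomials in two variables

module Bivariate (𝔽 : FiniteField) where
  open FiniteField 𝔽
  open Univariate 𝔽
  open Polynomial K
  -- Polynomials in X whose coefficients are polynomials in Y.
  module B = Polynomial polyRing
  open B using () renaming (_⊕_ to _⊞_; _⊛_ to _⊠_; ⊖_ to ⊟_; _≋_ to _≣_; 𝟘 to 𝟎)
  module BS = RingSolver B.polyRing
  module BR = CommutativeRing B.polyRing
  open BS using (_:=_; _:+_; _:*_; :-_)

  opaque
    unfolding B._⊛_ _⊛_ eval

    -- Restriction to the line Y = y. The other restriction, to a dual line X = s(Y), is `B.eval s`.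
    σ : F → B.Poly → Poly
    σ y = map (eval y)

    coeff-σ : ∀ y P i → coeff (σ y P) i ≡ eval y (B.coeff P i)
    coeff-σ y []      i       = ≡.sym (eval-zero y ≋-refl)
    coeff-σ y (a ∷ P) zero    = ≡.refl
    coeff-σ y (a ∷ P) (suc i) = coeff-σ y P i

    σ-nil : ∀ y → σ y [] ≡ []
    σ-nil y = ≡.refl

    σ-cons : ∀ y a P → σ y (a ∷ P) ≡ eval y a ∷ σ y P
    σ-cons y a P = ≡.refl

  σ-cong : ∀ y {P Q} → P ≣ Q → σ y P ≋ σ y Q
  σ-cong y {P} {Q} e = mk λ i → ≡.trans (coeff-σ y P i) (≡.trans (eval-cong y (B.at e i)) (≡.sym (coeff-σ y Q i)))

  σ-⊞ : ∀ y P Q → σ y (P ⊞ Q) ≋ σ y P ⊕ σ y Q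
  σ-⊞ y P Q = mk λ i → ≡.trans (coeff-σ y (P ⊞ Q) i) (≡.trans (eval-cong y (B.coeff-⊕ P Q i)) (≡.trans (eval-⊕ y _ _)
    (≡.sym (≡.trans (coeff-⊕ (σ y P) (σ y Q) i) (≡.cong₂ _+_ (coeff-σ y P i) (coeff-σ y Q i))))))

  σ-⊟ : ∀ y P → σ y (⊟ P) ≋ ⊖ σ y P
  σ-⊟ y P = mk λ i → ≡.trans (coeff-σ y (⊟ P) i) (≡.trans (eval-cong y (B.coeff-⊖ P i)) (≡.trans (eval-⊖ y _)
    (≡.sym (≡.trans (coeff-⊖ (σ y P) i) (≡.cong -_ (coeff-σ y P i))))))

  σ-𝟎 : ∀ y → σ y 𝟎 ≋ 𝟘
  σ-𝟎 y = mk λ i → ≡.trans (coeff-σ y 𝟎 i) (≡.trans (eval-zero y (B.coeff-𝟘 i)) (≡.sym (coeff-𝟘 i)))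

  σ-scale : ∀ y a P → σ y (B.scale a P) ≋ scale (eval y a) (σ y P)
  σ-scale y a P = mk λ i → ≡.trans (coeff-σ y (B.scale a P) i) (≡.trans (eval-cong y (B.coeff-scale a P i)) (≡.trans (eval-⊛ y _ _)
    (≡.sym (≡.trans (coeff-scale (eval y a) (σ y P) i) (≡.cong (eval y a *_) (coeff-σ y P i))))))

  σ-shift : ∀ y P → σ y (B.shift P) ≋ shift (σ y P)
  σ-shift y P = mk λ
    { zero → ≡.trans (coeff-σ y (B.shift P) 0) (≡.trans (eval-zero y (B.coeff-shift-zero P)) (≡.sym (coeff-shift-zero _)))
    ; (suc i) → ≡.trans (coeff-σ y (B.shift P) (suc i)) (≡.trans (eval-cong y (B.coeff-shift-suc P i))
        (≡.sym (≡.trans (coeff-shift-suc _ i) (coeff-σ y P i)))) }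

  σ-const : ∀ y a → σ y (B.const a) ≋ const (eval y a)
  σ-const y a = mk λ
    { zero → ≡.trans (coeff-σ y (B.const a) 0) (≡.trans (eval-cong y (B.coeff-const-zero a)) (≡.sym (coeff-const-zero _)))
    ; (suc i) → ≡.trans (coeff-σ y (B.const a) (suc i)) (≡.trans (eval-zero y (B.coeff-const-suc a i)) (≡.sym (coeff-const-suc _ i))) }

  σ-⊠ : ∀ y P Q → σ y (P ⊠ Q) ≋ σ y P ⊛ σ y Q
  σ-⊠ y [] Q = ≋-trans (σ-cong y (B.nil-⊛ Q)) (≋-trans (σ-𝟎 y) (≋-sym (≡.subst (λ g → g ⊛ σ y Q ≋ 𝟘) (≡.sym (σ-nil y)) (nil-⊛ (σ y Q)))))
  σ-⊠ y (a ∷ P) Q = begin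
    σ y ((a ∷ P) ⊠ Q)
      ≈⟨ ≋-trans (σ-cong y (B.cons-⊛ a P Q)) (σ-⊞ y (B.scale a Q) (B.shift (P ⊠ Q))) ⟩
    σ y (B.scale a Q) ⊕ σ y (B.shift (P ⊠ Q))
      ≈⟨ ⊕-cong (σ-scale y a Q) (≋-trans (σ-shift y (P ⊠ Q)) (shift-cong (σ-⊠ y P Q))) ⟩
    scale (eval y a) (σ y Q) ⊕ shift (σ y P ⊛ σ y Q)
      ≈⟨ cons-⊛ (eval y a) (σ y P) (σ y Q) ⟨
    (eval y a ∷ σ y P) ⊛ σ y Q
      ≡⟨ ≡.cong (_⊛ σ y Q) (σ-cons y a P) ⟨
    σ y (a ∷ P) ⊛ σ y Q ∎
    where open ≋R

  σ-lin : ∀ y s → σ y (B.lin s) ≋ lin (eval y s)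
  σ-lin y s = begin
    σ y (B.lin s)
      ≈⟨ ≋-trans (σ-cong y (B.lin-shift s)) (σ-⊞ y (B.const (⊖ s)) (B.shift (B.const (const 1#)))) ⟩
    σ y (B.const (⊖ s)) ⊕ σ y (B.shift (B.const (const 1#)))
      ≈⟨ ⊕-cong (≋-trans (σ-const y (⊖ s)) (const-cong (eval-⊖ y s)))
           (≋-trans (σ-shift y _) (shift-cong (≋-trans (σ-const y _) (const-cong (eval-const y 1#))))) ⟩
    const (- eval y s) ⊕ shift (const 1#)
      ≈⟨ lin-shift (eval y s) ⟨
    lin (eval y s) ∎
    where open ≋R

  σ-Π : ∀ y ss → σ y (B.Π ss) ≋ Π (map (eval y) ss)
  σ-Π y []       = ≋-trans (σ-const y (const 1#)) (const-cong (eval-const y 1#))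
  σ-Π y (s ∷ ss) = ≋-trans (σ-⊠ y (B.lin s) (B.Π ss)) (⊛-cong (σ-lin y s) (σ-Π y ss))

  -- Together with `T` below: X - x and Y - y, the generators of the ideal of the point (x, y).
  X̂ : F → B.Poly
  X̂ x = B.lin (const x)

  T : F → B.Poly
  T y = B.const (lin y)

  σ-X̂ : ∀ y x → σ y (X̂ x) ≋ lin x
  σ-X̂ y x = ≋-trans (σ-lin y (const x)) (lin-cong (eval-const y x))

  σ-T : ∀ y z → σ y (T z) ≋ const (y + - z)
  σ-T y z = ≋-trans (σ-const y (lin z)) (const-cong (eval-lin y z))

  σ-T-same : ∀ y → σ y (T y) ≋ 𝟘
  σ-T-same y = ≋-trans (σ-T y y) (≋-trans (const-cong (KR.-‿inverseʳ y)) const-0)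

  σ𝟘⇒T-factor : ∀ y P → σ y P ≋ 𝟘 → P ≣ T y ⊠ map (quot y) P
  σ𝟘⇒T-factor y P e = B.mk λ i → ≋-trans (root⇒factor y (B.coeff P i) (≡.trans (≡.sym (coeff-σ y P i)) (≡.trans (at e i) (coeff-𝟘 i))))
    (≋-sym (≋-trans (B.coeff-const-⊛ (lin y) (map (quot y) P) i) (⊛-cong ≋-refl (coeff-map P i))))
    where
    opaque
      unfolding quot 𝟘
      coeff-map : ∀ P i → B.coeff (map (quot y) P) i ≋ quot y (B.coeff P i)
      coeff-map []      i       = ≋-refl
      coeff-map (a ∷ P) zero    = ≋-refl
      coeff-map (a ∷ P) (suc i) = coeff-map P i

  T-zero : ∀ y P → T y ⊠ P ≣ 𝟎 → P ≣ 𝟎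
  T-zero y P e = B.mk λ i → ≋-trans (lin-zero y (B.coeff P i) (≋-trans (≋-sym (B.coeff-const-⊛ (lin y) P i)) (≋-trans (B.at e i) (B.coeff-𝟘 i))))
    (≋-sym (B.coeff-𝟘 i))

  T-cancel : ∀ y {P Q} → T y ⊠ P ≣ T y ⊠ Q → P ≣ Q
  T-cancel y {P} {Q} e = B.⊖⇒≋ (T-zero y (P ⊞ ⊟ Q) (B.≋-trans
    (BS.solve 3 (λ l p q → l :* (p :+ :- q) := l :* p :+ :- (l :* q)) B.≋-refl (T y) P Q) (B.≋⇒⊖ e)))

  -- The total degree of P is less than m.
  record TB (m : ℕ) (P : B.Poly) : Set where
    constructor mkTB
    field bound : ∀ i → Bnd (m ∸ i) (B.coeff P i)
  open TB public

  TB-resp : ∀ {m P Q} → P ≣ Q → TB m P → TB m Q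
  TB-resp e b = mkTB λ i → Bnd-resp (B.at e i) (bound b i)

  TB-≤ : ∀ {m k P} → m ≤ k → TB m P → TB k P
  TB-≤ m≤k b = mkTB λ i → Bnd-≤ (ℕ.∸-monoˡ-≤ i m≤k) (bound b i)

  TB-⊞ : ∀ {m P Q} → TB m P → TB m Q → TB m (P ⊞ Q)
  TB-⊞ {m} {P} {Q} b c = mkTB λ i → Bnd-resp (≋-sym (B.coeff-⊕ P Q i)) (Bnd-⊕ (bound b i) (bound c i))

  TB-⊟ : ∀ {m P} → TB m P → TB m (⊟ P)
  TB-⊟ {m} {P} b = mkTB λ i → Bnd-resp (≋-sym (B.coeff-⊖ P i)) (Bnd-⊖ (bound b i))

  TB-𝟎 : ∀ {m} → TB m 𝟎
  TB-𝟎 = mkTB λ i → Bnd-resp (≋-sym (B.coeff-𝟘 i)) Bnd-𝟘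

  TB-const : ∀ {m c} → Bnd m c → TB m (B.const c)
  TB-const {m} {c} b = mkTB λ { zero → Bnd-resp (≋-sym (B.coeff-const-zero c)) b
                              ; (suc i) → Bnd-resp (≋-sym (B.coeff-const-suc c i)) Bnd-𝟘 }

  -- For a = 0 truncated subtraction makes the hypothesis say that `q` is zero; so the bounds m - i
  -- in `TB` are treated uniformly, also where i exceeds m.
  Bnd-⊛-affine : ∀ a {s q} → Bnd 2 s → Bnd (a ∸ 1) q → Bnd a (s ⊛ q)
  Bnd-⊛-affine zero    {s} {q} bs bq = Bnd-resp (≋-sym (≋-trans (⊛-cong ≋-refl (Bnd-0 bq)) (P.zeroʳ s))) Bnd-𝟘
  Bnd-⊛-affine (suc a) {s} {q} bs bq = Bnd-resp (⊛-comm q s) (Bnd-≤ (ℕ.≤-reflexive (ℕ.+-comm a 1)) (Bnd-⊛ a 1 q s bq bs))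

  private
    ∸-pred : ∀ m i → m ∸ suc i ≡ m ∸ i ∸ 1
    ∸-pred m i = ≡.trans (≡.cong (m ∸_) (ℕ.+-comm 1 i)) (≡.sym (ℕ.∸-+-assoc m i 1))

  TB-lin : ∀ {m s Q} → Bnd 2 s → TB m Q → TB (suc m) (B.lin s ⊠ Q)
  TB-lin {m} {s} {Q} bs b = mkTB λ
    { zero    → Bnd-resp (≋-sym (B.coeff-lin-zero s Q)) (Bnd-⊛-affine (suc m) (Bnd-⊖ bs) (bound b 0))
    ; (suc i) → Bnd-resp (≋-sym (B.coeff-lin s Q i)) (Bnd-⊕ (bound b i)
        (Bnd-⊛-affine (m ∸ i) (Bnd-⊖ bs) (≡.subst (λ k → Bnd k (B.coeff Q (suc i))) (∸-pred m i) (bound b (suc i))))) }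

  -- The coefficients of Q are recovered from the top: the k-th is the coefficient of X^(k+1) in the
  -- product plus s times the next one of Q, and an affine s raises degrees by at most one.
  TB-lin-inv : ∀ {m s} Q → Bnd 2 s → TB (suc m) (B.lin s ⊠ Q) → TB m Q
  TB-lin-inv {m} {s} Q bs b = mkTB λ i → go (length Q) i (λ j l≤j → Bnd-resp (≋-sym (B.vanish (B.Bnd-length Q) j l≤j)) Bnd-𝟘)
    where
    step : ∀ k → Bnd (m ∸ suc k) (B.coeff Q (suc k)) → Bnd (m ∸ k) (B.coeff Q k)
    step k h = Bnd-resp (≋-sym eq) (Bnd-⊕ (bound b (suc k)) (Bnd-⊛-affine (m ∸ k) bs (≡.subst (λ j → Bnd j (B.coeff Q (suc k))) (∸-pred m k) h)))
      where
      eq : B.coeff Q k ≋ B.coeff (B.lin s ⊠ Q) (suc k) ⊕ s ⊛ B.coeff Q (suc k)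
      eq = ≋-trans (PS.solve 3 (λ a s b → a PS.:= (a PS.:+ (PS.:- s) PS.:* b) PS.:+ s PS.:* b) ≋-refl (B.coeff Q k) s (B.coeff Q (suc k)))
             (⊕-cong (≋-sym (B.coeff-lin s Q k)) ≋-refl)
    go : ∀ l i → (∀ j → l ≤ j → Bnd (m ∸ j) (B.coeff Q j)) → Bnd (m ∸ i) (B.coeff Q i)
    go zero    i h = h i z≤n
    go (suc l) i h = go l i λ j l≤j → h′ j (ℕ.m≤n⇒m<n∨m≡n l≤j)
      where
      h′ : ∀ j → l < j ⊎ l ≡ j → Bnd (m ∸ j) (B.coeff Q j)
      h′ j (inj₁ l<j)    = h j l<j
      h′ j (inj₂ ≡.refl) = step l (h (suc l) ℕ.≤-refl)

  TB-Π : ∀ ss → All (Bnd 2) ss → TB (suc (length ss)) (B.Π ss)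
  TB-Π []       []       = TB-const (Bnd-const 1#)
  TB-Π (s ∷ ss) (b ∷ bs) = TB-lin b (TB-Π ss bs)

  TB-Π-inv : ∀ {m} ss Q → All (Bnd 2) ss → TB (length ss ℕ.+ m) (B.Π ss ⊠ Q) → TB m Q
  TB-Π-inv []       Q _        h = TB-resp (BR.*-identityˡ Q) h
  TB-Π-inv (s ∷ ss) Q (b ∷ bs) h = TB-Π-inv ss Q bs (TB-lin-inv (B.Π ss ⊠ Q) b (TB-resp (B.⊛-assoc (B.lin s) (B.Π ss) Q) h))

  TB-T-inv : ∀ {m y} Q → TB (suc m) (T y ⊠ Q) → TB m Q
  TB-T-inv {m} {y} Q b = mkTB λ i → ≡.subst (λ k → Bnd k (B.coeff Q i)) (eq i)
    (Bnd-lin-inv y (B.coeff Q i) (Bnd-resp (B.coeff-const-⊛ (lin y) Q i) (bound b i)))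
    where
    eq : ∀ i → suc m ∸ i ∸ 1 ≡ m ∸ i
    eq i = ≡.trans (ℕ.∸-+-assoc (suc m) i 1) (≡.cong (suc m ∸_) (ℕ.+-comm i 1))

  TB-σ : ∀ {m P} y → TB m P → Bnd m (σ y P)
  TB-σ {m} {P} y b = mkB λ k m≤k → ≡.trans (coeff-σ y P k) (eval-zero y (Bnd-0 (≡.subst (λ j → Bnd j (B.coeff P k)) (ℕ.m≤n⇒m∸n≡0 m≤k) (bound b k))))

  TB-eval : ∀ {m s} P → Bnd 2 s → TB m P → Bnd m (B.eval s P)
  TB-eval {m} {s} []      bs b = Bnd-resp (≋-sym (B.eval-nil s)) Bnd-𝟘
  TB-eval {m} {s} (a ∷ P) bs b = Bnd-resp (≋-sym (B.eval-cons s a P)) (Bnd-⊕ (bound b 0)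
    (Bnd-⊛-affine m bs (TB-eval P bs (mkTB λ i → ≡.subst (λ k → Bnd k (B.coeff P i)) (≡.sym (ℕ.∸-+-assoc m 1 i)) (bound b (suc i))))))

  -- Successive division by the factors X - s. Because each s is affine, no step exceeds the total
  -- degree of P, while the remainder also gets degree below `length ss` in X.
  divΠ : ∀ {m} ss → All (Bnd 2) ss → ∀ P → TB (length ss ℕ.+ m) P → ∃₂ λ Q C →
    P ≣ B.Π ss ⊠ Q ⊞ C × TB m Q × TB (length ss ℕ.+ m) C × B.Bnd (length ss) C
  divΠ [] [] P h = P , 𝟎 , B.≋-sym (B.≋-trans (B.⊕-identityʳ _) (BR.*-identityˡ P)) , h , TB-𝟎 , B.Bnd-𝟘
  divΠ {m} (s ∷ ss) (b ∷ bs) P h = step (divΠ {m} ss bs (B.quot s P) (TB-lin-inv (B.quot s P) b (TB-resp eq (TB-⊞ h (TB-⊟ hc)))))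
    where
    c L : B.Poly
    c = B.const (B.eval s P)
    L = B.lin s ⊠ B.quot s P
    hc : TB (suc (length ss ℕ.+ m)) c
    hc = TB-const (TB-eval P b h)
    eq : P ⊞ ⊟ c ≣ L
    eq = B.≋-trans (B.⊕-cong (B.quot-spec s P) B.≋-refl) (BS.solve 2 (λ l c → (l :+ c) :+ :- c := l) B.≋-refl L c)
    step : (∃₂ λ Q C → B.quot s P ≣ B.Π ss ⊠ Q ⊞ C × TB m Q × TB (length ss ℕ.+ m) C × B.Bnd (length ss) C) →
           ∃₂ λ Q C → P ≣ B.Π (s ∷ ss) ⊠ Q ⊞ C × TB m Q × TB (suc (length ss ℕ.+ m)) C × B.Bnd (suc (length ss)) C
    step (Q , C , e , hQ , hC , bC) = Q , B.lin s ⊠ C ⊞ c ,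
      B.≋-trans (B.quot-spec s P) (B.≋-trans (B.⊕-cong (B.⊛-cong B.≋-refl e) B.≋-refl)
        (BS.solve 5 (λ l π q c k → l :* (π :* q :+ c) :+ k := (l :* π) :* q :+ (l :* c :+ k)) B.≋-refl (B.lin s) (B.Π ss) Q C c)) ,
      hQ , TB-⊞ (TB-lin b hC) hc ,
      B.Bnd-⊕ (B.Bnd-resp (B.⊛-comm C (B.lin s)) (B.Bnd-≤ (ℕ.≤-reflexive (ℕ.+-comm (length ss) 1)) (B.Bnd-⊛ (length ss) 1 C (B.lin s) bC (B.Bnd-lin-2 s))))
              (B.Bnd-≤ (s≤s z≤n) (B.Bnd-const (B.eval s P)))

  Bnd-σ : ∀ {m P} y → B.Bnd m P → Bnd m (σ y P)
  Bnd-σ {m} {P} y b = mkB λ k m≤k → ≡.trans (coeff-σ y P k) (eval-zero y (B.vanish b k m≤k))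

-- Order of vanishing at a point

module Order (𝔽 : FiniteField) where
  open FiniteField 𝔽
  open Univariate 𝔽
  open Bivariate 𝔽
  open Rédei 𝔽
  open Polynomial K
  open B using () renaming (_⊕_ to _⊞_; _⊛_ to _⊠_; ⊖_ to ⊟_; _≋_ to _≣_; 𝟘 to 𝟎)
  open BS using (_:=_; _:+_; _:*_; :-_)

  𝟙 : B.Poly
  𝟙 = B.const (const 1#)

  prod : List B.Poly → B.Poly
  prod []       = 𝟙
  prod (E ∷ Es) = E ⊠ prod Es

  -- P lies in the m-th power of the ideal (X - x, Y - y).
  data Ord (x y : F) : ℕ → B.Poly → Set where
    oz : ∀ {P} → Ord x y 0 P
    os : ∀ {m P} P₁ P₂ → P ≣ X̂ x ⊠ P₁ ⊞ T y ⊠ P₂ → Ord x y m P₁ → Ord x y m P₂ → Ord x y (suc m) P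

  module _ {x y : F} where

    Ord-resp : ∀ {m P Q} → P ≣ Q → Ord x y m P → Ord x y m Q
    Ord-resp e oz             = oz
    Ord-resp e (os a b f r s) = os a b (B.≋-trans (B.≋-sym e) f) r s

    Ord-⊞ : ∀ {m P Q} → Ord x y m P → Ord x y m Q → Ord x y m (P ⊞ Q)
    Ord-⊞ oz oz = oz
    Ord-⊞ (os a b e r s) (os a′ b′ e′ r′ s′) = os (a ⊞ a′) (b ⊞ b′) (B.≋-trans (B.⊕-cong e e′)
      (BS.solve 6 (λ X T a b a′ b′ → (X :* a :+ T :* b) :+ (X :* a′ :+ T :* b′) := X :* (a :+ a′) :+ T :* (b :+ b′)) B.≋-refl
        (X̂ x) (T y) a b a′ b′)) (Ord-⊞ r r′) (Ord-⊞ s s′)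

    Ord-⊠ : ∀ {m P} Q → Ord x y m P → Ord x y m (Q ⊠ P)
    Ord-⊠ Q oz = oz
    Ord-⊠ Q (os a b e r s) = os (Q ⊠ a) (Q ⊠ b) (B.≋-trans (B.⊛-cong B.≋-refl e)
      (BS.solve 5 (λ X T a b q → q :* (X :* a :+ T :* b) := X :* (q :* a) :+ T :* (q :* b)) B.≋-refl (X̂ x) (T y) a b Q))
      (Ord-⊠ Q r) (Ord-⊠ Q s)

    Ord-⊟ : ∀ {m P} → Ord x y m P → Ord x y m (⊟ P)
    Ord-⊟ {m} {P} r = Ord-resp (B.≋-trans (BS.solve 2 (λ o g → (:- o) :* g := :- (o :* g)) B.≋-refl 𝟙 P)
      (B.⊖-cong (BR.*-identityˡ P))) (Ord-⊠ (⊟ 𝟙) r)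

    Ord-≤ : ∀ {m k P} → k ≤ m → Ord x y m P → Ord x y k P
    Ord-≤ z≤n       _              = oz
    Ord-≤ (s≤s k≤m) (os a b e r s) = os a b e (Ord-≤ k≤m r) (Ord-≤ k≤m s)

    Ord-1⊠ : ∀ {m E P} → Ord x y 1 E → Ord x y m P → Ord x y (suc m) (E ⊠ P)
    Ord-1⊠ {E = E} {P} (os a b e _ _) r = os (a ⊠ P) (b ⊠ P) (B.≋-trans (B.⊛-cong e B.≋-refl)
      (BS.solve 5 (λ X T a b q → (X :* a :+ T :* b) :* q := X :* (a :* q) :+ T :* (b :* q)) B.≋-refl (X̂ x) (T y) a b P))
      (Ord-⊠ a r) (Ord-⊠ b r)

    Ord-X̂ : Ord x y 1 (X̂ x)
    Ord-X̂ = os 𝟙 𝟎 (B.≋-sym (B.≋-trans (B.⊕-cong (BR.*-identityʳ (X̂ x)) (BR.zeroʳ (T y))) (B.⊕-identityʳ (X̂ x)))) oz oz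

    Ord-T : Ord x y 1 (T y)
    Ord-T = os 𝟎 𝟙 (B.≋-sym (B.≋-trans (B.⊕-cong (BR.zeroʳ (X̂ x)) (BR.*-identityʳ (T y))) (B.⊕-identityˡ (T y)))) oz oz

    -- The expansion of X - s(Y) at (x, y): its value there plus an element of the ideal of the
    -- point.
    lin-split : ∀ s → B.lin s ≣ B.const (const (x + - eval y s)) ⊞ (X̂ x ⊠ 𝟙 ⊞ T y ⊠ B.const (⊖ quot y s))
    lin-split s = begin
      B.lin s
        ≈⟨ B.lin-diff s (const x) ⟩
      X̂ x ⊞ B.const (const x ⊕ ⊖ s)
        ≈⟨ B.⊕-cong (B.≋-sym (BR.*-identityʳ (X̂ x))) (B.const-cong eq) ⟩
      X̂ x ⊠ 𝟙 ⊞ B.const (const (x + - eval y s) ⊕ lin y ⊛ ⊖ quot y s)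
        ≈⟨ B.⊕-cong B.≋-refl (B.≋-trans (B.const-+ _ _) (B.⊕-cong B.≋-refl (B.const-* (lin y) (⊖ quot y s)))) ⟩
      X̂ x ⊠ 𝟙 ⊞ (B.const (const (x + - eval y s)) ⊞ T y ⊠ B.const (⊖ quot y s))
        ≈⟨ BS.solve 3 (λ a b c → a :+ (b :+ c) := b :+ (a :+ c)) B.≋-refl (X̂ x ⊠ 𝟙) (B.const (const (x + - eval y s))) (T y ⊠ B.const (⊖ quot y s)) ⟩
      B.const (const (x + - eval y s)) ⊞ (X̂ x ⊠ 𝟙 ⊞ T y ⊠ B.const (⊖ quot y s)) ∎
      where
      open B.≋R
      eq : const x ⊕ ⊖ s ≋ const (x + - eval y s) ⊕ lin y ⊛ ⊖ quot y s
      eq = ≋-trans (⊕-cong ≋-refl (⊖-cong (quot-spec y s))) (≋-trans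
        (PS.solve 4 (λ x l q c → x PS.:+ PS.:- (l PS.:* q PS.:+ c) PS.:= (x PS.:+ PS.:- c) PS.:+ l PS.:* (PS.:- q)) ≋-refl (const x) (lin y) (quot y s) (const (eval y s)))
        (⊕-cong (≋-sym (≋-trans (const-+ x (- eval y s)) (⊕-cong ≋-refl (const-neg (eval y s))))) ≋-refl))

    Ord-lin-rest : ∀ s → Ord x y 1 (X̂ x ⊠ 𝟙 ⊞ T y ⊠ B.const (⊖ quot y s))
    Ord-lin-rest s = os 𝟙 (B.const (⊖ quot y s)) B.≋-refl oz oz

    lin-pass : ∀ s → eval y s ≡ x → B.lin s ≣ X̂ x ⊠ 𝟙 ⊞ T y ⊠ B.const (⊖ quot y s)
    lin-pass s e = B.≋-trans (lin-split s) (B.≋-trans (B.⊕-cong c≣𝟎 B.≋-refl) (B.⊕-identityˡ _))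
      where
      c≣𝟎 : B.const (const (x + - eval y s)) ≣ 𝟎
      c≣𝟎 = B.≋-trans (B.const-cong (≋-trans (const-cong (≡.trans (≡.cong (λ z → x + - z) e) (KR.-‿inverseʳ x))) const-0)) B.const-0

    Ord-lin : ∀ s → eval y s ≡ x → Ord x y 1 (B.lin s)
    Ord-lin s e = Ord-resp (B.≋-sym (lin-pass s e)) (Ord-lin-rest s)

    Ord-Π : ∀ ss → Ord x y (count x (map (eval y) ss)) (B.Π ss)
    Ord-Π []       = oz
    Ord-Π (s ∷ ss) with x ≟ eval y s
    ... | yes e = Ord-1⊠ (Ord-lin s (≡.sym e)) (Ord-Π ss)
    ... | no _  = Ord-⊠ (B.lin s) (Ord-Π ss)

    Ord⇒Mult-σ : ∀ {m P} → Ord x y m P → Mult x m (σ y P)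
    Ord⇒Mult-σ oz = mz
    Ord⇒Mult-σ {suc m} {P} (os a b e r s) = ms (σ y a) eq (Ord⇒Mult-σ r)
      where
      eq : σ y P ≋ lin x ⊛ σ y a
      eq = ≋-trans (σ-cong y e) (≋-trans (σ-⊞ y (X̂ x ⊠ a) (T y ⊠ b))
        (≋-trans (⊕-cong (≋-trans (σ-⊠ y (X̂ x) a) (⊛-cong (σ-X̂ y x) ≋-refl))
          (≋-trans (σ-⊠ y (T y) b) (≋-trans (⊛-cong (σ-T-same y) ≋-refl) (P.zeroˡ (σ y b))))) (⊕-identityʳ _)))

    -- On a curve X = s(Y) through (x, y) both generators of the ideal become divisible by Y - y.
    Ord⇒Mult-eval : ∀ {m P} s → eval y s ≡ x → Ord x y m P → Mult y m (B.eval s P)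
    Ord⇒Mult-eval s h oz = mz
    Ord⇒Mult-eval {suc m} {P} s h (os a b e r t) =
      ms (quot y s ⊛ B.eval s a ⊕ B.eval s b) eq (Mult-⊕ (Mult-⊛ (quot y s) (Ord⇒Mult-eval s h r)) (Ord⇒Mult-eval s h t))
      where
      s-x : B.eval s (X̂ x) ≋ lin y ⊛ quot y s
      s-x = ≋-trans (B.eval-lin s (const x)) (≋-trans (⊕-cong (≋-trans (quot-spec y s) (⊕-cong ≋-refl (const-cong h))) ≋-refl)
              (PS.solve 2 (λ a b → (a PS.:+ b) PS.:+ PS.:- b PS.:= a) ≋-refl (lin y ⊛ quot y s) (const x)))
      eq : B.eval s P ≋ lin y ⊛ (quot y s ⊛ B.eval s a ⊕ B.eval s b)
      eq = ≋-trans (B.eval-cong s e) (≋-trans (B.eval-⊕ s (X̂ x ⊠ a) (T y ⊠ b))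
        (≋-trans (⊕-cong (≋-trans (B.eval-⊛ s (X̂ x) a) (⊛-cong s-x ≋-refl)) (≋-trans (B.eval-⊛ s (T y) b) (⊛-cong (B.eval-const s (lin y)) ≋-refl)))
          (PS.solve 4 (λ l q a b → (l PS.:* q) PS.:* a PS.:+ l PS.:* b PS.:= l PS.:* (q PS.:* a PS.:+ b)) ≋-refl (lin y) (quot y s) (B.eval s a) (B.eval s b))))

    -- `Unit` is meant for factors that do not vanish at the point, `Div` for linear factors that
    -- do; together they bound the order lost when a product is divided out.
    Unit Div : B.Poly → Set
    Unit E = ∀ m P → Ord x y m (E ⊠ P) → Ord x y m P
    Div E = ∀ m P → Ord x y (suc m) (E ⊠ P) → Ord x y m P

    -- Induction on the order: in k P = E P - E′ P the first term has order m + 1 by hypothesis, and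
    -- the second because P already has order m.
    unit : ∀ {E E′} k → k ≢ 0# → E ≣ B.const (const k) ⊞ E′ → Ord x y 1 E′ → Unit E
    unit k k≢0 e o zero P _ = oz
    unit {E} {E′} k k≢0 e o (suc m) P h = Ord-resp inv (Ord-⊠ (B.const (const k⁻¹)) (Ord-⊞ h (Ord-⊟ (Ord-1⊠ o (unit k k≢0 e o m P (Ord-≤ (ℕ.n≤1+n m) h))))))
      where
      k⁻¹ : F
      k⁻¹ = proj₁ (inverse k k≢0)
      kk : B.const (const k⁻¹) ⊠ B.const (const k) ≣ 𝟙
      kk = B.≋-trans (B.≋-sym (B.const-* (const k⁻¹) (const k))) (B.const-cong (≋-trans (≋-sym (const-* k⁻¹ k))
             (const-cong (≡.trans (KR.*-comm k⁻¹ k) (proj₂ (inverse k k≢0))))))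
      inv : B.const (const k⁻¹) ⊠ (E ⊠ P ⊞ ⊟ (E′ ⊠ P)) ≣ P
      inv = B.≋-trans (B.⊛-cong B.≋-refl (B.⊕-cong (B.⊛-cong e B.≋-refl) B.≋-refl))
        (B.≋-trans (BS.solve 4 (λ i k e p → i :* ((k :+ e) :* p :+ :- (e :* p)) := (i :* k) :* p) B.≋-refl (B.const (const k⁻¹)) (B.const (const k)) E′ P)
          (B.≋-trans (B.⊛-cong kk B.≋-refl) (BR.*-identityˡ P)))

    lin-unit : ∀ s → x ≢ eval y s → Unit (B.lin s)
    lin-unit s ne = unit (x + - eval y s) (λ z → ne (x-y≡0⇒x≡y z)) (lin-split s) (Ord-lin-rest s)

    T-unit : ∀ z → y ≢ z → Unit (T z)
    T-unit z ne = unit (y + - z) (λ e → ne (x-y≡0⇒x≡y e))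
      (B.≋-trans (B.const-cong (≋-trans (lin-diff z y) (⊕-comm (lin y) (const (y + - z))))) (B.const-+ (const (y + - z)) (lin y))) Ord-T

    -- Setting Y = y in (Y - y) P = (X - x) a + (Y - y) b shows that Y - y divides a. With a = (Y -
    -- y) q this gives P = (X - x) q + b, and induction applies to q.
    T-div : Div (T y)
    T-div zero    P _ = oz
    T-div (suc m) P (os a b e r s) = Ord-resp (B.≋-sym (T-cancel y eq))
        (Ord-⊞ (Ord-1⊠ Ord-X̂ (T-div m q (Ord-resp a≣ r))) s)
      where
      q : B.Poly
      q = map (quot y) a
      σa : σ y a ≋ 𝟘
      σa = lin-zero x (σ y a) (begin
        lin x ⊛ σ y a                        ≈⟨ ≋-trans (≋-sym (⊕-identityʳ _)) (⊕-cong (⊛-cong (≋-sym (σ-X̂ y x)) ≋-refl) (≋-sym (P.zeroˡ (σ y b)))) ⟩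
        σ y (X̂ x) ⊛ σ y a ⊕ 𝟘 ⊛ σ y b        ≈⟨ ⊕-cong (≋-sym (σ-⊠ y (X̂ x) a)) (≋-trans (⊛-cong (≋-sym (σ-T-same y)) ≋-refl) (≋-sym (σ-⊠ y (T y) b))) ⟩
        σ y (X̂ x ⊠ a) ⊕ σ y (T y ⊠ b)        ≈⟨ ≋-trans (≋-sym (σ-⊞ y (X̂ x ⊠ a) (T y ⊠ b))) (σ-cong y (B.≋-sym e)) ⟩
        σ y (T y ⊠ P)                        ≈⟨ ≋-trans (σ-⊠ y (T y) P) (⊛-cong (σ-T-same y) ≋-refl) ⟩
        𝟘 ⊛ σ y P                            ≈⟨ P.zeroˡ (σ y P) ⟩
        𝟘                                    ∎)
        where open ≋R
      a≣ : a ≣ T y ⊠ q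
      a≣ = σ𝟘⇒T-factor y a σa
      eq : T y ⊠ P ≣ T y ⊠ (X̂ x ⊠ q ⊞ b)
      eq = B.≋-trans e (B.≋-trans (B.⊕-cong (B.⊛-cong B.≋-refl a≣) B.≋-refl)
        (BS.solve 4 (λ X T q b → X :* (T :* q) :+ T :* b := T :* (X :* q :+ b)) B.≋-refl (X̂ x) (T y) q b))

    -- The argument of `T-div` with the restriction to X = s(Y) in place of Y = y, after X - x has
    -- been replaced by X - s as a generator of the ideal.
    lin-div : ∀ s → eval y s ≡ x → Div (B.lin s)
    lin-div s h zero    P _ = oz
    lin-div s h (suc m) P (os a b e r t) = Ord-resp (B.≋-sym P≣)
        (Ord-⊞ r (Ord-1⊠ Ord-T (lin-div s h m q (Ord-resp c≣ (Ord-⊞ t (Ord-⊠ (⊟ κ′) r))))))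
      where
      κ′ c q R : B.Poly
      κ′ = B.const (⊖ quot y s)
      c = b ⊞ (⊟ κ′) ⊠ a
      q = B.quot s c
      R = P ⊞ ⊟ a
      -- Since X - x = (X - s) - (Y - y) κ′, the relation e becomes (X - s)(P - a) = (Y - y) c.
      eq : B.lin s ⊠ R ≣ T y ⊠ c
      eq = begin
        B.lin s ⊠ (P ⊞ ⊟ a)
          ≈⟨ BS.solve 3 (λ l p a → l :* (p :+ :- a) := l :* p :+ :- (l :* a)) B.≋-refl (B.lin s) P a ⟩
        B.lin s ⊠ P ⊞ ⊟ (B.lin s ⊠ a)
          ≈⟨ B.⊕-cong e (B.⊖-cong (B.⊛-cong (B.≋-trans (lin-pass s h) (B.⊕-cong (BR.*-identityʳ (X̂ x)) B.≋-refl)) B.≋-refl)) ⟩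
        (X̂ x ⊠ a ⊞ T y ⊠ b) ⊞ ⊟ ((X̂ x ⊞ T y ⊠ κ′) ⊠ a)
          ≈⟨ BS.solve 5 (λ X a T b k → (X :* a :+ T :* b) :+ :- ((X :+ T :* k) :* a) := T :* (b :+ (:- k) :* a)) B.≋-refl (X̂ x) a (T y) b κ′ ⟩
        T y ⊠ c ∎
        where open B.≋R
      eval-c : B.eval s c ≋ 𝟘
      eval-c = lin-zero y (B.eval s c) (≋-trans (⊛-cong (≋-sym (B.eval-const s (lin y))) ≋-refl)
        (≋-trans (≋-sym (B.eval-⊛ s (T y) c)) (≋-trans (B.eval-cong s (B.≋-sym eq)) (≋-trans (B.eval-lin-⊛ s s R)
          (≋-trans (⊛-cong (⊖-inverseʳ s) ≋-refl) (P.zeroˡ _))))))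
      c≣ : c ≣ B.lin s ⊠ q
      c≣ = B.root⇒factor s c eval-c
      R≣ : R ≣ T y ⊠ q
      R≣ = B.lin-cancel s (B.≋-trans eq (B.≋-trans (B.⊛-cong B.≋-refl c≣)
             (BS.solve 3 (λ T l q → T :* (l :* q) := l :* (T :* q)) B.≋-refl (T y) (B.lin s) q)))
      P≣ : P ≣ a ⊞ T y ⊠ q
      P≣ = B.≋-trans (BS.solve 2 (λ p a → p := a :+ (p :+ :- a)) B.≋-refl P a) (B.⊕-cong B.≋-refl R≣)

    module _ {V : Set} (E : V → B.Poly) where

      prod-unit : ∀ vs → All (Unit ∘ E) vs → Unit (prod (map E vs))
      prod-unit []       _        m P h = Ord-resp (BR.*-identityˡ P) h
      prod-unit (v ∷ vs) (u ∷ us) m P h = prod-unit vs us m P (u m (prod (map E vs) ⊠ P) (Ord-resp (B.⊛-assoc (E v) (prod (map E vs)) P) h))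

      -- At most one factor vanishes at the point: once it is met, all others are units, so the
      -- whole product costs a single order.
      prod-div : (∀ v → Unit (E v) ⊎ (Div (E v) × ∀ v′ → v ≢ v′ → Unit (E v′))) → ∀ {vs} → Unique vs → Div (prod (map E vs))
      prod-div hyp {[]}     _       m P h = Ord-≤ (ℕ.n≤1+n m) (Ord-resp (BR.*-identityˡ P) h)
      prod-div hyp {v ∷ vs} (a ∷ u) m P h = go (hyp v)
        where
        h′ : Ord x y (suc m) (E v ⊠ (prod (map E vs) ⊠ P))
        h′ = Ord-resp (B.⊛-assoc (E v) (prod (map E vs)) P) h
        go : Unit (E v) ⊎ (Div (E v) × ∀ v′ → v ≢ v′ → Unit (E v′)) → Ord x y m P
        go (inj₁ uv)         = prod-div hyp u m P (uv (suc m) _ h′)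
        go (inj₂ (dv , us)) = prod-unit vs (All.map (λ {v′} → us v′) a) m P (dv m _ h′)

-- Vanishing on a grid and the expansion it forces

module Expansion (𝔽 : FiniteField) where
  open FiniteField 𝔽
  open Univariate 𝔽
  open Bivariate 𝔽
  open Rédei 𝔽
  open Order 𝔽
  open Polynomial K
  open B using () renaming (_⊕_ to _⊞_; _⊛_ to _⊠_; ⊖_ to ⊟_; _≋_ to _≣_; 𝟘 to 𝟎)

  map-eval-const : ∀ y L → map (eval y) (map const L) ≡ L
  map-eval-const y []      = ≡.refl
  map-eval-const y (z ∷ L) = ≡.cong₂ _∷_ (eval-const y z) (map-eval-const y L)

  Zᴮ : ℕ → B.Poly
  Zᴮ k = B.Π (map const (copies k))

  σ-Zᴮ : ∀ y k → σ y (Zᴮ k) ≋ Zp k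
  σ-Zᴮ y k = ≡.subst (λ L → σ y (Zᴮ k) ≋ Π L) (map-eval-const y (copies k)) (σ-Π y (map const (copies k)))

  Ord-Zᴮ : ∀ x y k → Ord x y k (Zᴮ k)
  Ord-Zᴮ x y k = ≡.subst (λ c → Ord x y c (Zᴮ k)) (≡.trans (≡.cong (count x) (map-eval-const y (copies k))) (count-copies x k))
    (Ord-Π (map const (copies k)))

  Bnd-2-const : ∀ L → All (Bnd 2) (map const L)
  Bnd-2-const L = All.map⁺ (All.tabulate λ {z} _ → Bnd-≤ (s≤s z≤n) (Bnd-const z))

  length-Zᴮ : ∀ k → length (map const (copies k)) ≡ k ℕ.* p
  length-Zᴮ k = ≡.trans (List.length-map const (copies k)) (length-copies k)

  const-zero : ∀ {k} g → k ≢ 0# → const k ⊛ g ≋ 𝟘 → g ≋ 𝟘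
  const-zero {k} g k≢0 e = mk λ i → ≡.trans (*-cancelˡ-0 k≢0 (≡.trans (≡.sym (coeff-const-⊛ k g i)) (≡.trans (at e i) (coeff-𝟘 i)))) (≡.sym (coeff-𝟘 i))

  W : List F → B.Poly
  W Y = prod (map T Y)

  -- At any other element of the list the factor Y - y takes a nonzero value, so the quotient by it
  -- still vanishes there.
  W-factor : ∀ {m Y} → Unique Y → ∀ C → TB (length Y ℕ.+ m) C → (∀ y → y ∈ Y → σ y C ≋ 𝟘) → ∃ λ Q → C ≣ W Y ⊠ Q × TB m Q
  W-factor {m} {[]}    _       C h v = C , B.≋-sym (BR.*-identityˡ C) , h
  W-factor {m} {y ∷ Y} (a ∷ u) C h v = step (W-factor {m} {Y} u C₁ (TB-T-inv C₁ (TB-resp C≣ h)) v₁)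
    where
    C₁ : B.Poly
    C₁ = map (quot y) C
    C≣ : C ≣ T y ⊠ C₁
    C≣ = σ𝟘⇒T-factor y C (v y (here ≡.refl))
    v₁ : ∀ z → z ∈ Y → σ z C₁ ≋ 𝟘
    v₁ z z∈Y = const-zero (σ z C₁) (λ e → All.lookup a z∈Y (≡.sym (x-y≡0⇒x≡y e)))
      (≋-trans (⊛-cong (≋-sym (σ-T z y)) ≋-refl) (≋-trans (≋-sym (σ-⊠ z (T y) C₁)) (≋-trans (σ-cong z (B.≋-sym C≣)) (v z (there z∈Y)))))
    step : (∃ λ Q → C₁ ≣ W Y ⊠ Q × TB m Q) → ∃ λ Q → C ≣ W (y ∷ Y) ⊠ Q × TB m Q
    step (Q , e , hQ) = Q , B.≋-trans C≣ (B.≋-trans (B.⊛-cong B.≋-refl e) (B.≋-sym (B.⊛-assoc (T y) (W Y) Q))) , hQ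

  W-div : ∀ {x y Y} → Unique Y → Div {x} {y} (W Y)
  W-div {x} {y} u = prod-div T hyp u
    where
    hyp : ∀ v → Unit (T v) ⊎ (Div (T v) × ∀ v′ → v ≢ v′ → Unit (T v′))
    hyp v with y ≟ v
    ... | yes ≡.refl = inj₂ (T-div , T-unit)
    ... | no ne      = inj₁ (T-unit v ne)

  -- On a line Y = y the polynomial `W Y` becomes a constant, so it does not raise the degree in X.
  Bnd-σ-W : ∀ {m} y Y g → Bnd m g → Bnd m (σ y (W Y) ⊛ g)
  Bnd-σ-W y []      g h = Bnd-resp (≋-sym (≋-trans (⊛-cong (≋-trans (σ-const y (const 1#)) (const-cong (eval-const y 1#))) ≋-refl) (P.*-identityˡ g))) h
  Bnd-σ-W {m} y (z ∷ Y) g h = Bnd-resp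
    (≋-sym (≋-trans (⊛-cong (≋-trans (σ-⊠ y (T z) (W Y)) (⊛-cong (σ-T y z) ≋-refl)) ≋-refl) (≋-trans (⊛-assoc (const (y + - z)) (σ y (W Y)) g) (const-⊛ (y + - z) (σ y (W Y) ⊛ g)))))
    (Bnd-scale (y + - z) (Bnd-σ-W y Y g h))

  Σ<-⊛ : ∀ c f m → c ⊛ Σ< f m ≋ Σ< (λ i → c ⊛ f i) m
  Σ<-⊛ c f zero    = P.zeroʳ c
  Σ<-⊛ c f (suc m) = ≋-trans (⊛-distribˡ c (Σ< f m) (f m)) (⊕-cong (Σ<-⊛ c f m) ≋-refl)

  module Grid (Y : List F) (uY : Unique Y) (D : ℕ) (N+D≡p : length Y ℕ.+ D ≡ p) where

    -- Division by Zᵏ leaves a remainder C of degree below kp in X. For y ∈ Y it has a zero of order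
    -- k at every (x, y), so it vanishes on the line Y = y; hence C = W V. Removing W lowers the
    -- total degree by N = p - D and the order by at most one, so V satisfies the hypotheses for k -
    -- 1 and j + 1. Thus j counts the powers of Z given up so far, each paid for with D.
    expand : ∀ k j Q → TB (suc (k ℕ.* p ℕ.+ j ℕ.* D)) Q → (∀ x y → y ∈ Y → Ord x y k Q) → ∀ z →
      ∃ λ d → σ z Q ≋ S d (suc k) × (∀ i → i ≤ k → Bnd (suc ((j ℕ.+ (k ∸ i)) ℕ.* D)) (d i))
    expand zero j Q h o z = (λ _ → σ z Q) ,
      ≋-sym (≋-trans (⊕-identityˡ _) (P.*-identityˡ (σ z Q))) ,
      λ { zero _ → ≡.subst (λ l → Bnd (suc (l ℕ.* D)) (σ z Q)) (≡.sym (ℕ.+-identityʳ j)) (TB-σ z h) }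
    expand (suc k) j Q h o z = step₁ (divΠ {suc (j ℕ.* D)} zs (Bnd-2-const (copies (suc k))) Q (≡.subst (λ l → TB l Q) len h))
      where
      zs : List Poly
      zs = map const (copies (suc k))
      len : suc (suc k ℕ.* p ℕ.+ j ℕ.* D) ≡ length zs ℕ.+ suc (j ℕ.* D)
      len = ≡.trans (≡.sym (ℕ.+-suc (suc k ℕ.* p) (j ℕ.* D))) (≡.cong (ℕ._+ suc (j ℕ.* D)) (≡.sym (length-Zᴮ (suc k))))
      Result : Set
      Result = ∃ λ d → σ z Q ≋ S d (suc (suc k)) × (∀ i → i ≤ suc k → Bnd (suc ((j ℕ.+ (suc k ∸ i)) ℕ.* D)) (d i))

      step₂ : ∀ A C V → Q ≣ Zᴮ (suc k) ⊠ A ⊞ C → C ≣ W Y ⊠ V → TB (suc (j ℕ.* D)) A →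
        (∃ λ d → σ z V ≋ S d (suc k) × (∀ i → i ≤ k → Bnd (suc ((suc j ℕ.+ (k ∸ i)) ℕ.* D)) (d i))) → Result
      step₂ A C V eQ eC hA (d , e , bd) = d′ , eq , bd′
        where
        -- The top digit is the quotient; the lower ones are those of V, multiplied by the constant
        -- W(z).
        d′ : ℕ → Poly
        d′ i with i ℕ.≟ suc k
        ... | yes _ = σ z A
        ... | no  _ = σ z (W Y) ⊛ d i
        d′-top : d′ (suc k) ≡ σ z A
        d′-top with suc k ℕ.≟ suc k
        ... | yes _ = ≡.refl
        ... | no ne = contradiction ≡.refl ne
        d′-low : ∀ i → i ≤ k → d′ i ≡ σ z (W Y) ⊛ d i
        d′-low i i≤k with i ℕ.≟ suc k
        ... | yes ≡.refl = contradiction i≤k (ℕ.<⇒≱ (ℕ.n<1+n k))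
        ... | no _ = ≡.refl
        low : σ z C ≋ S d′ (suc k)
        low = ≋-trans (σ-cong z eC) (≋-trans (σ-⊠ z (W Y) V) (≋-trans (⊛-cong ≋-refl e) (≋-trans (Σ<-⊛ (σ z (W Y)) _ (suc k))
          (Σ<-cong (suc k) λ i i<1+k → ≋-trans
            (PS.solve 3 (λ a b c → a PS.:* (b PS.:* c) PS.:= b PS.:* (a PS.:* c)) ≋-refl (σ z (W Y)) (Zp i) (d i))
            (≡.subst (λ g → Zp i ⊛ (σ z (W Y) ⊛ d i) ≋ Zp i ⊛ g) (≡.sym (d′-low i (ℕ.≤-pred i<1+k))) ≋-refl)))))
        eq : σ z Q ≋ S d′ (suc (suc k))
        eq = begin
          σ z Q                                ≈⟨ ≋-trans (σ-cong z eQ) (σ-⊞ z (Zᴮ (suc k) ⊠ A) C) ⟩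
          σ z (Zᴮ (suc k) ⊠ A) ⊕ σ z C         ≈⟨ ⊕-cong (≋-trans (σ-⊠ z (Zᴮ (suc k)) A) (⊛-cong (σ-Zᴮ z (suc k)) ≋-refl)) low ⟩
          Zp (suc k) ⊛ σ z A ⊕ S d′ (suc k)    ≈⟨ ⊕-comm _ _ ⟩
          S d′ (suc k) ⊕ Zp (suc k) ⊛ σ z A    ≡⟨ ≡.cong (λ g → S d′ (suc k) ⊕ Zp (suc k) ⊛ g) d′-top ⟨
          S d′ (suc (suc k))                   ∎
          where open ≋R
        bd′ : ∀ i → i ≤ suc k → Bnd (suc ((j ℕ.+ (suc k ∸ i)) ℕ.* D)) (d′ i)
        bd′ i i≤1+k = go (ℕ.m≤n⇒m<n∨m≡n i≤1+k)
          where
          go : i < suc k ⊎ i ≡ suc k → Bnd (suc ((j ℕ.+ (suc k ∸ i)) ℕ.* D)) (d′ i)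
          go (inj₁ (s≤s i≤k)) = ≡.subst₂ (λ l g → Bnd (suc (l ℕ.* D)) g)
            (≡.trans (≡.sym (ℕ.+-suc j (k ∸ i))) (≡.cong (j ℕ.+_) (≡.sym (ℕ.+-∸-assoc 1 i≤k)))) (≡.sym (d′-low i i≤k))
            (Bnd-σ-W z Y (d i) (bd i i≤k))
          go (inj₂ ≡.refl) = ≡.subst₂ (λ l g → Bnd (suc (l ℕ.* D)) g)
            (≡.sym (≡.trans (≡.cong (j ℕ.+_) (ℕ.n∸n≡0 k)) (ℕ.+-identityʳ j))) (≡.sym d′-top) (TB-σ z hA)

      step₁ : (∃₂ λ A C → Q ≣ Zᴮ (suc k) ⊠ A ⊞ C × TB (suc (j ℕ.* D)) A × TB (length zs ℕ.+ suc (j ℕ.* D)) C × B.Bnd (length zs) C) → Result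
      step₁ (A , C , eQ , hA , hC , bC) = finish (W-factor {suc (k ℕ.* p ℕ.+ suc j ℕ.* D)} uY C (≡.subst (λ l → TB l C) len₂ hC) σC)
        where
        len₂ : length zs ℕ.+ suc (j ℕ.* D) ≡ length Y ℕ.+ suc (k ℕ.* p ℕ.+ suc j ℕ.* D)
        len₂ = ≡.trans (≡.sym len) (≡.trans (≡.cong (λ q → suc (q ℕ.+ k ℕ.* p ℕ.+ j ℕ.* D)) (≡.sym N+D≡p)) (rearr (length Y) D (k ℕ.* p) (j ℕ.* D)))
          where
          rearr : ∀ N D a b → suc (N ℕ.+ D ℕ.+ a ℕ.+ b) ≡ N ℕ.+ suc (a ℕ.+ (D ℕ.+ b))
          rearr = solve-∀
        C≣ : C ≣ Q ⊞ ⊟ (Zᴮ (suc k) ⊠ A)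
        C≣ = B.≋-sym (B.≋-trans (B.⊕-cong eQ B.≋-refl) (BS.solve 2 (λ z c → (z BS.:+ c) BS.:+ BS.:- z BS.:= c) B.≋-refl (Zᴮ (suc k) ⊠ A) C))
        OrdC : ∀ x y → y ∈ Y → Ord x y (suc k) C
        OrdC x y y∈Y = Ord-resp (B.≋-sym C≣) (Ord-⊞ (o x y y∈Y) (Ord-⊟ (Ord-resp (B.⊛-comm A (Zᴮ (suc k))) (Ord-⊠ A (Ord-Zᴮ x y (suc k))))))
        σC : ∀ y → y ∈ Y → σ y C ≋ 𝟘
        σC y y∈Y = many-roots⇒𝟘 (copies (suc k)) (λ x → ≡.subst (λ c → Mult x c (σ y C)) (≡.sym (count-copies x (suc k))) (Ord⇒Mult-σ (OrdC x y y∈Y)))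
          (≡.subst (λ l → Bnd l (σ y C)) (List.length-map const (copies (suc k))) (Bnd-σ y bC))
        finish : (∃ λ V → C ≣ W Y ⊠ V × TB (suc (k ℕ.* p ℕ.+ suc j ℕ.* D)) V) → Result
        finish (V , eC , hV) = step₂ A C V eQ eC hA (expand k (suc j) V hV (λ x y y∈Y → W-div uY k V (Ord-resp eC (OrdC x y y∈Y))) z)

-- Points, lines and their dual linear factors

module Geometry (𝔽 : FiniteField) where
  open FiniteField 𝔽
  open Univariate 𝔽
  open Bivariate 𝔽
  open Rédei 𝔽
  open Order 𝔽
  open Expansion 𝔽
  open Polynomial K
  open B using () renaming (_⊕_ to _⊞_; _⊛_ to _⊠_; ⊖_ to ⊟_; _≋_ to _≣_; 𝟘 to 𝟎)

  Pt : Set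
  Pt = F × F

  val : F → Pt → F
  val y (u , v) = v + - u * y

  -- The point (u , v) is dual to the linear factor X - (v - u Y).
  aff : Pt → Poly
  aff (u , v) = const v ⊕ scale (- u) (shift (const 1#))

  eval-aff : ∀ y Q → eval y (aff Q) ≡ val y Q
  eval-aff y (u , v) = ≡.trans (eval-⊕ y (const v) _) (≡.cong₂ _+_ (eval-const y v)
    (≡.trans (eval-scale y (- u) _) (≡.cong (- u *_) (≡.trans (eval-shift y _) (≡.trans (≡.cong (y *_) (eval-const y 1#)) (KR.*-identityʳ y))))))

  Bnd-aff : ∀ Q → Bnd 2 (aff Q)
  Bnd-aff (u , v) = Bnd-⊕ (Bnd-≤ (s≤s z≤n) (Bnd-const v)) (Bnd-scale (- u) (Bnd-shift (Bnd-const 1#)))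

  aff-injective : ∀ {Q Q′} → aff Q ≋ aff Q′ → Q ≡ Q′
  aff-injective {u , v} {u′ , v′} e = ≡.cong₂ _,_ u≡u′ v≡v′
    where
    at-0 : ∀ u v → val 0# (u , v) ≡ v
    at-0 u v = ≡.trans (≡.cong (v +_) (KR.zeroʳ (- u))) (KR.+-identityʳ v)
    at-1 : ∀ u v → u ≡ v + - val 1# (u , v)
    at-1 u v = ≡.sym (≡.trans (≡.cong (λ z → v + - (v + z)) (KR.*-identityʳ (- u)))
                 (KS.solve 2 (λ u v → v KS.:+ KS.:- (v KS.:+ KS.:- u) KS.:= u) ≡.refl u v))
    vals : ∀ y → val y (u , v) ≡ val y (u′ , v′)
    vals y = ≡.trans (≡.sym (eval-aff y (u , v))) (≡.trans (eval-cong y e) (eval-aff y (u′ , v′)))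
    v≡v′ : v ≡ v′
    v≡v′ = ≡.trans (≡.sym (at-0 u v)) (≡.trans (vals 0#) (at-0 u′ v′))
    u≡u′ : u ≡ u′
    u≡u′ = ≡.trans (at-1 u v) (≡.trans (≡.cong₂ (λ a b → a + - b) v≡v′ (vals 1#)) (≡.sym (at-1 u′ v′)))

  -- Lines in chart coordinates: `sloped y x` consists of the points whose dual line X = v - uY
  -- passes through (x, y).
  data CLine : Set where
    vertical : F → CLine
    sloped   : F → F → CLine

  On : CLine → Pt → Set
  On (vertical c) (u , v) = u ≡ c
  On (sloped y x) Q       = val y Q ≡ x

  on? : ∀ ℓ Q → Dec (On ℓ Q)
  on? (vertical c) (u , v) = u ≟ c
  on? (sloped y x) Q       = val y Q ≟ x

  pt : CLine → F → Pt
  pt (vertical c) t = c , t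
  pt (sloped y x) t = t , x + t * y

  par : CLine → Pt → F
  par (vertical c) (u , v) = v
  par (sloped y x) (u , v) = u

  On-pt : ∀ ℓ t → On ℓ (pt ℓ t)
  On-pt (vertical c) t = ≡.refl
  On-pt (sloped y x) t = KS.solve 3 (λ x t y → (x KS.:+ t KS.:* y) KS.:+ (KS.:- t) KS.:* y KS.:= x) ≡.refl x t y

  par-pt : ∀ ℓ t → par ℓ (pt ℓ t) ≡ t
  par-pt (vertical c) t = ≡.refl
  par-pt (sloped y x) t = ≡.refl

  par-injective : ∀ ℓ {Q Q′} → On ℓ Q → On ℓ Q′ → par ℓ Q ≡ par ℓ Q′ → Q ≡ Q′
  par-injective (vertical c) h h′ e = ≡.cong₂ _,_ (≡.trans h (≡.sym h′)) e
  par-injective (sloped y x) {u , v} {.u , v′} h h′ ≡.refl = ≡.cong (u ,_)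
    (≡.trans (recover v) (≡.trans (≡.cong (_+ u * y) (≡.trans h (≡.sym h′))) (≡.sym (recover v′))))
    where
    recover : ∀ v → v ≡ val y (u , v) + u * y
    recover v = KS.solve 3 (λ v u y → v KS.:= (v KS.:+ (KS.:- u) KS.:* y) KS.:+ u KS.:* y) ≡.refl v u y

  countOn : CLine → List Pt → ℕ
  countOn ℓ U = length (filter (on? ℓ) U)

  countOn-here : ∀ ℓ {Q} U → On ℓ Q → countOn ℓ (Q ∷ U) ≡ suc (countOn ℓ U)
  countOn-here ℓ U o = ≡.cong length (List.filter-accept (on? ℓ) o)

  countOn-mono : ∀ ℓ Q U → countOn ℓ U ≤ countOn ℓ (Q ∷ U)
  countOn-mono ℓ Q U with on? ℓ Q
  ... | yes _ = ℕ.n≤1+n _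
  ... | no _  = ℕ.≤-refl

  -- The link between algebra and geometry: the multiplicity of x as a root of R(X,y) is the number
  -- of points on a line of slope y.
  count≡countOn : ∀ y x U → count x (map (val y) U) ≡ countOn (sloped y x) U
  count≡countOn y x []      = ≡.refl
  count≡countOn y x (Q ∷ U) with x ≟ val y Q | val y Q ≟ x
  ... | yes _ | yes _  = ≡.cong suc (count≡countOn y x U)
  ... | no _  | no _   = count≡countOn y x U
  ... | yes e | no ne  = contradiction (≡.sym e) ne
  ... | no ne | yes e  = contradiction (≡.sym e) ne

  map-eval-aff : ∀ y U → map (eval y) (map aff U) ≡ map (val y) U
  map-eval-aff y []      = ≡.refl
  map-eval-aff y (Q ∷ U) = ≡.cong₂ _∷_ (eval-aff y Q) (map-eval-aff y U)

  sum-mono : ∀ {f g : F → ℕ} xs → (∀ x → f x ≤ g x) → sum (map f xs) ≤ sum (map g xs)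
  sum-mono []       h = z≤n
  sum-mono (x ∷ xs) h = ℕ.+-mono-≤ (h x) (sum-mono xs h)

  unique⇒length≤p : ∀ {L} → Unique L → length L ≤ p
  unique⇒length≤p {L} u = ≡.subst₂ _≤_ (sum-count L) (sum-1 els) (sum-mono els λ x → count-≤1 x u)
    where
    sum-1 : ∀ (xs : List F) → sum (map (λ _ → 1) xs) ≡ length xs
    sum-1 []       = ≡.refl
    sum-1 (_ ∷ xs) = ≡.cong suc (sum-1 xs)

  countOn≤p : ∀ ℓ {U} → Unique U → countOn ℓ U ≤ p
  countOn≤p ℓ {U} u = ≡.subst (_≤ p) (List.length-map (par ℓ) (filter (on? ℓ) U))
    (unique⇒length≤p (unique-map (filter⁺ (on? ℓ) u) (all-filter (on? ℓ) U)))
    where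
    All-map : ∀ {Q L} → On ℓ Q → All (Q ≢_) L → All (On ℓ) L → All (par ℓ Q ≢_) (map (par ℓ) L)
    All-map o []       []       = []
    All-map o (ne ∷ a) (h ∷ hs) = (λ e → ne (par-injective ℓ o h e)) ∷ All-map o a hs
    unique-map : ∀ {L} → Unique L → All (On ℓ) L → Unique (map (par ℓ) L)
    unique-map []      []       = []
    unique-map (a ∷ u) (h ∷ hs) = All-map h a hs ∷ unique-map u hs

  module _ {A : Set} where
    length-partition : ∀ {Q : A → Set} (Q? : ∀ x → Dec (Q x)) xs → length xs ≡ length (filter Q? xs) ℕ.+ length (filter (¬? ∘ Q?) xs)
    length-partition Q? []       = ≡.refl
    length-partition Q? (x ∷ xs) with Q? x
    ... | yes _ = ≡.cong suc (length-partition Q? xs)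
    ... | no _  = ≡.trans (≡.cong suc (length-partition Q? xs)) (≡.sym (ℕ.+-suc _ _))

  R : List Pt → B.Poly
  R U = B.Π (map aff U)

  Bnd-2-aff : ∀ U → All (Bnd 2) (map aff U)
  Bnd-2-aff U = All.map⁺ (All.tabulate λ {Q} _ → Bnd-aff Q)

  R-partition : ∀ {A : Pt → Set} (A? : ∀ x → Dec (A x)) U → R U ≣ R (filter A? U) ⊠ R (filter (¬? ∘ A?) U)
  R-partition A? []      = B.≋-sym (BR.*-identityˡ _)
  R-partition A? (Q ∷ U) with A? Q
  ... | yes _ = B.≋-trans (B.⊛-cong B.≋-refl (R-partition A? U)) (B.≋-sym (B.⊛-assoc (B.lin (aff Q)) _ _))
  ... | no _  = B.≋-trans (B.⊛-cong B.≋-refl (R-partition A? U))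
    (BS.solve 3 (λ l a b → l BS.:* (a BS.:* b) BS.:= a BS.:* (l BS.:* b)) B.≋-refl (B.lin (aff Q)) (R (filter A? U)) (R (filter (¬? ∘ A?) U)))

  Ord-R : ∀ x y U → Ord x y (count x (map (val y) U)) (R U)
  Ord-R x y U = ≡.subst (λ L → Ord x y (count x L) (R U)) (map-eval-aff y U) (Ord-Π (map aff U))

  σ-R : ∀ y U → σ y (R U) ≋ Π (map (val y) U)
  σ-R y U = ≡.subst (λ L → σ y (R U) ≋ Π L) (map-eval-aff y U) (σ-Π y (map aff U))

  aff-≢ : ∀ {Q Q′} → Q ≢ Q′ → ¬ (aff Q ⊕ ⊖ aff Q′ ≋ 𝟘)
  aff-≢ ne e = ne (aff-injective (⊖⇒≋ e))

  -- Distinct points have distinct dual lines, and the polynomials in Y form an integral domain; so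
  -- the factor of Q′ cannot be what vanishes on the dual line of Q.
  eval-lin-cancel : ∀ {Q Q′} g → Q ≢ Q′ → B.eval (aff Q) (B.lin (aff Q′) ⊠ g) ≋ 𝟘 → B.eval (aff Q) g ≋ 𝟘
  eval-lin-cancel {Q} {Q′} g ne e = domain (B.eval (aff Q) g) (aff-≢ ne)
    (≋-trans (⊛-comm _ _) (≋-trans (≋-sym (B.eval-lin-⊛ (aff Q) (aff Q′) g)) e))

  eval-R-cancel : ∀ Q U g → All (Q ≢_) U → B.eval (aff Q) (R U ⊠ g) ≋ 𝟘 → B.eval (aff Q) g ≋ 𝟘
  eval-R-cancel Q []       g _        e = ≋-trans (B.eval-cong (aff Q) (B.≋-sym (BR.*-identityˡ g))) e
  eval-R-cancel Q (Q′ ∷ U) g (ne ∷ a) e = eval-R-cancel Q U g a (eval-lin-cancel (R U ⊠ g) ne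
    (≋-trans (B.eval-cong (aff Q) (B.≋-sym (B.⊛-assoc (B.lin (aff Q′)) (R U) g))) e))

  R-divides : ∀ {U} → Unique U → ∀ h → (∀ Q → Q ∈ U → B.eval (aff Q) h ≋ 𝟘) → ∃ λ h′ → h ≣ R U ⊠ h′
  R-divides {[]}    _       h v = h , B.≋-sym (BR.*-identityˡ h)
  R-divides {Q ∷ U} (a ∷ u) h v = step (R-divides u h₁ λ Q′ i → eval-lin-cancel h₁ (λ e → All.lookup a i (≡.sym e))
      (≋-trans (B.eval-cong (aff Q′) (B.≋-sym h≣)) (v Q′ (there i))))
    where
    h₁ : B.Poly
    h₁ = B.quot (aff Q) h
    h≣ : h ≣ B.lin (aff Q) ⊠ h₁
    h≣ = B.root⇒factor (aff Q) h (v Q (here ≡.refl))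
    step : (∃ λ h′ → h₁ ≣ R U ⊠ h′) → ∃ λ h′ → h ≣ R (Q ∷ U) ⊠ h′
    step (h′ , e) = h′ , B.≋-trans h≣ (B.≋-trans (B.⊛-cong B.≋-refl e) (B.≋-sym (B.⊛-assoc (B.lin (aff Q)) (R U) h′)))

  slope-through : ∀ {u v u₀ v₀} → u ≢ u₀ → ∃ λ y → val y (u , v) ≡ val y (u₀ , v₀)
  slope-through {u} {v} {u₀} {v₀} ne = go (inverse (u + - u₀) λ e → ne (x-y≡0⇒x≡y e))
    where
    go : (∃ λ w → (u + - u₀) * w ≡ 1#) → ∃ λ y → val y (u , v) ≡ val y (u₀ , v₀)
    go (w , e) = w * (v + - v₀) , x-y≡0⇒x≡y (≡.trans
      (KS.solve 5 (λ u v u₀ v₀ w → (v KS.:+ (KS.:- u) KS.:* (w KS.:* (v KS.:+ KS.:- v₀))) KS.:+ KS.:- (v₀ KS.:+ (KS.:- u₀) KS.:* (w KS.:* (v KS.:+ KS.:- v₀)))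
         KS.:= (v KS.:+ KS.:- v₀) KS.:+ KS.:- (((u KS.:+ KS.:- u₀) KS.:* w) KS.:* (v KS.:+ KS.:- v₀))) ≡.refl u v u₀ v₀ w)
      (≡.trans (≡.cong (λ z → (v + - v₀) + - (z * (v + - v₀))) e)
        (≡.trans (≡.cong (λ z → (v + - v₀) + - z) (KR.*-identityˡ _)) (KR.-‿inverseʳ _))))

  sum-mono-< : ∀ {f g : F → ℕ} {xs z} → (∀ x → f x ≤ g x) → z ∈ xs → f z < g z → sum (map f xs) < sum (map g xs)
  sum-mono-< {xs = _ ∷ xs} h (here ≡.refl) lt = ℕ.+-mono-<-≤ lt (sum-mono xs h)
  sum-mono-< {xs = x ∷ _}  h (there i)     lt = ℕ.+-mono-≤-< (h x) (sum-mono-< h i lt)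

  -- Every point other than Q₀ lies on a line through Q₀.
  pencil-bound : ∀ Q₀ U → All (Q₀ ≢_) U →
    length U ≤ countOn (vertical (proj₁ Q₀)) U ℕ.+ sum (map (λ y → countOn (sloped y (val y Q₀)) U) els)
  pencil-bound Q₀ []      []       = z≤n
  pencil-bound Q₀ (Q ∷ U) (ne ∷ a) with proj₁ Q ≟ proj₁ Q₀
  ... | yes e = s≤s (ℕ.≤-trans (pencil-bound Q₀ U a) (ℕ.+-monoʳ-≤ _ (sum-mono els λ y → countOn-mono (sloped y (val y Q₀)) Q U)))
  ... | no u≢u₀ = ℕ.≤-trans (s≤s (pencil-bound Q₀ U a)) (ℕ.≤-trans (ℕ.≤-reflexive (≡.sym (ℕ.+-suc _ _)))
      (ℕ.+-monoʳ-≤ _ (sum-mono-< (λ y → countOn-mono (sloped y (val y Q₀)) Q U) (∈-els (proj₁ through)) strict)))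
    where
    through : ∃ λ y → val y Q ≡ val y Q₀
    through = slope-through u≢u₀
    strict : countOn (sloped (proj₁ through) (val (proj₁ through) Q₀)) U < countOn (sloped (proj₁ through) (val (proj₁ through) Q₀)) (Q ∷ U)
    strict = ℕ.≤-reflexive (≡.sym (countOn-here (sloped (proj₁ through) (val (proj₁ through) Q₀)) {Q} U (proj₂ through)))

  eval-σ : ∀ y s Q → eval y (B.eval s Q) ≡ eval (eval y s) (σ y Q)
  eval-σ y s []      = ≡.trans (eval-zero y (B.eval-nil s)) (≡.sym (≡.trans (≡.cong (eval (eval y s)) (σ-nil y)) (eval-nil (eval y s))))
  eval-σ y s (a ∷ Q) = ≡.trans (eval-cong y (B.eval-cons s a Q)) (≡.trans (eval-⊕ y a (s ⊛ B.eval s Q))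
    (≡.trans (≡.cong (eval y a +_) (≡.trans (eval-⊛ y s (B.eval s Q)) (≡.cong (eval y s *_) (eval-σ y s Q))))
      (≡.sym (≡.trans (≡.cong (eval (eval y s)) (σ-cons y a Q)) (eval-cons (eval y s) (eval y a) (σ y Q))))))

  root⇒Ord : ∀ x y Q → eval x (σ y Q) ≡ 0# → Ord x y 1 Q
  root⇒Ord x y Q e = os (B.quot (const x) Q) (B.const (quot y c))
    (B.≋-trans (B.quot-spec (const x) Q) (B.⊕-cong B.≋-refl (B.≋-trans (B.const-cong (root⇒factor y c c-root)) (B.const-* (lin y) (quot y c))))) oz oz
    where
    c : Poly
    c = B.eval (const x) Q
    c-root : eval y c ≡ 0#
    c-root = ≡.trans (eval-σ y (const x) Q) (≡.trans (≡.cong (λ z → eval z (σ y Q)) (eval-const y x)) e)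

-- Completions, removal of lines and the covering

module Covering (𝔽 : FiniteField) where
  open FiniteField 𝔽
  open Univariate 𝔽
  open Bivariate 𝔽
  open Rédei 𝔽
  open Order 𝔽
  open Expansion 𝔽
  open Geometry 𝔽
  open Polynomial K
  open B using () renaming (_⊕_ to _⊞_; _⊛_ to _⊠_; ⊖_ to ⊟_; _≋_ to _≣_; 𝟘 to 𝟎)

  Covered : ℕ → List Pt → Set
  Covered n U = ∃ λ ls → length ls ≡ n × (∀ Q → Q ∈ U → Any (λ ℓ → On ℓ Q) ls)

  module _ (Y : List F) (uY : Unique Y) (D : ℕ) (N+D≡p : length Y ℕ.+ D ≡ p) where
    open Grid Y uY D N+D≡p

    _∈Y? : ∀ y → Dec (y ∈ Y)
    y ∈Y? = any? (y ≟_) Y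

    -- Only lines whose direction is not an element of Y are removed; the vertical direction never
    -- is one.
    OffGrid : CLine → Set
    OffGrid (vertical c) = ⊤
    OffGrid (sloped y x) = y ∉ Y

    -- P is the Rédei polynomial R U of U, completed by a cofactor f to total degree n p,
    -- such that it vanishes to order n at all points over Y.
    record Completion (n : ℕ) (U : List Pt) : Set where
      field
        P f   : B.Poly
        P≣    : P ≣ R U ⊠ f
        deg   : TB (suc (n ℕ.* p)) P
        monic : ∀ y → coeff (σ y P) (n ℕ.* p) ≡ 1#
        order : ∀ x y → y ∈ Y → Ord x y n P

    -- The zeros counted on the dual line of a point of ℓ: order n over each of the N slopes in Y
    -- and, for a sloped ℓ, order e where the dual lines of the points of ℓ meet. The inequality
    -- lets them outnumber the degree np.
    module Vanishing {n U} (comp : Completion n U) (e : ℕ) (np<nN+e : suc (n ℕ.* p) ≤ n ℕ.* length Y ℕ.+ e) where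
      open Completion comp

      Mult-Y : ∀ s x → Mult x (n ℕ.* count x Y) (B.eval s P)
      Mult-Y s x = go (x ∈Y?)
        where
        go : Dec (x ∈ Y) → Mult x (n ℕ.* count x Y) (B.eval s P)
        go (yes x∈Y) = ≡.subst (λ k → Mult x k (B.eval s P)) (≡.sym (≡.trans (≡.cong (n ℕ.*_) (count-unique uY x∈Y)) (ℕ.*-identityʳ n)))
                         (Ord⇒Mult-eval s ≡.refl (order (eval x s) x x∈Y))
        go (no x∉Y)  = ≡.subst (λ k → Mult x k (B.eval s P)) (≡.sym (≡.trans (≡.cong (n ℕ.*_) (count-∉ x Y x∉Y)) (ℕ.*-zeroʳ n))) mz

      vanish-sloped : ∀ y x → y ∉ Y → countOn (sloped y x) U ≡ e → ∀ Q → On (sloped y x) Q → B.eval (aff Q) P ≋ 𝟘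
      vanish-sloped y x y∉Y ce Q o = many-roots⇒𝟘 (rep n Y ++ rep e (y ∷ [])) mults
          (Bnd-≤ (ℕ.≤-trans np<nN+e (ℕ.≤-reflexive (≡.sym len))) (TB-eval P (Bnd-aff Q) deg))
        where
        g : Poly
        g = B.eval (aff Q) P
        len : length (rep n Y ++ rep e (y ∷ [])) ≡ n ℕ.* length Y ℕ.+ e
        len = ≡.trans (List.length-++ (rep n Y)) (≡.cong₂ ℕ._+_ (length-rep n Y) (≡.trans (length-rep e (y ∷ [])) (ℕ.*-identityʳ e)))
        mult : ∀ z → Dec (z ≡ y) → Mult z (n ℕ.* count z Y ℕ.+ e ℕ.* count z (y ∷ [])) g
        mult z (no ne) = ≡.subst (λ k → Mult z k g)
          (≡.sym (≡.trans (≡.cong (n ℕ.* count z Y ℕ.+_) (≡.trans (≡.cong (e ℕ.*_) (count-there [] ne)) (ℕ.*-zeroʳ e))) (ℕ.+-identityʳ _)))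
          (Mult-Y (aff Q) z)
        mult z (yes ≡.refl) = ≡.subst (λ k → Mult z k g)
          (≡.sym (≡.cong₂ ℕ._+_ (≡.trans (≡.cong (n ℕ.*_) (count-∉ z Y y∉Y)) (ℕ.*-zeroʳ n))
                                (≡.trans (≡.cong (e ℕ.*_) (count-here z [])) (ℕ.*-identityʳ e))))
          (Ord⇒Mult-eval (aff Q) (≡.trans (eval-aff z Q) o) (Ord-resp (B.≋-trans (B.⊛-comm f (R U)) (B.≋-sym P≣))
            (Ord-⊠ f (≡.subst (λ k → Ord x z k (R U)) (≡.trans (count≡countOn z x U) ce) (Ord-R x z U)))))
        mults : ∀ z → Mult z (count z (rep n Y ++ rep e (y ∷ []))) g
        mults z = ≡.subst (λ k → Mult z k g)
          (≡.sym (≡.trans (count-++ z (rep n Y) _) (≡.cong₂ ℕ._+_ (count-rep z n Y) (count-rep z e (y ∷ []))))) (mult z (z ≟ y))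

      -- The dual lines of points with equal abscissae are parallel, which lowers the degree of P on them.
      vanish-vertical : ∀ c → countOn (vertical c) U ≡ e → ∀ Q → On (vertical c) Q → B.eval (aff Q) P ≋ 𝟘
      vanish-vertical c ce Q o = many-roots⇒𝟘 (rep n Y)
          (λ z → ≡.subst (λ k → Mult z k (B.eval (aff Q) P)) (≡.sym (count-rep z n Y)) (Mult-Y (aff Q) z))
          (Bnd-≤ (ℕ.≤-trans (ℕ.m≤n+o⇒m∸n≤o (suc (n ℕ.* p)) e (ℕ.≤-trans np<nN+e (ℕ.≤-reflexive (ℕ.+-comm _ e)))) (ℕ.≤-reflexive (≡.sym (length-rep n Y)))) bnd)
        where
        U₁ U₂ : List Pt
        U₁ = filter (on? (vertical c)) U
        U₂ = filter (¬? ∘ on? (vertical c)) U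
        m : ℕ
        m = suc (n ℕ.* p) ∸ e
        P≣₁ : P ≣ R U₁ ⊠ (R U₂ ⊠ f)
        P≣₁ = B.≋-trans P≣ (B.≋-trans (B.⊛-cong (R-partition (on? (vertical c)) U) B.≋-refl) (B.⊛-assoc (R U₁) (R U₂) f))
        deg₂ : TB m (R U₂ ⊠ f)
        deg₂ = TB-Π-inv (map aff U₁) (R U₂ ⊠ f) (Bnd-2-aff U₁)
          (TB-≤ (ℕ.≤-trans (ℕ.m≤n+m∸n (suc (n ℕ.* p)) e) (ℕ.≤-reflexive (≡.cong (ℕ._+ m) (≡.sym (≡.trans (List.length-map aff U₁) ce))))) (TB-resp P≣₁ deg))
        coeff-1 : ∀ Q′ → coeff (aff Q′) 1 ≡ - proj₁ Q′
        coeff-1 (u , v) = ≡.trans (coeff-⊕ (const v) _ 1) (≡.trans (≡.cong₂ _+_ (coeff-const-suc v 0)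
          (≡.trans (coeff-scale (- u) _ 1) (≡.trans (≡.cong (- u *_) (≡.trans (coeff-shift-suc _ 0) (coeff-const-zero 1#))) (KR.*-identityʳ (- u)))))
          (KR.+-identityˡ (- u)))
        const-lin : ∀ Q′ → On (vertical c) Q′ → Bnd 1 (aff Q ⊕ ⊖ aff Q′)
        const-lin Q′ o′ = Bnd-pred top (Bnd-⊕ (Bnd-aff Q) (Bnd-⊖ (Bnd-aff Q′)))
          where
          top : coeff (aff Q ⊕ ⊖ aff Q′) 1 ≡ 0#
          top = ≡.trans (coeff-⊕ (aff Q) (⊖ aff Q′) 1) (≡.trans (≡.cong₂ _+_ (coeff-1 Q) (≡.trans (coeff-⊖ (aff Q′) 1) (≡.cong -_ (coeff-1 Q′))))
            (≡.trans (≡.cong (λ u → - u + - (- proj₁ Q′)) (≡.trans o (≡.sym o′))) (KR.-‿inverseʳ (- proj₁ Q′))))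
        const-R : ∀ V → All (On (vertical c)) V → Bnd 1 (B.eval (aff Q) (R V))
        const-R []       _         = Bnd-resp (≋-sym (B.eval-const (aff Q) (const 1#))) (Bnd-const 1#)
        const-R (Q′ ∷ V) (o′ ∷ os′) = Bnd-resp (≋-sym (B.eval-lin-⊛ (aff Q) (aff Q′) (R V)))
          (Bnd-⊛ 1 0 _ _ (const-lin Q′ o′) (const-R V os′))
        bnd : Bnd m (B.eval (aff Q) P)
        bnd = Bnd-resp (≋-sym (≋-trans (B.eval-cong (aff Q) P≣₁) (≋-trans (B.eval-⊛ (aff Q) (R U₁) (R U₂ ⊠ f)) (⊛-comm _ _))))
          (Bnd-≤ (ℕ.≤-reflexive (ℕ.+-identityʳ m)) (Bnd-⊛ m 0 _ _ (TB-eval (R U₂ ⊠ f) (Bnd-aff Q) deg₂) (const-R U₁ (all-filter (on? (vertical c)) U))))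

      vanish-on : ∀ ℓ → OffGrid ℓ → countOn ℓ U ≡ e → ∀ Q → On ℓ Q → B.eval (aff Q) P ≋ 𝟘
      vanish-on (sloped y x) y∉Y = vanish-sloped y x y∉Y
      vanish-on (vertical c) _   = vanish-vertical c

    module LongLine {n r U} (comp : Completion n U) (hD : suc n ℕ.* D ℕ.+ r ≤ p) (r<p : r < p)
                    (ℓ : CLine) (long : p ≤ countOn ℓ U ℕ.+ r) (off : OffGrid ℓ) where
      open Completion comp

      e : ℕ
      e = countOn ℓ U

      -- By np = nN + nD this is what makes the zeros outnumber the degree. For D ≥ 1 the surplus is
      -- the last copy of D in (n+1) D ≤ e; for D = 0 it comes from r < p.
      nD<e : suc (n ℕ.* D) ≤ e
      nD<e = go D hD
        where
        go : ∀ D → suc n ℕ.* D ℕ.+ r ≤ p → suc (n ℕ.* D) ≤ e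
        go zero    _  = ≡.subst (_< e) (≡.sym (ℕ.*-zeroʳ n)) (ℕ.+-cancelʳ-< r 0 e (ℕ.≤-trans r<p long))
        go (suc D) hD = ℕ.≤-trans (s≤s (ℕ.m≤n+m _ D)) (ℕ.+-cancelʳ-≤ r _ _ (ℕ.≤-trans hD long))

      np<nN+e : suc (n ℕ.* p) ≤ n ℕ.* length Y ℕ.+ e
      np<nN+e = ℕ.≤-trans (ℕ.≤-reflexive (≡.trans (≡.cong (λ q → suc (n ℕ.* q)) (≡.sym N+D≡p))
        (≡.trans (≡.cong suc (ℕ.*-distribˡ-+ n (length Y) D)) (≡.sym (ℕ.+-suc _ _))))) (ℕ.+-monoʳ-≤ (n ℕ.* length Y) nD<e)

      U₁ U₂ : List Pt
      U₁ = filter (on? ℓ) U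
      U₂ = filter (¬? ∘ on? ℓ) U

      line : List Pt
      line = map (pt ℓ) els

      line-unique : Unique line
      line-unique = Unique.map⁺ (λ {t} {t′} e → ≡.trans (≡.sym (par-pt ℓ t)) (≡.trans (≡.cong (par ℓ) e) (par-pt ℓ t′))) els-unique

      -- P vanishes on the dual lines of all p points of ℓ. The factors of points off ℓ cannot
      -- account for this, so the rest of P does, also for those points of ℓ that are missing from
      -- U.
      cofactor : ∃ λ h → R U₁ ⊠ f ≣ R line ⊠ h
      cofactor = R-divides line-unique (R U₁ ⊠ f) λ Q Q∈ → zero-at Q (on-line Q (∈-map⁻ (pt ℓ) Q∈))
        where
        on-line : ∀ Q → (∃ λ t → t ∈ els × Q ≡ pt ℓ t) → On ℓ Q
        on-line Q (t , _ , ≡.refl) = On-pt ℓ t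
        P≣₂ : P ≣ R U₂ ⊠ (R U₁ ⊠ f)
        P≣₂ = B.≋-trans P≣ (B.≋-trans (B.⊛-cong (R-partition (on? ℓ) U) B.≋-refl)
          (BS.solve 3 (λ a b c → (a BS.:* b) BS.:* c BS.:= b BS.:* (a BS.:* c)) B.≋-refl (R U₁) (R U₂) f))
        zero-at : ∀ Q → On ℓ Q → B.eval (aff Q) (R U₁ ⊠ f) ≋ 𝟘
        zero-at Q o = eval-R-cancel Q U₂ (R U₁ ⊠ f) (All.map (λ { no-on ≡.refl → no-on o }) (all-filter (¬? ∘ on? ℓ) U))
          (≋-trans (B.eval-cong (aff Q) (B.≋-sym P≣₂)) (Vanishing.vanish-on comp e np<nN+e ℓ off ≡.refl Q o))

      h : B.Poly
      h = proj₁ cofactor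

      P≣₃ : P ≣ R line ⊠ (R U₂ ⊠ h)
      P≣₃ = B.≋-trans P≣ (B.≋-trans (B.⊛-cong (R-partition (on? ℓ) U) B.≋-refl)
        (B.≋-trans (BS.solve 3 (λ a b c → (a BS.:* b) BS.:* c BS.:= b BS.:* (a BS.:* c)) B.≋-refl (R U₁) (R U₂) f)
          (B.≋-trans (B.⊛-cong B.≋-refl (proj₂ cofactor))
            (BS.solve 3 (λ a b c → a BS.:* (b BS.:* c) BS.:= b BS.:* (a BS.:* c)) B.≋-refl (R U₂) (R line) h))))

      -- The slope of ℓ is not y, so its points lie on different lines of slope y. Hence at most one
      -- factor of the line vanishes at a given (x, y), and dividing out the line costs one order.
      val-injective : ∀ {y} → y ∈ Y → ∀ {t t′} → val y (pt ℓ t) ≡ val y (pt ℓ t′) → t ≡ t′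
      val-injective {y} y∈Y {t} {t′} eq = go ℓ off eq
        where
        go : ∀ ℓ → OffGrid ℓ → val y (pt ℓ t) ≡ val y (pt ℓ t′) → t ≡ t′
        go (vertical c) _ eq = ≡.trans (cancel t) (≡.trans (≡.cong (_+ c * y) eq) (≡.sym (cancel t′)))
          where
          cancel : ∀ t → t ≡ (t + - c * y) + c * y
          cancel t = KS.solve 3 (λ t c y → t KS.:= (t KS.:+ (KS.:- c) KS.:* y) KS.:+ c KS.:* y) ≡.refl t c y
        go (sloped z x) z∉Y eq = x-y≡0⇒x≡y (*-cancelˡ-0 {z + - y} (λ e → z∉Y (≡.subst (_∈ Y) (≡.sym (x-y≡0⇒x≡y e)) y∈Y))
          (≡.trans (KS.solve 5 (λ t t′ x y z → (z KS.:+ KS.:- y) KS.:* (t KS.:+ KS.:- t′) KS.:=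
              ((x KS.:+ t KS.:* z) KS.:+ (KS.:- t) KS.:* y) KS.:+ KS.:- ((x KS.:+ t′ KS.:* z) KS.:+ (KS.:- t′) KS.:* y)) ≡.refl t t′ x y z)
            (≡.trans (≡.cong (_+ - val y (t′ , x + t′ * z)) eq) (KR.-‿inverseʳ _))))

    remove-line : ∀ {n r U} (comp : Completion (suc n) U) → suc (suc n) ℕ.* D ℕ.+ r ≤ p → r < p →
                  ∀ ℓ → p ≤ countOn ℓ U ℕ.+ r → OffGrid ℓ → Completion n (filter (¬? ∘ on? ℓ) U)
    remove-line {n} {r} {U} comp hD r<p ℓ long off = record
      { P = P′ ; f = h ; P≣ = B.≋-refl ; deg = deg′ ; monic = monic′ ; order = order′ }
      where
      open Completion comp
      open LongLine comp hD r<p ℓ long off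
      P′ : B.Poly
      P′ = R U₂ ⊠ h
      length-line : length (map aff line) ≡ p
      length-line = ≡.trans (List.length-map aff line) (List.length-map (pt ℓ) els)
      deg′ : TB (suc (n ℕ.* p)) P′
      deg′ = TB-Π-inv (map aff line) P′ (Bnd-2-aff line)
        (TB-≤ (ℕ.≤-reflexive (≡.trans (≡.sym (ℕ.+-suc p (n ℕ.* p))) (≡.cong (ℕ._+ suc (n ℕ.* p)) (≡.sym length-line)))) (TB-resp P≣₃ deg))
      monic′ : ∀ y → coeff (σ y P′) (n ℕ.* p) ≡ 1#
      monic′ y = ≡.trans (≡.sym (≡.trans (at σP (p ℕ.+ n ℕ.* p)) (≡.trans
          (≡.cong (λ k → coeff (Π L ⊛ σ y P′) (k ℕ.+ n ℕ.* p)) (≡.sym len))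
          (≡.trans (coeff-top (length L) (n ℕ.* p) (Π L) (σ y P′) (Bnd-Π L) (TB-σ y deg′))
            (≡.trans (≡.cong (_* coeff (σ y P′) (n ℕ.* p)) (coeff-Π L)) (KR.*-identityˡ _)))))) (monic y)
        where
        L : List F
        L = map (val y) line
        len : length L ≡ p
        len = ≡.trans (List.length-map (val y) line) (List.length-map (pt ℓ) els)
        σP : σ y P ≋ Π L ⊛ σ y P′
        σP = ≋-trans (σ-cong y P≣₃) (≋-trans (σ-⊠ y (R line) P′) (⊛-cong (σ-R y line) ≋-refl))
      order′ : ∀ x y → y ∈ Y → Ord x y n P′
      order′ x y y∈Y = prod-div E hyp els-unique n P′ (Ord-resp (B.≋-trans P≣₃ (≡.subst (λ Q → R line ⊠ P′ ≣ Q ⊠ P′) (R-line els) B.≋-refl)) (order x y y∈Y))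
        where
        E : F → B.Poly
        E t = B.lin (aff (pt ℓ t))
        R-line : ∀ ts → R (map (pt ℓ) ts) ≡ prod (map E ts)
        R-line []       = ≡.refl
        R-line (t ∷ ts) = ≡.cong (E t ⊠_) (R-line ts)
        hyp : ∀ t → Unit (E t) ⊎ (Div (E t) × ∀ t′ → t ≢ t′ → Unit (E t′))
        hyp t = case (x ≟ val y (pt ℓ t))
          where
          case : Dec (x ≡ val y (pt ℓ t)) → Unit (E t) ⊎ (Div (E t) × ∀ t′ → t ≢ t′ → Unit (E t′))
          case (no ne) = inj₁ (lin-unit (aff (pt ℓ t)) λ e → ne (≡.trans e (eval-aff y (pt ℓ t))))
          case (yes e) = inj₂ (lin-div (aff (pt ℓ t)) (≡.trans (eval-aff y (pt ℓ t)) (≡.sym e)) ,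
            λ t′ ne → lin-unit (aff (pt ℓ t′)) λ e′ → ne (val-injective y∈Y (≡.trans (≡.sym e) (≡.trans e′ (eval-aff y (pt ℓ t′))))))

    find-long : ∀ {n r Q₀ U} (comp : Completion (suc n) (Q₀ ∷ U)) → Unique (Q₀ ∷ U) → suc (suc n) ℕ.* D ℕ.+ r ≤ p →
                suc n ℕ.* p ≤ length (Q₀ ∷ U) ℕ.+ r → ∃ λ ℓ → p ≤ countOn ℓ (Q₀ ∷ U) ℕ.+ r × OffGrid ℓ
    find-long {n} {r} {Q₀} {U} comp (a ∷ _) hD len = search (any? (λ y → suc n ℕ.<? count (val y Q₀) (L y)) els)
      where
      open Completion comp
      V : List Pt
      V = Q₀ ∷ U
      L : F → List F
      L y = map (val y) V
      Goal : Set
      Goal = ∃ λ ℓ → p ≤ countOn ℓ V ℕ.+ r × OffGrid ℓ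

      Mult-P : ∀ y x → Mult x (count x (L y)) (σ y P)
      Mult-P y x = Mult-resp (≋-trans (⊛-comm (σ y f) (Π (L y))) (≋-sym (≋-trans (σ-cong y P≣) (≋-trans (σ-⊠ y (R V) f) (⊛-cong (σ-R y V) ≋-refl)))))
        (Mult-⊛ (σ y f) (Mult-Π x (L y)))

      -- For y ∈ Y the polynomial P(X,y) has n + 1 zeros at each of the p elements; one more at x
      -- would exceed its degree (n+1) p, although it is monic.
      not-in-Y : ∀ y x → suc n < count x (L y) → y ∉ Y
      not-in-Y y x lt y∈Y = 1≢0 (≡.trans (≡.sym (monic y)) (≡.trans (at zero-P (suc n ℕ.* p)) (coeff-𝟘 _)))
        where
        mults : ∀ z → Dec (z ≡ x) → Mult z (count z (x ∷ copies (suc n))) (σ y P)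
        mults z (yes ≡.refl) = Mult-≤ (≡.subst (_≤ count z (L y)) (≡.sym (≡.trans (count-here z (copies (suc n))) (≡.cong suc (count-copies z (suc n))))) lt) (Mult-P y z)
        mults z (no ne) = ≡.subst (λ k → Mult z k (σ y P)) (≡.sym (≡.trans (count-there (copies (suc n)) ne) (count-copies z (suc n)))) (Ord⇒Mult-σ (order z y y∈Y))
        zero-P : σ y P ≋ 𝟘
        zero-P = many-roots⇒𝟘 (x ∷ copies (suc n)) (λ z → mults z (z ≟ x))
          (≡.subst (λ k → Bnd (suc k) (σ y P)) (≡.sym (length-copies (suc n))) (TB-σ y deg))

      1≤D : ∀ y → y ∉ Y → 1 ≤ D
      1≤D y y∉Y = ℕ.+-cancelˡ-≤ (length Y) 1 D (ℕ.≤-trans (ℕ.≤-reflexive (ℕ.+-comm (length Y) 1))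
        (ℕ.≤-trans (unique⇒length≤p {y ∷ Y} (All.tabulate (λ {z} z∈Y e → y∉Y (≡.subst (_∈ Y) (≡.sym e) z∈Y)) ∷ uY)) (ℕ.≤-reflexive (≡.sym N+D≡p))))

      sloped-case : ∀ y → suc n < count (val y Q₀) (L y) → Goal
      sloped-case y lt = go (expand (suc n) 0 P (TB-≤ (ℕ.≤-reflexive (≡.cong suc (≡.sym (ℕ.+-identityʳ _)))) deg) order y)
        where
        y∉Y : y ∉ Y
        y∉Y = not-in-Y y (val y Q₀) lt
        go : (∃ λ d → σ y P ≋ S d (suc (suc n)) × (∀ i → i ≤ suc n → Bnd (suc ((0 ℕ.+ (suc n ∸ i)) ℕ.* D)) (d i))) → Goal
        go (d , e , bd) = finish (long-root n D r (1≤D y y∉Y) hD d (σ y P) (L y) e bd (monic y)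
            (ℕ.≤-trans len (ℕ.≤-reflexive (≡.cong (ℕ._+ r) (≡.sym (List.length-map (val y) V))))) (Mult-P y) (val y Q₀) lt)
          where
          finish : (∃ λ x → p ≤ count x (L y) ℕ.+ r) → Goal
          finish (x , h) = sloped y x , ≡.subst (λ k → p ≤ k ℕ.+ r) (count≡countOn y x V) h , y∉Y

      -- Apart from Q₀, each of the p sloped lines through Q₀ carries at most n points. Of at least
      -- (n+1) p - r points this leaves p - r, with Q₀ among them, for the vertical line.
      vertical-case : (∀ y → count (val y Q₀) (L y) ≤ suc n) → Goal
      vertical-case few = vertical (proj₁ Q₀) , long , tt
        where
        few′ : ∀ y → countOn (sloped y (val y Q₀)) U ≤ n
        few′ y = ℕ.≤-pred (≡.subst (_≤ suc n) (≡.trans (count≡countOn y (val y Q₀) V) (countOn-here (sloped y (val y Q₀)) {Q₀} U ≡.refl)) (few y))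
        cv : ℕ
        cv = countOn (vertical (proj₁ Q₀)) U
        sum-n : ∀ (xs : List F) → sum (map (λ _ → n) xs) ≡ length xs ℕ.* n
        sum-n []       = ≡.refl
        sum-n (_ ∷ xs) = ≡.cong (n ℕ.+_) (sum-n xs)
        rearr : ∀ c q r → suc (c ℕ.+ q) ℕ.+ r ≡ q ℕ.+ (suc c ℕ.+ r)
        rearr = solve-∀
        long : p ≤ countOn (vertical (proj₁ Q₀)) V ℕ.+ r
        long = ℕ.≤-trans (ℕ.+-cancelˡ-≤ (n ℕ.* p) p (suc cv ℕ.+ r) (begin
          n ℕ.* p ℕ.+ p                    ≡⟨ ℕ.+-comm (n ℕ.* p) p ⟩
          suc n ℕ.* p                      ≤⟨ len ⟩
          suc (length U) ℕ.+ r             ≤⟨ ℕ.+-monoˡ-≤ r (s≤s (ℕ.≤-trans (pencil-bound Q₀ U a) (ℕ.+-monoʳ-≤ cv (sum-mono els few′)))) ⟩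
          suc (cv ℕ.+ sum (map (λ _ → n) els)) ℕ.+ r
                                           ≡⟨ ≡.cong (λ k → suc (cv ℕ.+ k) ℕ.+ r) (≡.trans (sum-n els) (ℕ.*-comm p n)) ⟩
          suc (cv ℕ.+ n ℕ.* p) ℕ.+ r       ≡⟨ rearr cv (n ℕ.* p) r ⟩
          n ℕ.* p ℕ.+ (suc cv ℕ.+ r)       ∎))
          (ℕ.≤-reflexive (≡.cong (ℕ._+ r) (≡.sym (countOn-here (vertical (proj₁ Q₀)) {Q₀} U ≡.refl))))
          where open ℕ.≤-Reasoning

      search : Dec (Any (λ y → suc n < count (val y Q₀) (L y)) els) → Goal
      search (yes some) = sloped-case (proj₁ (Any.satisfied some)) (proj₂ (Any.satisfied some))
      search (no none)  = vertical-case λ y → ℕ.≮⇒≥ λ lt → none (Any.map (λ { ≡.refl → lt }) (∈-els y))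

    -- The size condition is an inequality because a removed line may contain fewer than p points of
    -- U.
    cover : ∀ n r U → Unique U → suc n ℕ.* D ℕ.+ r ≤ p → r < p → n ℕ.* p ≤ length U ℕ.+ r → Completion n U → Covered n U
    -- The points can run out early; arbitrary lines then fill the list up to length n.
    cover n r [] _ _ _ _ _ = replicate n (vertical 0#) , List.length-replicate n , λ _ ()
    -- With n = 0 the polynomial P has degree at most 0 and yet a linear factor, so it vanishes,
    -- against `monic`.
    cover zero r (Q ∷ U) _ _ _ _ comp = ⊥-elim (1≢0 (≡.trans (≡.sym (monic 0#)) (≡.trans (at σP 0) (coeff-𝟘 0))))
      where
      open Completion comp
      P₁ : B.Poly
      P₁ = R U ⊠ f
      eq : P ≣ B.lin (aff Q) ⊠ P₁
      eq = B.≋-trans P≣ (B.⊛-assoc (B.lin (aff Q)) (R U) f)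
      σP : σ 0# P ≋ 𝟘
      σP = ≋-trans (σ-cong 0# eq) (≋-trans (σ-⊠ 0# (B.lin (aff Q)) P₁)
        (≋-trans (⊛-cong ≋-refl (Bnd-0 (TB-σ 0# (TB-lin-inv P₁ (Bnd-aff Q) (TB-resp eq deg))))) (P.zeroʳ _)))
    cover (suc n) r U@(Q₀ ∷ U′) uU hD r<p len comp = step (find-long comp uU hD len)
      where
      step : (∃ λ ℓ → p ≤ countOn ℓ U ℕ.+ r × OffGrid ℓ) → Covered (suc n) U
      step (ℓ , long , off) = extend (cover n r U₂ (filter⁺ (¬? ∘ on? ℓ) uU) (ℕ.≤-trans (ℕ.+-monoˡ-≤ r (ℕ.m≤n+m _ D)) hD) r<p len₂
                                (remove-line comp hD r<p ℓ long off))
        where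
        U₂ : List Pt
        U₂ = filter (¬? ∘ on? ℓ) U
        len₂ : n ℕ.* p ≤ length U₂ ℕ.+ r
        len₂ = ℕ.+-cancelˡ-≤ p _ _ (ℕ.≤-trans len (ℕ.≤-trans
          (ℕ.≤-reflexive (≡.trans (≡.cong (ℕ._+ r) (length-partition (on? ℓ) U)) (ℕ.+-assoc (countOn ℓ U) (length U₂) r)))
          (ℕ.+-monoˡ-≤ (length U₂ ℕ.+ r) (countOn≤p ℓ uU))))
        extend : Covered n U₂ → Covered (suc n) U
        extend (ls , ll , h) = ℓ ∷ ls , ≡.cong suc ll , λ Q Q∈U → case Q Q∈U (on? ℓ Q)
          where
          case : ∀ Q → Q ∈ U → Dec (On ℓ Q) → Any (λ ℓ → On ℓ Q) (ℓ ∷ ls)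
          case Q Q∈U (yes o) = here o
          case Q Q∈U (no no-on) = there (h Q (∈-filter⁺ (¬? ∘ on? ℓ) Q∈U no-on))

    -- P is Zⁿ minus its remainder modulo R U; over Y the remainder vanishes.
    complete : ∀ n r U → length U ℕ.+ r ≡ n ℕ.* p →
      (∀ y → y ∈ Y → ∀ x → count x (map (val y) U) ≤ n × n ≤ suc (count x (map (val y) U))) → Completion n U
    complete n r U len cnt = build (divΠ {suc r} (map aff U) (Bnd-2-aff U) (Zᴮ n) degZ)
      where
      len-aff : length (map aff U) ℕ.+ suc r ≡ suc (n ℕ.* p)
      len-aff = ≡.trans (≡.cong (ℕ._+ suc r) (List.length-map aff U)) (≡.trans (ℕ.+-suc (length U) r) (≡.cong suc len))
      degZ : TB (length (map aff U) ℕ.+ suc r) (Zᴮ n)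
      degZ = ≡.subst (λ k → TB k (Zᴮ n)) (≡.trans (≡.cong suc (length-Zᴮ n)) (≡.sym len-aff)) (TB-Π (map const (copies n)) (Bnd-2-const (copies n)))
      build : (∃₂ λ f C → Zᴮ n ≣ R U ⊠ f ⊞ C × TB (suc r) f × TB (length (map aff U) ℕ.+ suc r) C × B.Bnd (length (map aff U)) C) → Completion n U
      build (f , C , e , _ , hC , bC) = record { P = P ; f = f ; P≣ = B.≋-refl ; deg = deg ; monic = monic ; order = order }
        where
        P : B.Poly
        P = R U ⊠ f
        P≣ : P ≣ Zᴮ n ⊞ ⊟ C
        P≣ = B.≋-sym (B.≋-trans (B.⊕-cong e B.≋-refl) (BS.solve 2 (λ a c → (a BS.:+ c) BS.:+ BS.:- c BS.:= a) B.≋-refl P C))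
        deg : TB (suc (n ℕ.* p)) P
        deg = ≡.subst (λ k → TB k P) len-aff (TB-resp (B.≋-sym P≣) (TB-⊞ degZ (TB-⊟ hC)))
        σP : ∀ y → σ y P ≋ Zp n ⊕ ⊖ σ y C
        σP y = ≋-trans (σ-cong y P≣) (≋-trans (σ-⊞ y (Zᴮ n) (⊟ C)) (⊕-cong (σ-Zᴮ y n) (σ-⊟ y C)))
        bσC : ∀ y → Bnd (length U) (σ y C)
        bσC y = ≡.subst (λ k → Bnd k (σ y C)) (List.length-map aff U) (Bnd-σ y bC)
        monic : ∀ y → coeff (σ y P) (n ℕ.* p) ≡ 1#
        monic y = ≡.trans (at (σP y) (n ℕ.* p)) (≡.trans (coeff-⊕ (Zp n) (⊖ σ y C) (n ℕ.* p))
          (≡.trans (≡.cong₂ _+_ (≡.trans (≡.cong (coeff (Zp n)) (≡.sym (length-copies n))) (coeff-Π (copies n)))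
                                (vanish (Bnd-⊖ (bσC y)) (n ℕ.* p) (≡.subst (length U ≤_) len (ℕ.m≤m+n (length U) r))))
            (KR.+-identityʳ 1#)))
        L : F → List F
        L y = map (val y) U
        σP₂ : ∀ y → σ y P ≋ Π (L y) ⊛ σ y f
        σP₂ y = ≋-trans (σ-⊠ y (R U) f) (⊛-cong (σ-R y U) ≋-refl)
        -- Every multiplicity is at most n, so the zeros of R(X,y) are zeros of Zⁿ and hence of the
        -- remainder, whose degree is below the number of points.
        σC≋𝟘 : ∀ y → y ∈ Y → σ y C ≋ 𝟘
        σC≋𝟘 y y∈Y = many-roots⇒𝟘 (L y) mults (≡.subst (λ k → Bnd k (σ y C)) (≡.sym (List.length-map (val y) U)) (bσC y))
          where
          σC : σ y C ≋ Zp n ⊕ ⊖ (σ y f ⊛ Π (L y))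
          σC = ≋-trans (PS.solve 2 (λ z c → c PS.:= z PS.:+ PS.:- (z PS.:+ PS.:- c)) ≋-refl (Zp n) (σ y C))
            (⊕-cong ≋-refl (⊖-cong (≋-trans (≋-sym (σP y)) (≋-trans (σP₂ y) (⊛-comm (Π (L y)) (σ y f))))))
          mults : ∀ x → Mult x (count x (L y)) (σ y C)
          mults x = Mult-resp (≋-sym σC) (Mult-⊕ (Mult-≤ (proj₁ (cnt y y∈Y x)) (Mult-Zp x n)) (Mult-⊖ (Mult-⊛ (σ y f) (Mult-Π x (L y)))))
        order : ∀ x y → y ∈ Y → Ord x y n P
        order x y y∈Y = go (n ℕ.≤? count x (L y))
          where
          go : Dec (n ≤ count x (L y)) → Ord x y n P
          go (yes n≤c) = Ord-resp (B.⊛-comm f (R U)) (Ord-⊠ f (Ord-≤ n≤c (Ord-R x y U)))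
          -- Here the multiplicity is n - 1. As the remainder vanishes, Zⁿ = R(X,y) f(X,y), so the
          -- missing zero is a zero of f.
          go (no n≰c) = ≡.subst (λ k → Ord x y k P) 1+c≡n (Ord-resp (B.⊛-comm f (R U)) (Ord-1⊠ (root⇒Ord x y f (Mult-root f-root)) (Ord-R x y U)))
            where
            1+c≡n : suc (count x (L y)) ≡ n
            1+c≡n = ℕ.≤-antisym (ℕ.≰⇒> n≰c) (proj₂ (cnt y y∈Y x))
            Zp≋ : Zp n ≋ Π (L y) ⊛ σ y f
            Zp≋ = ≋-trans (≋-sym (⊕-identityʳ (Zp n))) (≋-trans (⊕-cong ≋-refl (≋-sym (≋-trans (⊖-cong (σC≋𝟘 y y∈Y)) (≋-trans (≋-sym (⊕-identityˡ _)) (⊖-inverseʳ 𝟘)))))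
              (≋-trans (≋-sym (σP y)) (σP₂ y)))
            f-root : Mult x 1 (σ y f)
            f-root = Mult-Π-inv (L y) (σ y f) (Mult-resp Zp≋ (≡.subst (λ k → Mult x k (Zp n)) (≡.trans (≡.sym 1+c≡n) (ℕ.+-comm 1 _)) (Mult-Zp x n)))

    covering : ∀ n r U → Unique U → length U ℕ.+ r ≡ n ℕ.* p → suc n ℕ.* D ℕ.+ r ≤ p → r < p →
      (∀ y → y ∈ Y → ∀ x → count x (map (val y) U) ≤ n × n ≤ suc (count x (map (val y) U))) → Covered n U
    covering n r U uU len hD r<p cnt = cover n r U uU hD r<p (ℕ.≤-reflexive (≡.sym len)) (complete n r U len cnt)

-- Residues modulo a prime as a field

module Residues (p : ℕ) .{{_ : NonZero p}} where

  ⟦_⟧ : ℕ → Fin p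
  ⟦ n ⟧ = n mod p

  toℕ-⟦⟧ : ∀ n → toℕ ⟦ n ⟧ ≡ n % p
  toℕ-⟦⟧ n = Fin.toℕ-fromℕ< (ℕ.m%n<n n p)

  ⟦⟧-cong : ∀ {m n} → m % p ≡ n % p → ⟦ m ⟧ ≡ ⟦ n ⟧
  ⟦⟧-cong {m} {n} e = Fin.toℕ-injective (≡.trans (toℕ-⟦⟧ m) (≡.trans e (≡.sym (toℕ-⟦⟧ n))))

  ⟦toℕ⟧ : ∀ a → ⟦ toℕ a ⟧ ≡ a
  ⟦toℕ⟧ a = Fin.toℕ-injective (≡.trans (toℕ-⟦⟧ (toℕ a)) (ℕ.m<n⇒m%n≡m (Fin.toℕ<n a)))

  infixl 6 _+ₚ_
  infixl 7 _*ₚ_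

  _+ₚ_ _*ₚ_ : Fin p → Fin p → Fin p
  a +ₚ b = (toℕ a ℕ.+ toℕ b) mod p
  a *ₚ b = (toℕ a ℕ.* toℕ b) mod p

  -ₚ_ : Fin p → Fin p
  -ₚ a = ⟦ p ∸ toℕ a ⟧

  ⟦⟧-+ : ∀ m n → ⟦ m ⟧ +ₚ ⟦ n ⟧ ≡ ⟦ m ℕ.+ n ⟧
  ⟦⟧-+ m n = ⟦⟧-cong (≡.trans (≡.cong₂ (λ a b → (a ℕ.+ b) % p) (toℕ-⟦⟧ m) (toℕ-⟦⟧ n)) (≡.sym (ℕ.%-distribˡ-+ m n p)))

  ⟦⟧-* : ∀ m n → ⟦ m ⟧ *ₚ ⟦ n ⟧ ≡ ⟦ m ℕ.* n ⟧
  ⟦⟧-* m n = ⟦⟧-cong (≡.trans (≡.cong₂ (λ a b → (a ℕ.* b) % p) (toℕ-⟦⟧ m) (toℕ-⟦⟧ n)) (≡.sym (ℕ.%-distribˡ-* m n p)))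

  ⟦p⟧ : ⟦ p ⟧ ≡ ⟦ 0 ⟧
  ⟦p⟧ = ⟦⟧-cong (≡.trans (ℕ.n%n≡0 p) (≡.sym (ℕ.m*n%n≡0 0 p)))

  ⟦⟧-*p : ∀ k → ⟦ k ℕ.* p ⟧ ≡ ⟦ 0 ⟧
  ⟦⟧-*p k = ⟦⟧-cong (≡.trans (ℕ.m*n%n≡0 k p) (≡.sym (ℕ.m*n%n≡0 0 p)))

  -- An identity in Fin p follows from its lift to ℕ since every a is ⟦ toℕ a ⟧.
  private
    ⟦+⟧ˡ : ∀ m a → ⟦ m ⟧ +ₚ a ≡ ⟦ m ℕ.+ toℕ a ⟧
    ⟦+⟧ˡ m a = ≡.trans (≡.cong (⟦ m ⟧ +ₚ_) (≡.sym (⟦toℕ⟧ a))) (⟦⟧-+ m (toℕ a))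
    ⟦+⟧ʳ : ∀ a m → a +ₚ ⟦ m ⟧ ≡ ⟦ toℕ a ℕ.+ m ⟧
    ⟦+⟧ʳ a m = ≡.trans (≡.cong (_+ₚ ⟦ m ⟧) (≡.sym (⟦toℕ⟧ a))) (⟦⟧-+ (toℕ a) m)
    ⟦*⟧ˡ : ∀ m a → ⟦ m ⟧ *ₚ a ≡ ⟦ m ℕ.* toℕ a ⟧
    ⟦*⟧ˡ m a = ≡.trans (≡.cong (⟦ m ⟧ *ₚ_) (≡.sym (⟦toℕ⟧ a))) (⟦⟧-* m (toℕ a))
    ⟦*⟧ʳ : ∀ a m → a *ₚ ⟦ m ⟧ ≡ ⟦ toℕ a ℕ.* m ⟧
    ⟦*⟧ʳ a m = ≡.trans (≡.cong (_*ₚ ⟦ m ⟧) (≡.sym (⟦toℕ⟧ a))) (⟦⟧-* (toℕ a) m)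

  +ₚ-comm : ∀ a b → a +ₚ b ≡ b +ₚ a
  +ₚ-comm a b = ≡.cong ⟦_⟧ (ℕ.+-comm (toℕ a) (toℕ b))

  *ₚ-comm : ∀ a b → a *ₚ b ≡ b *ₚ a
  *ₚ-comm a b = ≡.cong ⟦_⟧ (ℕ.*-comm (toℕ a) (toℕ b))

  +ₚ-assoc : ∀ a b c → (a +ₚ b) +ₚ c ≡ a +ₚ (b +ₚ c)
  +ₚ-assoc a b c = ≡.trans (⟦+⟧ˡ (toℕ a ℕ.+ toℕ b) c) (≡.trans (≡.cong ⟦_⟧ (ℕ.+-assoc (toℕ a) (toℕ b) (toℕ c))) (≡.sym (⟦+⟧ʳ a (toℕ b ℕ.+ toℕ c))))

  *ₚ-assoc : ∀ a b c → (a *ₚ b) *ₚ c ≡ a *ₚ (b *ₚ c)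
  *ₚ-assoc a b c = ≡.trans (⟦*⟧ˡ (toℕ a ℕ.* toℕ b) c) (≡.trans (≡.cong ⟦_⟧ (ℕ.*-assoc (toℕ a) (toℕ b) (toℕ c))) (≡.sym (⟦*⟧ʳ a (toℕ b ℕ.* toℕ c))))

  +ₚ-identityˡ : ∀ a → ⟦ 0 ⟧ +ₚ a ≡ a
  +ₚ-identityˡ a = ≡.trans (⟦+⟧ˡ 0 a) (⟦toℕ⟧ a)

  *ₚ-identityˡ : ∀ a → ⟦ 1 ⟧ *ₚ a ≡ a
  *ₚ-identityˡ a = ≡.trans (⟦*⟧ˡ 1 a) (≡.trans (≡.cong ⟦_⟧ (ℕ.*-identityˡ (toℕ a))) (⟦toℕ⟧ a))

  -ₚ-inverseʳ : ∀ a → a +ₚ -ₚ a ≡ ⟦ 0 ⟧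
  -ₚ-inverseʳ a = ≡.trans (⟦+⟧ʳ a (p ∸ toℕ a)) (≡.trans (≡.cong ⟦_⟧ (ℕ.m+[n∸m]≡n (ℕ.<⇒≤ (Fin.toℕ<n a)))) ⟦p⟧)

  distribˡ : ∀ a b c → a *ₚ (b +ₚ c) ≡ a *ₚ b +ₚ a *ₚ c
  distribˡ a b c = ≡.trans (⟦*⟧ʳ a (toℕ b ℕ.+ toℕ c)) (≡.trans (≡.cong ⟦_⟧ (ℕ.*-distribˡ-+ (toℕ a) (toℕ b) (toℕ c)))
    (≡.sym (⟦⟧-+ (toℕ a ℕ.* toℕ b) (toℕ a ℕ.* toℕ c))))

  isCommutativeRing : IsCommutativeRing _≡_ _+ₚ_ _*ₚ_ -ₚ_ ⟦ 0 ⟧ ⟦ 1 ⟧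
  isCommutativeRing = record
    { isRing = record
      { +-isAbelianGroup = record
        { isGroup = record
          { isMonoid = record
            { isSemigroup = record { isMagma = record { isEquivalence = ≡.isEquivalence ; ∙-cong = ≡.cong₂ _+ₚ_ } ; assoc = +ₚ-assoc }
            ; identity = +ₚ-identityˡ , λ a → ≡.trans (+ₚ-comm a _) (+ₚ-identityˡ a) }
          ; inverse = (λ a → ≡.trans (+ₚ-comm _ a) (-ₚ-inverseʳ a)) , -ₚ-inverseʳ
          ; ⁻¹-cong = ≡.cong -ₚ_ }
        ; comm = +ₚ-comm }
      ; *-cong = ≡.cong₂ _*ₚ_
      ; *-assoc = *ₚ-assoc
      ; *-identity = *ₚ-identityˡ , λ a → ≡.trans (*ₚ-comm a _) (*ₚ-identityˡ a)
      ; distrib = distribˡ , λ a b c → ≡.trans (*ₚ-comm _ a) (≡.trans (distribˡ a b c) (≡.cong₂ _+ₚ_ (*ₚ-comm a b) (*ₚ-comm a c))) }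
    ; *-comm = *ₚ-comm }

  ring : CommutativeRing 0ℓ 0ℓ
  ring = record { isCommutativeRing = isCommutativeRing }

  ⟦⟧≢0 : ∀ {k} → 0 < k → k < p → ⟦ k ⟧ ≢ ⟦ 0 ⟧
  ⟦⟧≢0 {k} 0<k k<p e = ℕ.<⇒≢ 0<k (≡.sym (≡.trans (≡.sym (ℕ.m<n⇒m%n≡m k<p)) (≡.trans (≡.sym (toℕ-⟦⟧ k)) (≡.trans (≡.cong toℕ e) (≡.trans (toℕ-⟦⟧ 0) (ℕ.m*n%n≡0 0 p))))))

  inverse : Prime p → ∀ a → a ≢ ⟦ 0 ⟧ → ∃ λ b → a *ₚ b ≡ ⟦ 1 ⟧
  inverse pr a a≢0 = go (coprime-Bézout (prime⇒coprime pr {{ℕ.≢-nonZero a≢0′}} (Fin.toℕ<n a)))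
    where
    module RS = RingSolver ring
    a≢0′ : toℕ a ≢ 0
    a≢0′ e = a≢0 (≡.trans (≡.sym (⟦toℕ⟧ a)) (≡.cong ⟦_⟧ e))
    a* : ∀ y → a *ₚ ⟦ y ⟧ ≡ ⟦ y ℕ.* toℕ a ⟧
    a* y = ≡.trans (⟦*⟧ʳ a y) (≡.cong ⟦_⟧ (ℕ.*-comm (toℕ a) y))
    go : Bézout.Identity 1 p (toℕ a) → ∃ λ b → a *ₚ b ≡ ⟦ 1 ⟧
    go (Bézout.-+ x y eq) = ⟦ y ⟧ , ≡.trans (a* y) (≡.trans (≡.cong ⟦_⟧ (≡.sym eq)) (≡.trans (≡.sym (⟦⟧-+ 1 (x ℕ.* p)))
      (≡.trans (≡.cong (⟦ 1 ⟧ +ₚ_) (⟦⟧-*p x)) (CommutativeRing.+-identityʳ ring ⟦ 1 ⟧))))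
    -- Here 1 + y a = x p, so the inverse of a is -y.
    go (Bézout.+- x y eq) = -ₚ ⟦ y ⟧ , ≡.trans (RS.solve 3 (λ a y o → a RS.:* (RS.:- y) RS.:= o RS.:+ RS.:- (o RS.:+ a RS.:* y)) ≡.refl a ⟦ y ⟧ ⟦ 1 ⟧)
      (≡.trans (≡.cong (λ z → ⟦ 1 ⟧ +ₚ -ₚ z) (≡.trans (≡.cong (⟦ 1 ⟧ +ₚ_) (a* y)) (≡.trans (⟦⟧-+ 1 (y ℕ.* toℕ a)) (≡.trans (≡.cong ⟦_⟧ eq) (⟦⟧-*p x)))))
        (≡.trans (≡.cong (⟦ 1 ⟧ +ₚ_) (Algebra.Properties.Ring.-0#≈0# (CommutativeRing.ring ring))) (CommutativeRing.+-identityʳ ring ⟦ 1 ⟧)))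

  field-of : Prime p → FiniteField
  field-of pr = record
    { F = Fin p ; _+_ = _+ₚ_ ; _*_ = _*ₚ_ ; -_ = -ₚ_ ; 0# = ⟦ 0 ⟧ ; 1# = ⟦ 1 ⟧
    ; isCommutativeRing = isCommutativeRing ; _≟_ = Fin._≟_ ; inverse = inverse pr
    ; 1≢0 = ⟦⟧≢0 (s≤s z≤n) (ℕ.nonTrivial⇒n>1 p {{prime⇒nonTrivial pr}})
    ; els = allFin p ; ∈-els = ∈-allFin ; els-unique = Unique.allFin⁺ p
    ; char = λ k 0<k k<p e → ⟦⟧≢0 0<k (≡.subst (k <_) (List.length-tabulate id) k<p) (≡.trans (≡.sym (×-1 k)) e) }
    where
    open import Algebra.Properties.Semiring.Mult (CommutativeRing.semiring ring) using () renaming (_×_ to _×ₙ_)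
    ×-1 : ∀ k → k ×ₙ ⟦ 1 ⟧ ≡ ⟦ k ⟧
    ×-1 zero    = ≡.refl
    ×-1 (suc k) = ≡.trans (≡.cong (⟦ 1 ⟧ +ₚ_) (×-1 k)) (⟦⟧-+ 1 k)

-- Charts and special directions in the original plane

module Directions (p : ℕ) .{{nz : NonZero p}} (prime : Prime p) where
  open Residues p
  𝔽 : FiniteField
  𝔽 = field-of prime
  open FiniteField 𝔽 using (_≟_; els; ∈-els; els-unique) renaming (_+_ to _⊹_; _*_ to _·_; -_ to ~_; 0# to 0ₚ; 1# to 1ₚ; p to p′)
  open Univariate 𝔽 using (count; x-y≡0⇒x≡y; module KS; module KR; *-cancelˡ-0)
  open Geometry 𝔽
  open Covering 𝔽

  p′≡p : p′ ≡ p
  p′≡p = List.length-tabulate id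

  filterᵇ : ∀ {A : Set} → (A → Bool) → List A → List A
  filterᵇ P = filter (λ x → P x Bool.≟ true)

  length-filterᵇ : ∀ {A : Set} (P : A → Bool) xs → sum (map (λ x → if P x then 1 else 0) xs) ≡ length (filterᵇ P xs)
  length-filterᵇ P []       = ≡.refl
  length-filterᵇ P (x ∷ xs) with P x
  ... | true  = ≡.cong suc (length-filterᵇ P xs)
  ... | false = length-filterᵇ P xs

  points : PointSet p → List (Point p)
  points U = filterᵇ U (allPoints p)

  points-unique : ∀ U → Unique (points U)
  points-unique U = Unique.filter⁺ _ (Unique.cartesianProduct⁺ (Unique.allFin⁺ p) (Unique.allFin⁺ p))

  ∈-points : ∀ U x → U x ≡ true → x ∈ points U
  ∈-points U x@(u , v) e = ∈-filter⁺ (λ x → U x Bool.≟ true) (∈-cartesianProduct⁺ (∈-allFin u) (∈-allFin v)) e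

  card≡length : ∀ U → card U ≡ length (points U)
  card≡length U = length-filterᵇ U (allPoints p)

  -- Affine coordinates in which a given direction becomes vertical.
  record Chart (base : Direction p) : Set where
    field
      φ             : Point p → Pt
      φ-injective   : ∀ {P Q} → φ P ≡ φ Q → P ≡ Q
      dir           : Fin p → Direction p
      dir-injective : ∀ {y y′} → dir y ≡ dir y′ → y ≡ y′
      dir≢base      : ∀ y → base ≢ dir y
      line          : CLine → Line p
      line-slope    : ∀ y x → slope (line (sloped y x)) ≡ dir y
      on⇒           : ∀ ℓ P → On ℓ (φ P) → onLine (line ℓ) P ≡ true
      on⇐           : ∀ ℓ P → onLine (line ℓ) P ≡ true → On ℓ (φ P)

  ⌊⌋-true : ∀ {A : Set} (A? : Dec A) → A → ⌊ A? ⌋ ≡ true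
  ⌊⌋-true (yes _) _ = ≡.refl
  ⌊⌋-true (no ¬a) a = contradiction a ¬a

  true-⌊⌋ : ∀ {A : Set} (A? : Dec A) → ⌊ A? ⌋ ≡ true → A
  true-⌊⌋ (yes a) _ = a

  +-cancelʳ : ∀ {a b} c → a ⊹ c ≡ b ⊹ c → a ≡ b
  +-cancelʳ {a} {b} c e = ≡.trans (lem a) (≡.trans (≡.cong (_⊹ ~ c) e) (≡.sym (lem b)))
    where
    lem : ∀ a → a ≡ (a ⊹ c) ⊹ ~ c
    lem a = KS.solve 2 (λ a c → a KS.:= (a KS.:+ c) KS.:+ KS.:- c) ≡.refl a c

  chart-∞ : Chart ∞
  chart-∞ = record
    { φ = id ; φ-injective = id
    ; dir = fin ; dir-injective = λ { ≡.refl → ≡.refl } ; dir≢base = λ _ ()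
    ; line = line ; line-slope = λ _ _ → ≡.refl
    ; on⇒ = on⇒ ; on⇐ = on⇐ }
    where
    line : CLine → Line p
    line (vertical c) = vert c
    -- The original lines are v = mu - k, so the intercept x becomes k = -x.
    line (sloped y x) = nonvert y (~ x)
    lhs : ∀ u v y x → (v ⊹ (~ u) · y) ⊹ (u · y ⊹ ~ x) ≡ v ⊹ ~ x
    lhs u v y x = KS.solve 4 (λ u v y x → (v KS.:+ (KS.:- u) KS.:* y) KS.:+ (u KS.:* y KS.:+ KS.:- x) KS.:= v KS.:+ KS.:- x) ≡.refl u v y x
    rhs : ∀ u y x → x ⊹ (u · y ⊹ ~ x) ≡ y · u
    rhs u y x = KS.solve 3 (λ u y x → x KS.:+ (u KS.:* y KS.:+ KS.:- x) KS.:= y KS.:* u) ≡.refl u y x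
    on⇒ : ∀ ℓ P → On ℓ P → onLine (line ℓ) P ≡ true
    on⇒ (vertical c) (u , v) o = ⌊⌋-true (u ≟ c) o
    on⇒ (sloped y x) (u , v) o = ⌊⌋-true (v ⊹ ~ x ≟ y · u)
      (≡.trans (≡.sym (lhs u v y x)) (≡.trans (≡.cong (_⊹ (u · y ⊹ ~ x)) o) (rhs u y x)))
    on⇐ : ∀ ℓ P → onLine (line ℓ) P ≡ true → On ℓ P
    on⇐ (vertical c) (u , v) o = true-⌊⌋ (u ≟ c) o
    on⇐ (sloped y x) (u , v) o = +-cancelʳ (u · y ⊹ ~ x)
      (≡.trans (lhs u v y x) (≡.trans (true-⌊⌋ (v ⊹ ~ x ≟ y · u) o) (≡.sym (rhs u y x))))

  -- The point (a , b) gets the coordinates u = b - m a, v = a, so that the line v = y u + x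
  -- has slope m + 1/y in the old coordinates, and is vertical for y = 0.
  chart-fin : ∀ m → Chart (fin m)
  chart-fin m = record
    { φ = φ ; φ-injective = φ-injective
    ; dir = λ y → dir y (y ≟ 0ₚ) ; dir-injective = λ {y} {y′} → dir-injective y y′ (y ≟ 0ₚ) (y′ ≟ 0ₚ)
    ; dir≢base = λ y → dir≢base y (y ≟ 0ₚ)
    ; line = line ; line-slope = line-slope
    ; on⇒ = λ { (vertical c) → on⇒-vertical c ; (sloped y x) → on⇒ y x (y ≟ 0ₚ) }
    ; on⇐ = λ { (vertical c) → on⇐-vertical c ; (sloped y x) → on⇐ y x (y ≟ 0ₚ) } }
    where
    φ : Point p → Pt
    φ (a , b) = b ⊹ (~ m) · a , a
    φ-injective : ∀ {P Q} → φ P ≡ φ Q → P ≡ Q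
    φ-injective {a , b} {a′ , b′} e = ≡.cong₂ _,_ a≡a′ (+-cancelʳ ((~ m) · a) (≡.trans (≡.cong proj₁ e) (≡.cong (λ z → b′ ⊹ (~ m) · z) (≡.sym a≡a′))))
      where
      a≡a′ : a ≡ a′
      a≡a′ = ≡.cong proj₂ e

    inv : ∀ {y} → y ≢ 0ₚ → Fin p
    inv y≢0 = proj₁ (inverse prime _ y≢0)
    inv-spec : ∀ {y} (y≢0 : y ≢ 0ₚ) → y · inv y≢0 ≡ 1ₚ
    inv-spec y≢0 = proj₂ (inverse prime _ y≢0)

    dir : ∀ y → Dec (y ≡ 0ₚ) → Direction p
    dir y (yes _)  = ∞
    dir y (no y≢0) = fin (m ⊹ inv y≢0)

    fin-injective : ∀ {a b : Fin p} → fin a ≡ fin b → a ≡ b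
    fin-injective ≡.refl = ≡.refl

    dir-injective : ∀ y y′ d d′ → dir y d ≡ dir y′ d′ → y ≡ y′
    dir-injective y y′ (yes e)  (yes e′)  _ = ≡.trans e (≡.sym e′)
    dir-injective y y′ (no y≢0) (no y′≢0) e = begin
      y                   ≡⟨ KR.*-identityʳ y ⟨
      y · 1ₚ              ≡⟨ ≡.cong (y ·_) (inv-spec y′≢0) ⟨
      y · (y′ · w′)       ≡⟨ KS.solve 3 (λ a b c → a KS.:* (b KS.:* c) KS.:= (a KS.:* c) KS.:* b) ≡.refl y y′ w′ ⟩
      y · w′ · y′         ≡⟨ ≡.cong (λ z → y · z · y′) w≡w′ ⟨
      y · inv y≢0 · y′    ≡⟨ ≡.cong (_· y′) (inv-spec y≢0) ⟩
      1ₚ · y′             ≡⟨ KR.*-identityˡ y′ ⟩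
      y′                  ∎
      where
      open ≡.≡-Reasoning
      w′ : Fin p
      w′ = inv y′≢0
      w≡w′ : inv y≢0 ≡ w′
      w≡w′ = +-cancelʳ m (≡.trans (KR.+-comm _ m) (≡.trans (fin-injective e) (KR.+-comm m _)))

    dir≢base : ∀ y d → fin m ≢ dir y d
    dir≢base y (no y≢0) e = FiniteField.1≢0 𝔽 (≡.trans (≡.sym (inv-spec y≢0)) (≡.trans (≡.cong (y ·_) w≡0) (KR.zeroʳ y)))
      where
      w≡0 : inv y≢0 ≡ 0ₚ
      w≡0 = +-cancelʳ m (≡.trans (KR.+-comm _ m) (≡.trans (≡.sym (fin-injective e)) (≡.sym (KR.+-identityˡ m))))

    -- Solving a = y (b - m a) + x for b gives b = (m + w) a - x w with w = 1/y; for y = 0 the line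
    -- is a = x.
    sline : ∀ y → Fin p → Dec (y ≡ 0ₚ) → Line p
    sline y x (yes _)  = vert x
    sline y x (no y≢0) = nonvert (m ⊹ inv y≢0) (x · inv y≢0)

    line : CLine → Line p
    line (vertical c) = nonvert m (~ c)
    line (sloped y x) = sline y x (y ≟ 0ₚ)

    line-slope : ∀ y x → slope (line (sloped y x)) ≡ dir y (y ≟ 0ₚ)
    line-slope y x with y ≟ 0ₚ
    ... | yes _ = ≡.refl
    ... | no _  = ≡.refl

    lhsᵥ : ∀ a b c → (b ⊹ (~ m) · a) ⊹ (m · a ⊹ ~ c) ≡ b ⊹ ~ c
    lhsᵥ a b c = KS.solve 4 (λ a b c m → (b KS.:+ (KS.:- m) KS.:* a) KS.:+ (m KS.:* a KS.:+ KS.:- c) KS.:= b KS.:+ KS.:- c) ≡.refl a b c m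
    rhsᵥ : ∀ a c → c ⊹ (m · a ⊹ ~ c) ≡ m · a
    rhsᵥ a c = KS.solve 3 (λ a c m → c KS.:+ (m KS.:* a KS.:+ KS.:- c) KS.:= m KS.:* a) ≡.refl a c m

    on⇒-vertical : ∀ c P → On (vertical c) (φ P) → onLine (line (vertical c)) P ≡ true
    on⇒-vertical c (a , b) o = ⌊⌋-true (b ⊹ ~ c ≟ m · a)
      (≡.trans (≡.sym (lhsᵥ a b c)) (≡.trans (≡.cong (_⊹ (m · a ⊹ ~ c)) o) (rhsᵥ a c)))
    on⇐-vertical : ∀ c P → onLine (line (vertical c)) P ≡ true → On (vertical c) (φ P)
    on⇐-vertical c (a , b) o = +-cancelʳ (m · a ⊹ ~ c)
      (≡.trans (lhsᵥ a b c) (≡.trans (true-⌊⌋ (b ⊹ ~ c ≟ m · a) o) (≡.sym (rhsᵥ a c))))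

    val-0 : ∀ {y} u v → y ≡ 0ₚ → val y (u , v) ≡ v
    val-0 u v ≡.refl = ≡.trans (≡.cong (v ⊹_) (KR.zeroʳ (~ u))) (KR.+-identityʳ v)

    -- (x - (a - (b - m a) y)) w = x w + b - (m + w) a when y w = 1.
    relation : ∀ {y} (y≢0 : y ≢ 0ₚ) a b x → (x ⊹ ~ val y (φ (a , b))) · inv y≢0 ≡ (b ⊹ x · inv y≢0) ⊹ ~ ((m ⊹ inv y≢0) · a)
    relation {y} y≢0 a b x = ≡.trans
      (KS.solve 6 (λ y w a b x m → (x KS.:+ KS.:- (a KS.:+ (KS.:- (b KS.:+ (KS.:- m) KS.:* a)) KS.:* y)) KS.:* w
         KS.:= x KS.:* w KS.:+ KS.:- (w KS.:* a) KS.:+ (b KS.:+ (KS.:- m) KS.:* a) KS.:* (y KS.:* w)) ≡.refl y w a b x m)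
      (≡.trans (≡.cong (λ z → x · w ⊹ ~ (w · a) ⊹ (b ⊹ (~ m) · a) · z) (inv-spec y≢0))
        (≡.trans (≡.cong (x · w ⊹ ~ (w · a) ⊹_) (KR.*-identityʳ _))
          (KS.solve 5 (λ w a b x m → x KS.:* w KS.:+ KS.:- (w KS.:* a) KS.:+ (b KS.:+ (KS.:- m) KS.:* a) KS.:= (b KS.:+ x KS.:* w) KS.:+ KS.:- ((m KS.:+ w) KS.:* a)) ≡.refl w a b x m)))
      where
      w : Fin p
      w = inv y≢0

    on⇒ : ∀ y x d P → On (sloped y x) (φ P) → onLine (sline y x d) P ≡ true
    on⇒ y x (yes y≡0) (a , b) o = ⌊⌋-true (a ≟ x) (≡.trans (≡.sym (val-0 (b ⊹ (~ m) · a) a y≡0)) o)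
    on⇒ y x (no y≢0)  (a , b) o = ⌊⌋-true (b ⊹ x · inv y≢0 ≟ (m ⊹ inv y≢0) · a)
      (x-y≡0⇒x≡y (≡.trans (≡.sym (relation y≢0 a b x)) (≡.trans (≡.cong (λ z → (x ⊹ ~ z) · inv y≢0) o)
        (≡.trans (≡.cong (_· inv y≢0) (KR.-‿inverseʳ x)) (KR.zeroˡ (inv y≢0))))))

    on⇐ : ∀ y x d P → onLine (sline y x d) P ≡ true → On (sloped y x) (φ P)
    on⇐ y x (yes y≡0) (a , b) o = ≡.trans (val-0 (b ⊹ (~ m) · a) a y≡0) (true-⌊⌋ (a ≟ x) o)
    on⇐ y x (no y≢0)  (a , b) o = ≡.sym (x-y≡0⇒x≡y {x} {val y (φ (a , b))} (*-cancelˡ-0 w≢0 (≡.trans (KR.*-comm (inv y≢0) (x ⊹ ~ val y (φ (a , b)))) (≡.trans (relation y≢0 a b x)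
        (≡.trans (≡.cong (_⊹ ~ ((m ⊹ inv y≢0) · a)) (true-⌊⌋ (b ⊹ x · inv y≢0 ≟ (m ⊹ inv y≢0) · a) o)) (KR.-‿inverseʳ ((m ⊹ inv y≢0) · a)))))))
      where
      w≢0 : inv y≢0 ≢ 0ₚ
      w≢0 e = FiniteField.1≢0 𝔽 (≡.trans (≡.sym (inv-spec y≢0)) (≡.trans (≡.cong (y ·_) e) (KR.zeroʳ y)))

  SpecialLine : PointSet p → Line p → Set
  SpecialLine U ℓ = Rich U ℓ ⊎ Poor U ℓ

  specialLine? : ∀ U ℓ → Dec (SpecialLine U ℓ)
  specialLine? U ℓ = (card U ℕ.+ p ℕ.≤? p ℕ.* cardOn ℓ U) ⊎-dec (p ℕ.* cardOn ℓ U ℕ.+ p ℕ.≤? card U)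

  module InChart {base : Direction p} (chart : Chart base) (U : PointSet p) where
    open Chart chart

    SpecialSlope : Fin p → Set
    SpecialSlope y = Any (λ x → SpecialLine U (line (sloped y x))) els

    specialSlope? : ∀ y → Dec (SpecialSlope y)
    specialSlope? y = any? (λ x → specialLine? U (line (sloped y x))) els

    special ordinary : List (Fin p)
    special  = filter specialSlope? els
    ordinary = filter (¬? ∘ specialSlope?) els

    D : ℕ
    D = length special

    directions : List (Direction p)
    directions = base ∷ map dir special

    directions-unique : Unique directions
    directions-unique = All.map⁺ (All.tabulate λ {y} _ → dir≢base y) ∷ Unique.map⁺ dir-injective (Unique.filter⁺ specialSlope? els-unique)

    directions-special : Special U base → All (Special U) directions
    directions-special b = b ∷ All.map⁺ (All.map to (All.all-filter specialSlope? els))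
      where
      to : ∀ {y} → SpecialSlope y → Special U (dir y)
      to {y} s = let (x , h) = Any.satisfied s in line (sloped y x) , line-slope y x , h

    V : List Pt
    V = map φ (points U)

    cardOn≡count : ∀ y x → cardOn (line (sloped y x)) U ≡ count x (map (val y) V)
    cardOn≡count y x = ≡.trans (length-filterᵇ _ (allPoints p)) (≡.trans (go (allPoints p)) (≡.sym (count≡countOn y x V)))
      where
      go : ∀ xs → length (filterᵇ (λ z → onLine (line (sloped y x)) z ∧ U z) xs) ≡ countOn (sloped y x) (map φ (filterᵇ U xs))
      go []       = ≡.refl
      go (z ∷ xs) with U z
      go (z ∷ xs) | false with onLine (line (sloped y x)) z
      ... | true  = go xs
      ... | false = go xs
      go (z ∷ xs) | true with onLine (line (sloped y x)) z in eq | val y (φ z) ≟ x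
      ... | true  | yes _ = ≡.cong suc (go xs)
      ... | false | no _  = go xs
      ... | true  | no ne = contradiction (on⇐ (sloped y x) z eq) ne
      ... | false | yes o = contradiction (≡.trans (≡.sym eq) (on⇒ (sloped y x) z o)) λ ()

    module _ {n r : ℕ} (r<p : r < p) (size : card U ℕ.+ r ≡ n ℕ.* p) where

      -- With #U = np - r the threshold θ + 1 is n + 1 - r/p, which n + 1 points reach.
      not-rich : ∀ c → ¬ (card U ℕ.+ p ≤ p ℕ.* c) → c ≤ n
      not-rich c h = ℕ.≮⇒≥ λ n<c → h (begin
        card U ℕ.+ p   ≤⟨ ℕ.+-monoˡ-≤ p (≡.subst (card U ≤_) size (ℕ.m≤m+n (card U) r)) ⟩
        n ℕ.* p ℕ.+ p  ≡⟨ ≡.trans (ℕ.+-comm (n ℕ.* p) p) (ℕ.*-comm (suc n) p) ⟩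
        p ℕ.* suc n    ≤⟨ ℕ.*-monoʳ-≤ p n<c ⟩
        p ℕ.* c        ∎)
        where open ℕ.≤-Reasoning

      -- The threshold θ - 1 is n - 1 - r/p, and this is above n - 2 because r < p.
      not-poor : ∀ c → ¬ (p ℕ.* c ℕ.+ p ≤ card U) → n ≤ suc c
      not-poor c h = ℕ.≮⇒≥ λ 1+c<n → h (ℕ.+-cancelʳ-≤ r _ _ (begin
        p ℕ.* c ℕ.+ p ℕ.+ r   ≤⟨ ℕ.+-monoʳ-≤ (p ℕ.* c ℕ.+ p) (ℕ.<⇒≤ r<p) ⟩
        p ℕ.* c ℕ.+ p ℕ.+ p   ≡⟨ eq p c ⟩
        suc (suc c) ℕ.* p     ≤⟨ ℕ.*-monoˡ-≤ p 1+c<n ⟩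
        n ℕ.* p               ≡⟨ size ⟨
        card U ℕ.+ r          ∎))
        where
        open ℕ.≤-Reasoning
        eq : ∀ p c → p ℕ.* c ℕ.+ p ℕ.+ p ≡ suc (suc c) ℕ.* p
        eq = solve-∀

      -- Lines of ordinary slope have n - 1 or n points, which is the input of `covering`; the lines
      -- it finds are carried back through the chart.
      few-special⇒covered : suc n ℕ.* D ℕ.+ r ≤ p → CoveredByLines n U
      few-special⇒covered hD = convert (covering ordinary (Unique.filter⁺ _ els-unique) D split n r V
          (Unique.map⁺ φ-injective (points-unique U))
          (≡.trans (≡.cong (ℕ._+ r) (≡.trans (List.length-map φ (points U)) (≡.sym (card≡length U)))) (≡.trans size (≡.cong (n ℕ.*_) (≡.sym p′≡p))))
          (≡.subst (suc n ℕ.* D ℕ.+ r ≤_) (≡.sym p′≡p) hD) (≡.subst (r <_) (≡.sym p′≡p) r<p) counts)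
        where
        split : length ordinary ℕ.+ D ≡ p′
        split = ≡.trans (ℕ.+-comm (length ordinary) D) (≡.sym (length-partition specialSlope? els))
        counts : ∀ y → y ∈ ordinary → ∀ x → count x (map (val y) V) ≤ n × n ≤ suc (count x (map (val y) V))
        counts y y∈ x = ≡.subst (λ c → c ≤ n × n ≤ suc c) (cardOn≡count y x)
            (not-rich _ (λ h → ns (inj₁ h)) , not-poor _ (λ h → ns (inj₂ h)))
          where
          ns : ¬ SpecialLine U (line (sloped y x))
          ns s = proj₂ (∈-filter⁻ (¬? ∘ specialSlope?) {xs = els} y∈) (Any.map (λ { ≡.refl → s }) (∈-els x))
        convert : Covered n V → CoveredByLines n U
        convert (ls , ≡.refl , h) = (λ i → line (lookup ls i)) , λ x Ux →
          let a = h (φ x) (∈-map⁺ φ (∈-points U x Ux)) in Any.index a , on⇒ _ x (All-lookup a)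
          where
          All-lookup : ∀ {x ls} (a : Any (λ ℓ → On ℓ (φ x)) ls) → On (lookup ls (Any.index a)) (φ x)
          All-lookup (here o)  = o
          All-lookup (there a) = All-lookup a

      -- The numerator is (p - r + 1) + (n + 1), so the ceiling is 1 + ⌈(p - r + 1)/(n + 1)⌉, and p
      -- - r < (n + 1) D bounds it by 1 + D.
      enough-directions : p < suc n ℕ.* D ℕ.+ r → ⌈ p ℕ.+ n ℕ.+ 2 ∸ r / suc n ⌉ ≤ length directions
      enough-directions lt = ≡.subst (⌈ p ℕ.+ n ℕ.+ 2 ∸ r / suc n ⌉ ≤_) (≡.cong suc (≡.sym (List.length-map dir special)))
          (ℕ.≤-pred (ℕ.m<n*o⇒m/o<n {n = suc (suc D)} {o = suc n} bound))
        where
        q : ℕ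
        q = p ∸ r
        q+r≡p : q ℕ.+ r ≡ p
        q+r≡p = ℕ.m∸n+n≡m (ℕ.<⇒≤ r<p)
        numerator : p ℕ.+ n ℕ.+ 2 ∸ r ≡ q ℕ.+ n ℕ.+ 2
        numerator = ≡.trans (≡.cong (_∸ r) (≡.trans (≡.cong (λ z → z ℕ.+ n ℕ.+ 2) (≡.sym q+r≡p)) (eq q r n))) (ℕ.m+n∸n≡m _ r)
          where
          eq : ∀ q r n → q ℕ.+ r ℕ.+ n ℕ.+ 2 ≡ q ℕ.+ n ℕ.+ 2 ℕ.+ r
          eq = solve-∀
        q<[1+n]D : q < suc n ℕ.* D
        q<[1+n]D = ℕ.+-cancelʳ-< r _ _ (≡.subst (_< suc n ℕ.* D ℕ.+ r) (≡.sym q+r≡p) lt)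
        open ℕ.≤-Reasoning
        bound : p ℕ.+ n ℕ.+ 2 ∸ r ℕ.+ suc n ∸ 1 < suc (suc D) ℕ.* suc n
        bound = begin-strict
          p ℕ.+ n ℕ.+ 2 ∸ r ℕ.+ suc n ∸ 1        ≡⟨ ≡.cong (λ z → z ℕ.+ suc n ∸ 1) numerator ⟩
          q ℕ.+ n ℕ.+ 2 ℕ.+ suc n ∸ 1            ≡⟨ ≡.trans (≡.cong (_∸ 1) (eq₁ q n)) (ℕ.m+n∸n≡m (q ℕ.+ 2 ℕ.* suc n) 1) ⟩
          q ℕ.+ 2 ℕ.* suc n                      <⟨ ℕ.+-monoˡ-< (2 ℕ.* suc n) q<[1+n]D ⟩
          suc n ℕ.* D ℕ.+ 2 ℕ.* suc n            ≡⟨ eq₂ n D ⟩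
          suc (suc D) ℕ.* suc n                  ∎
          where
          eq₁ : ∀ q n → q ℕ.+ n ℕ.+ 2 ℕ.+ suc n ≡ q ℕ.+ 2 ℕ.* suc n ℕ.+ 1
          eq₁ = solve-∀
          eq₂ : ∀ n D → suc n ℕ.* D ℕ.+ 2 ℕ.* suc n ≡ suc (suc D) ℕ.* suc n
          eq₂ = solve-∀

      conclude : Special U base → ¬ CoveredByLines n U →
        Σ (List (Direction p)) λ ds → Unique ds × All (Special U) ds × ⌈ p ℕ.+ n ℕ.+ 2 ∸ r / suc n ⌉ ≤ length ds
      conclude b nc = directions , directions-unique , directions-special b ,
        enough-directions (ℕ.≰⇒> λ hD → nc (few-special⇒covered hD))

  special-vertical? : ∀ U → Dec (Any (λ c → SpecialLine U (vert c)) els)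
  special-vertical? U = any? (λ c → specialLine? U (vert c)) els

open import Data.Nat using (_+_; _*_)

theorem1p3 : (p : ℕ) → .{{_ : NonZero p}} → Prime p →
    (n r : ℕ) → 1 ≤ n → n ≤ p → r < p →
    (U : PointSet p) → card U + r ≡ n * p →
    ¬ CoveredByLines n U →
    Σ (List (Direction p)) λ ds →
    Unique ds × All (Special U) ds × ⌈ p + n + 2 ∸ r / suc n ⌉ ≤ length ds
theorem1p3 p pr n r 1≤n n≤p r<p U size nc = result (special-vertical? U) (any? (InChart.specialSlope? chart-∞ U) (allFin p))
  where
  open Directions p pr
  result : Dec (Any (λ c → SpecialLine U (vert c)) (allFin p)) → Dec (Any (InChart.SpecialSlope chart-∞ U) (allFin p)) →
    Σ (List (Direction p)) λ ds → Unique ds × All (Special U) ds × ⌈ p ℕ.+ n ℕ.+ 2 ∸ r / suc n ⌉ ≤ length ds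
  result (yes s) _ = let (c , h) = Any.satisfied s in InChart.conclude chart-∞ U r<p size (vert c , ≡.refl , h) nc
  result (no _) (yes s) = let (m , s′) = Any.satisfied s ; (x , h) = Any.satisfied s′ in
    InChart.conclude (chart-fin m) U r<p size (_ , ≡.refl , h) nc
  -- Without any special direction D is 0, the covering criterion reads r ≤ p, and U would be
  -- covered.
  result (no _) (no none) = contradiction (InChart.few-special⇒covered chart-∞ U r<p size few) nc
    where
    D≡0 : InChart.D chart-∞ U ≡ 0
    D≡0 = ≡.cong length (List.filter-none (InChart.specialSlope? chart-∞ U) (All.tabulate λ {y} y∈ s → none (Any.map (λ { ≡.refl → s }) y∈)))
    few : suc n ℕ.* InChart.D chart-∞ U ℕ.+ r ≤ p
    few = ℕ.≤-trans (ℕ.≤-reflexive (≡.cong (ℕ._+ r) (≡.trans (≡.cong (suc n ℕ.*_) D≡0) (ℕ.*-zeroʳ (suc n))))) (ℕ.<⇒≤ r<p)
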